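{- Let $d \geq 3$ be an integer. (a) If $n \in [2d+1, 4d-1]$ is an odd integer, then $\underline{sa}_d^s(n) = 2d$. (b) If $n$ is an integer with $d+2 \leq n \leq 2d-1$, then $\underline{sa}_d^s(n) \geq 2d$. (c) If $X \in \mathcal{C}_d^s(2d)$, then either $P = \operatorname{conv} X$ is a cross-polytope, and then $sa(X) = d$, or else $sa(X) \geq 2d$.
   Context: Let $X=\{x_1,\dots,x_n\}\subset\mathbb{R}^d$ be a finite set (with $x_i\neq x_j$ for $i\ne j$) whose affine hull is $\mathbb{R}^d$, and let $P=\operatorname{conv}X$. Two distinct points $x_i,x_j\in X$ are strictly antipodal (in $X$) if there are different parallel supporting hyperplanes $H',H''$ of $P$ with $X\cap H'=\{x_i\}$ and $X\cap H''=\{x_j\}$. $sa(X)$ is the number of (unordered) strictly antipodal pairs of $X$. $X$ is in strictly convex position if $X=\operatorname{vert}P$ (the vertex set of $P$). $\mathcal{C}_d^s(n)$ is the family of all $X\subset\mathbb{R}^d$ with $|X|=n$, $\operatorname{aff}X=\mathbb{R}^d$, $X$ in strictly convex position, and $\underline{sa}_d^s(n):=\min\{sa(X)\mid X\in\mathcal{C}_d^s(n)\}$. A cross-polytope in $\mathbb{R}^d$ is understood in the affine sense: $\operatorname{conv}\{p\pm v_i\mid 1\le i\le d\}$ with $v_1,\dots,v_d$ linearly independent. -}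

module Defs where

open import Level using (0ℓ; suc)
open import Algebra.Bundles using (CommutativeRing)
open import Axiom.ExcludedMiddle using (ExcludedMiddle)
open import Data.Nat.Base as ℕ using (ℕ)
open import Data.Fin.Base using (Fin)
open import Data.Fin.Properties using () renaming (_<?_ to _<ᶠ?_)
open import Data.List.Base using (length; filter; allFin; cartesianProduct)
open import Data.Product.Base using (Σ-syntax; ∃; ∃-syntax; _×_; _,_)
open import Data.Sum.Base using (_⊎_)
open import Data.Vec.Functional using (Vector; _++_)
import Data.Vec.Functional.Relation.Binary.Equality.Setoid as VecEquality
import Algebra.Properties.Monoid.Sum as MonoidSum
open import Function.Definitions using (Injective)
open import Relation.Binary.Core using (Rel)
open import Relation.Binary.PropositionalEquality.Core using (_≡_; _≢_)
open import Relation.Binary.Structures using (IsTotalOrder)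
open import Relation.Nullary using (¬_)
open import Relation.Unary using (Pred; _∩_; _≐_; _∈_)

-- The real numbers, given by their characterisation (unique up to isomorphism)
-- as a Dedekind-complete ordered field.
record RealField : Set (suc 0ℓ) where
  infix 4 _≤_
  field
    commutativeRing : CommutativeRing 0ℓ 0ℓ
  open CommutativeRing commutativeRing public
  field
    _≤_          : Rel Carrier 0ℓ
    0≉1          : ¬ (0# ≈ 1#)
    inverse      : ∀ x → ¬ (x ≈ 0#) → ∃[ y ] x * y ≈ 1#
    isTotalOrder : IsTotalOrder _≈_ _≤_
    +-monoˡ-≤    : ∀ z {x y} → x ≤ y → x + z ≤ y + z
    *-nonneg     : ∀ {x y} → 0# ≤ x → 0# ≤ y → 0# ≤ x * y

  UpperBound : Pred Carrier 0ℓ → Pred Carrier 0ℓ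
  UpperBound S b = ∀ x → x ∈ S → x ≤ b

  field
    supremum : (S : Pred Carrier 0ℓ) → ∃ S → ∃ (UpperBound S) →
               ∃[ s ] UpperBound S s × (∀ b → UpperBound S b → s ≤ b)

IsMinimum : Pred ℕ 0ℓ → ℕ → Set
IsMinimum S m = m ∈ S × (∀ k → k ∈ S → m ℕ.≤ k)

-- Excluded middle is needed only so that strictly antipodal pairs can be counted
-- by a function.
module Geometry (em : ExcludedMiddle 0ℓ) (ℝ : RealField) where

  open RealField ℝ
  open MonoidSum +-monoid using (sum-syntax)
  open VecEquality setoid using (_≋_) public

  Point : ℕ → Set
  Point d = Vector Carrier d

  infixl 6 _+ᵥ_ _-ᵥ_
  infixl 7 _*ᵥ_ _∙_

  0ᵥ : ∀ {d} → Point d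
  0ᵥ _ = 0#

  _+ᵥ_ _-ᵥ_ : ∀ {d} → Point d → Point d → Point d
  (p +ᵥ q) k = p k + q k
  (p -ᵥ q) k = p k - q k

  _*ᵥ_ : ∀ {d} → Carrier → Point d → Point d
  (t *ᵥ p) k = t * p k

  _∙_ : ∀ {d} → Point d → Point d → Carrier
  _∙_ {d} p q = ∑[ k < d ] (p k * q k)

  combination : ∀ {d n} → Vector Carrier n → Vector (Point d) n → Point d
  combination {n = n} w x k = ∑[ i < n ] (w i * x i k)

  range : ∀ {d n} → Vector (Point d) n → Pred (Point d) 0ℓ
  range x p = ∃[ i ] x i ≋ p

  ⟦_⟧ : ∀ {d} → Point d → Pred (Point d) 0ℓ
  ⟦ p ⟧ q = p ≋ q

  aff conv : ∀ {d n} → Vector (Point d) n → Pred (Point d) 0ℓ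
  aff {n = n} x p =
    Σ[ w ∈ Vector Carrier n ] ∑[ i < n ] w i ≈ 1# × combination w x ≋ p
  conv {n = n} x p =
    Σ[ w ∈ Vector Carrier n ]
      (∀ i → 0# ≤ w i) × ∑[ i < n ] w i ≈ 1# × combination w x ≋ p

  LinearlyIndependent : ∀ {d n} → Vector (Point d) n → Set
  LinearlyIndependent v = ∀ w → combination w v ≋ 0ᵥ → ∀ i → w i ≈ 0#

  record Hyperplane (d : ℕ) : Set where
    field
      normal   : Point d
      offset   : Carrier
      normal≉0 : ¬ (normal ≋ 0ᵥ)

  open Hyperplane public

  points : ∀ {d} → Hyperplane d → Pred (Point d) 0ℓ
  points H p = normal H ∙ p ≈ offset H

  -- t is automatically nonzero, because both normals are.
  Parallel : ∀ {d} → Hyperplane d → Hyperplane d → Set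
  Parallel H H′ = ∃[ t ] normal H′ ≋ t *ᵥ normal H

  Supports : ∀ {d} → Hyperplane d → Pred (Point d) 0ℓ → Set
  Supports H P =
    (∃[ p ] p ∈ (P ∩ points H)) ×
    ((∀ p → p ∈ P → normal H ∙ p ≤ offset H) ⊎
     (∀ p → p ∈ P → offset H ≤ normal H ∙ p))

  -- Vertices are the zero-dimensional faces, cut out by supporting hyperplanes.
  vert : ∀ {d} → Pred (Point d) 0ℓ → Pred (Point d) 0ℓ
  vert {d} P v = Σ[ H ∈ Hyperplane d ] Supports H P × (P ∩ points H) ≐ ⟦ v ⟧

  IsCrossPolytope : ∀ {d} → Pred (Point d) 0ℓ → Set
  IsCrossPolytope {d} P =
    Σ[ p ∈ Point d ] Σ[ v ∈ Vector (Point d) d ]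
      LinearlyIndependent v ×
      P ≐ conv ((λ i → p +ᵥ v i) ++ (λ i → p -ᵥ v i))

  -- A finite set X of n points is represented by an injective family x of
  -- n points enumerating it.

  StrictlyAntipodal : ∀ {d n} → Vector (Point d) n → Fin n → Fin n → Set
  StrictlyAntipodal {d} x i j =
    i ≢ j ×
    Σ[ H ∈ Hyperplane d ] Σ[ H′ ∈ Hyperplane d ]
      Parallel H H′ × ¬ (points H ≐ points H′) ×
      Supports H (conv x) × Supports H′ (conv x) ×
      (range x ∩ points H) ≐ ⟦ x i ⟧ × (range x ∩ points H′) ≐ ⟦ x j ⟧

  -- Each unordered pair is counted once, through its representative with i < j.
  sa : ∀ {d n} → Vector (Point d) n → ℕ
  sa {n = n} x =
    length (filter (λ (i , j) → em {P = StrictlyAntipodal x i j})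
             (filter (λ (i , j) → i <ᶠ? j)
               (cartesianProduct (allFin n) (allFin n))))

  record StrictlyConvexConfiguration {d n} (x : Vector (Point d) n) : Set where
    field
      distinct         : Injective _≡_ _≋_ x
      affinelySpanning : ∀ p → p ∈ aff x
      strictlyConvex   : range x ≐ vert (conv x)

  -- { sa(X) ∣ X ⊂ ℝᵈ, ∣X∣ = n, aff X = ℝᵈ, X in strictly convex position }
  saValues : (d n : ℕ) → Pred ℕ 0ℓ
  saValues d n m =
    Σ[ x ∈ Vector (Point d) n ] StrictlyConvexConfiguration x × sa x ≡ m

{-# OPTIONS --safe #-}
module Submission where

-- Let x i , y i enumerate the strictly antipodal pairs of X.  Any linear functional
-- u in general position attains its extremes over X at such a pair, so the vectors
-- v i = x i - y i and φ i = x i + y i satisfy: if u is maximal over all ± v j at both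
-- ± v a and ± v b, then u ∙ φ a = u ∙ φ b, the same φ being used for both signs.
-- Call this a flex of the polytope conv { ± v i }.  With fewer than 2 d pairs a flex is
-- constant.  Namely, on the vertices of a facet a flex is a homothety, or else the
-- facet has at least 2 (d - 1) vertices, by Shephard's lemma on decomposable polytopes.
-- If every facet is of the second kind, each misses at most one pair, and a linear
-- relation between facet normals forces φ to be constant.  If some facet is of the
-- first kind, then two facets always share a pair, so all facets are homothetic up to
-- sign; a connectedness argument comparing the vertices where the sign is + with
-- those where it is - then finds 2 (d - 1) distinct vertices in a set of at most d.
--
-- When φ is constant, all strictly antipodal pairs have the same midpoint, so X is
-- symmetric about it and n = 2 sa(X), while sa(X) ≥ d always.  Hence n is even, n ≥ 2 d,
-- and X consists of the vertices of a cross-polytope if n = 2 d.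
-- The bound in (a) is attained by erecting caps over two opposite facets of a
-- cross-polytope.

open import Defs
open import Level using (0ℓ)
import Algebra.Properties.AbelianGroup as AbelianGroupProperties
import Algebra.Properties.Ring as RingProperties
import Algebra.Properties.Semiring.Mult as SemiringMult
import Algebra.Properties.Semiring.Sum as SemiringSum
import Algebra.Solver.Ring as RingSolver
open import Algebra.Solver.Ring.AlmostCommutativeRing
  using (AlmostCommutativeRing; fromCommutativeRing; _-Raw-AlmostCommutative⟶_; Induced-equivalence)
open import Axiom.ExcludedMiddle using (ExcludedMiddle)
open import Data.Bool.Base using (Bool; true; false; not)
open import Data.Empty using (⊥; ⊥-elim)
open import Data.Fin.Base as Fin using (Fin; zero; suc; splitAt; _↑ˡ_; _↑ʳ_)
import Data.Fin.Properties as Fin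
open import Data.Fin.Properties using () renaming (_<?_ to _<ᶠ?_)
open import Data.Integer.Base as ℤ using (ℤ; +_; -[1+_]; _⊖_; _◃_)
import Data.Integer.Properties as ℤ
open import Data.List.Base using (List; []; _∷_; _++_; length; map; filter; lookup; allFin; cartesianProduct; tabulate)
open import Data.List.Membership.DecPropositional using () renaming (_∈?_ to ∈?-with)
open import Data.List.Membership.Propositional using (_∈_; _∉_)
open import Data.List.Membership.Propositional.Properties
open import Data.List.Properties using (length-++; length-map; length-tabulate)
open import Data.List.Relation.Binary.Disjoint.Propositional using (Disjoint)
open import Data.List.Relation.Unary.All as All using (All; []; _∷_)
import Data.List.Relation.Unary.All.Properties as All
open import Data.List.Relation.Unary.AllPairs using ([]; _∷_)
open import Data.List.Relation.Unary.Any using (here; there)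
open import Data.List.Relation.Unary.Unique.Propositional using (Unique)
import Data.List.Relation.Unary.Unique.Propositional.Properties as Unique
open import Data.Maybe.Base using (just; nothing)
open import Data.Nat.Base as ℕ using (ℕ; zero; suc; z≤n; s≤s)
open import Data.Nat.DivMod using (_%_; m*n%n≡0)
import Data.Nat.Properties as ℕ
import Data.Nat.Tactic.RingSolver as ℕ
open import Data.Product.Base using (∃; ∃-syntax; Σ-syntax; _×_; _,_; proj₁; proj₂)
open import Data.Sign.Base as Sign using (Sign)
open import Data.Sum.Base using (_⊎_; inj₁; inj₂)
import Data.Vec.Functional as Vector
open import Function.Base using (_∘_; case_of_)
open import Relation.Binary.Definitions using (WeaklyDecidable; tri<; tri≈; tri>)
open import Relation.Binary.PropositionalEquality.Core as ≡ using (_≡_; _≢_)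
import Relation.Binary.Reasoning.Setoid as SetoidReasoning
open import Relation.Binary.Structures using (IsTotalOrder)
open import Relation.Nullary using (¬_; Dec; yes; no)
open import Relation.Unary using (_∩_; _≐_)

-- The obstacle is the sign in "homothetic up to sign". Both v i and - v i carry φ i, so two facets
-- that share a pair through opposite vertices have opposite ratios. If the ratio λ of one facet is
-- zero, φ vanishes everywhere after a translation. Otherwise the vertices z with φ = λ z form a
-- class S of at least d members, and no nonzero functional is maximal both on S and on - S. On a
-- line of functionals leading from - S to S, connectedness yields one that is maximal on neither,
-- hence only on the set R of the remaining pairs. Such functionals can be prescribed on enough
-- vectors to show that R has d - 1 pairs, that they are joined like the vertices of a
-- cross-polytope, and that φ is constant on them; so S has at most d members. Each of the 2 (d - 1)
-- vertices ± R has a neighbour in S, and no two have the same one: a vertex at which φ deviates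
-- from a homothety has at most one neighbour at which φ agrees with it.

-- Ordered fields and a ring solver with integer coefficients

module OrderedField (em : ExcludedMiddle 0ℓ) (ℝ : RealField) where

  open RealField ℝ hiding (zero; distrib) renaming (Carrier to K) public
  open IsTotalOrder isTotalOrder public
    using (antisym; total)
    renaming (refl to ≤-refl; trans to ≤-trans; reflexive to ≤-reflexive)
  open RingProperties ring public using (-‿distribˡ-*; -‿distribʳ-*; -‿involutive; -0#≈0#)
  open AbelianGroupProperties +-abelianGroup using (⁻¹-∙-comm)
  open SemiringMult semiring using (×-homo-+; ×1-homo-*) renaming (_×_ to _·_)

  private
    open import Relation.Binary.Reasoning.Setoid setoid

    -- The clause for `suc zero` avoids a trailing `0#`: numerals unfold to plain sums of `1#`, so
    -- that `1-homo` is `refl` and the solver constant `con (+ 4)` means `four` definitionally.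
    fromℕ : ℕ → K
    fromℕ zero          = 0#
    fromℕ (suc zero)    = 1#
    fromℕ (suc (suc n)) = 1# + fromℕ (suc n)

    fromℕ≈ : ∀ n → fromℕ n ≈ n · 1#
    fromℕ≈ zero          = refl
    fromℕ≈ (suc zero)    = sym (+-identityʳ 1#)
    fromℕ≈ (suc (suc n)) = +-congˡ (fromℕ≈ (suc n))

    fromℕ-suc : ∀ n → fromℕ (suc n) ≈ 1# + fromℕ n
    fromℕ-suc zero    = sym (+-identityʳ 1#)
    fromℕ-suc (suc n) = refl

    fromℕ-+ : ∀ m n → fromℕ (m ℕ.+ n) ≈ fromℕ m + fromℕ n
    fromℕ-+ m n = begin
      fromℕ (m ℕ.+ n)        ≈⟨ fromℕ≈ (m ℕ.+ n) ⟩
      (m ℕ.+ n) · 1#         ≈⟨ ×-homo-+ 1# m n ⟩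
      m · 1# + n · 1#        ≈⟨ +-cong (fromℕ≈ m) (fromℕ≈ n) ⟨
      fromℕ m + fromℕ n      ∎

    fromℕ-* : ∀ m n → fromℕ (m ℕ.* n) ≈ fromℕ m * fromℕ n
    fromℕ-* m n = begin
      fromℕ (m ℕ.* n)        ≈⟨ fromℕ≈ (m ℕ.* n) ⟩
      (m ℕ.* n) · 1#         ≈⟨ ×1-homo-* m n ⟩
      m · 1# * n · 1#        ≈⟨ *-cong (fromℕ≈ m) (fromℕ≈ n) ⟨
      fromℕ m * fromℕ n      ∎

    fromℤ : ℤ → K
    fromℤ (+ n)    = fromℕ n
    fromℤ -[1+ n ] = - fromℕ (suc n)

    cancel : ∀ a b c → (a + b) - (a + c) ≈ b - c
    cancel a b c = begin
      (a + b) - (a + c)       ≈⟨ +-congˡ (⁻¹-∙-comm a c) ⟨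
      (a + b) + (- a - c)     ≈⟨ +-congʳ (+-comm a b) ⟩
      (b + a) + (- a - c)     ≈⟨ +-assoc b a _ ⟩
      b + (a + (- a - c))     ≈⟨ +-congˡ (+-assoc a (- a) (- c)) ⟨
      b + ((a - a) - c)       ≈⟨ +-congˡ (+-congʳ (-‿inverseʳ a)) ⟩
      b + (0# - c)            ≈⟨ +-congˡ (+-identityˡ _) ⟩
      b - c                   ∎

    ⊖-homo : ∀ m n → fromℤ (m ⊖ n) ≈ fromℕ m - fromℕ n
    ⊖-homo zero    zero    = sym (trans (+-congˡ -0#≈0#) (+-identityˡ 0#))
    ⊖-homo zero    (suc n) = sym (+-identityˡ _)
    ⊖-homo (suc m) zero    = sym (trans (+-congˡ -0#≈0#) (+-identityʳ _))
    ⊖-homo (suc m) (suc n) = begin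
      fromℤ (suc m ⊖ suc n)             ≡⟨ ≡.cong fromℤ (ℤ.[1+m]⊖[1+n]≡m⊖n m n) ⟩
      fromℤ (m ⊖ n)                     ≈⟨ ⊖-homo m n ⟩
      fromℕ m - fromℕ n                 ≈⟨ cancel 1# _ _ ⟨
      (1# + fromℕ m) - (1# + fromℕ n)   ≈⟨ +-cong (fromℕ-suc m) (-‿cong (fromℕ-suc n)) ⟨
      fromℕ (suc m) - fromℕ (suc n)     ∎

    +-homo : ∀ i j → fromℤ (i ℤ.+ j) ≈ fromℤ i + fromℤ j
    +-homo (+ m)    (+ n)    = fromℕ-+ m n
    +-homo (+ m)    -[1+ n ] = ⊖-homo m (suc n)
    +-homo -[1+ m ] (+ n)    = trans (⊖-homo n (suc m)) (+-comm _ _)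
    +-homo -[1+ m ] -[1+ n ] = begin
      - fromℕ (suc (suc (m ℕ.+ n)))        ≡⟨ ≡.cong (λ k → - fromℕ k) (≡.cong suc (ℕ.+-suc m n)) ⟨
      - fromℕ (suc m ℕ.+ suc n)            ≈⟨ -‿cong (fromℕ-+ (suc m) (suc n)) ⟩
      - (fromℕ (suc m) + fromℕ (suc n))    ≈⟨ ⁻¹-∙-comm _ _ ⟨
      - fromℕ (suc m) - fromℕ (suc n)      ∎

    neg◃ : ∀ n → fromℤ (Sign.- ◃ n) ≈ - fromℕ n
    neg◃ zero    = sym -0#≈0#
    neg◃ (suc n) = refl

    pos◃ : ∀ n → fromℤ (Sign.+ ◃ n) ≈ fromℕ n
    pos◃ zero    = refl
    pos◃ (suc n) = refl

    *-homo : ∀ i j → fromℤ (i ℤ.* j) ≈ fromℤ i * fromℤ j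
    *-homo (+ m)    (+ n)    = trans (pos◃ (m ℕ.* n)) (fromℕ-* m n)
    *-homo (+ m)    -[1+ n ] = trans (neg◃ (m ℕ.* suc n))
      (trans (-‿cong (fromℕ-* m (suc n))) (-‿distribʳ-* _ _))
    *-homo -[1+ m ] (+ n)    = trans (neg◃ (suc m ℕ.* n))
      (trans (-‿cong (fromℕ-* (suc m) n)) (-‿distribˡ-* _ _))
    *-homo -[1+ m ] -[1+ n ] = begin
      fromℤ (Sign.+ ◃ suc m ℕ.* suc n)          ≈⟨ fromℕ-* (suc m) (suc n) ⟩
      fromℕ (suc m) * fromℕ (suc n)             ≈⟨ -‿involutive _ ⟨
      - - (fromℕ (suc m) * fromℕ (suc n))       ≈⟨ -‿cong (-‿distribʳ-* _ _) ⟩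
      - (fromℕ (suc m) * - fromℕ (suc n))       ≈⟨ -‿distribˡ-* _ _ ⟩
      - fromℕ (suc m) * - fromℕ (suc n)         ∎

    -‿homo : ∀ i → fromℤ (ℤ.- i) ≈ - fromℤ i
    -‿homo (+ zero)  = sym -0#≈0#
    -‿homo (+ suc n) = refl
    -‿homo -[1+ n ]  = sym (-‿involutive _)

    ring′ : AlmostCommutativeRing 0ℓ 0ℓ
    ring′ = fromCommutativeRing commutativeRing

    morphism : ℤ.+-*-rawRing -Raw-AlmostCommutative⟶ ring′
    morphism = record
      { ⟦_⟧ = fromℤ ; +-homo = +-homo ; *-homo = *-homo ; -‿homo = -‿homo
      ; 0-homo = refl ; 1-homo = refl }

    _≟_ : WeaklyDecidable (Induced-equivalence morphism)
    i ≟ j with i ℤ.≟ j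
    ... | yes ≡.refl = just refl
    ... | no _       = nothing

  open RingSolver ℤ.+-*-rawRing ring′ morphism _≟_ public
    using (Polynomial; solve; _:=_; _:+_; _:-_; _:*_; :-_; con)

  infix 8 :0 :1
  :0 :1 : ∀ {n} → Polynomial n
  :0 = con (+ 0)
  :1 = con (+ 1)

  infix 4 _<_
  _<_ : K → K → Set
  x < y = ¬ (y ≤ x)

  <⇒≤ : ∀ {x y} → x < y → x ≤ y
  <⇒≤ {x} {y} x<y with total x y
  ... | inj₁ x≤y = x≤y
  ... | inj₂ y≤x = ⊥-elim (x<y y≤x)

  ≮⇒≥ : ∀ {x y} → ¬ (x < y) → y ≤ x
  ≮⇒≥ {x} {y} h with em {P = y ≤ x}
  ... | yes p = p
  ... | no ¬p = ⊥-elim (h ¬p)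

  ≤-<-connex : ∀ x y → (x ≤ y) ⊎ (y < x)
  ≤-<-connex x y with em {P = x ≤ y}
  ... | yes p = inj₁ p
  ... | no ¬p = inj₂ ¬p

  <-irrefl : ∀ {x y} → x ≈ y → ¬ (x < y)
  <-irrefl x≈y x<y = x<y (≤-reflexive (sym x≈y))

  ≤∧≉⇒< : ∀ {x y} → x ≤ y → x ≉ y → x < y
  ≤∧≉⇒< x≤y x≉y y≤x = x≉y (antisym x≤y y≤x)

  <-≤-trans : ∀ {x y z} → x < y → y ≤ z → x < z
  <-≤-trans x<y y≤z z≤x = x<y (≤-trans y≤z z≤x)

  ≤-<-trans : ∀ {x y z} → x ≤ y → y < z → x < z
  ≤-<-trans x≤y y<z z≤x = y<z (≤-trans z≤x x≤y)

  <-trans : ∀ {x y z} → x < y → y < z → x < z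
  <-trans x<y y<z = <-≤-trans x<y (<⇒≤ y<z)

  ≤-resp : ∀ {x x′ y y′} → x ≈ x′ → y ≈ y′ → x ≤ y → x′ ≤ y′
  ≤-resp p q x≤y = ≤-trans (≤-reflexive (sym p)) (≤-trans x≤y (≤-reflexive q))

  <-resp : ∀ {x x′ y y′} → x ≈ x′ → y ≈ y′ → x < y → x′ < y′
  <-resp p q x<y y′≤x′ = x<y (≤-resp (sym q) (sym p) y′≤x′)

  <-cmp : ∀ x y → (x < y) ⊎ (x ≈ y) ⊎ (y < x)
  <-cmp x y with ≤-<-connex x y | ≤-<-connex y x
  ... | inj₁ p | inj₁ q = inj₂ (inj₁ (antisym p q))
  ... | inj₂ p | _      = inj₂ (inj₂ p)
  ... | _      | inj₂ q = inj₁ q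

  ≤⇒0≤ : ∀ {x y} → x ≤ y → 0# ≤ y - x
  ≤⇒0≤ {x} x≤y = ≤-resp (-‿inverseʳ x) refl (+-monoˡ-≤ (- x) x≤y)

  0≤⇒≤ : ∀ {x y} → 0# ≤ y - x → x ≤ y
  0≤⇒≤ {x} {y} h = ≤-resp (+-identityˡ x)
    (solve 2 (λ x y → (y :- x) :+ x := y) refl x y) (+-monoˡ-≤ x h)

  <⇒0< : ∀ {x y} → x < y → 0# < y - x
  <⇒0< {x} {y} x<y h = x<y (0≤⇒≤ (≤-resp refl (solve 2 (λ x y → :0 :- (y :- x) := x :- y) refl x y) (≤⇒0≤ h)))

  0<⇒< : ∀ {x y} → 0# < y - x → x < y
  0<⇒< {x} {y} h y≤x = h (0≤⇒≤ (≤-resp refl (solve 2 (λ x y → x :- y := :0 :- (y :- x)) refl x y) (≤⇒0≤ y≤x)))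

  -- Inequalities are proved by certificates: `e` is composed of terms known to be nonnegative, and
  -- the ring solver checks that it equals the difference of the two sides.
  by≤ : ∀ {x y e} → 0# ≤ e → y - x ≈ e → x ≤ y
  by≤ h p = 0≤⇒≤ (≤-resp refl (sym p) h)

  by< : ∀ {x y e} → 0# < e → y - x ≈ e → x < y
  by< h p = 0<⇒< (<-resp refl (sym p) h)

  0≤+0≤ : ∀ {x y} → 0# ≤ x → 0# ≤ y → 0# ≤ x + y
  0≤+0≤ {x} {y} p q = ≤-trans q (≤-resp (+-identityˡ y) refl (+-monoˡ-≤ y p))

  0<+0≤ : ∀ {x y} → 0# < x → 0# ≤ y → 0# < x + y
  0<+0≤ {x} {y} p q = <-≤-trans p (≤-resp (+-identityˡ x) (+-comm y x) (+-monoˡ-≤ x q))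

  0≤+0< : ∀ {x y} → 0# ≤ x → 0# < y → 0# < x + y
  0≤+0< p q = <-resp refl (+-comm _ _) (0<+0≤ q p)

  0<+0< : ∀ {x y} → 0# < x → 0# < y → 0# < x + y
  0<+0< p q = 0<+0≤ p (<⇒≤ q)

  0≤*0≤ : ∀ {x y} → 0# ≤ x → 0# ≤ y → 0# ≤ x * y
  0≤*0≤ = *-nonneg

  0<⇒≉0 : ∀ {x} → 0# < x → x ≉ 0#
  0<⇒≉0 p x≈0 = <-irrefl (sym x≈0) p

  *-zero-divisor : ∀ {x y} → x * y ≈ 0# → x ≉ 0# → y ≈ 0#
  *-zero-divisor {x} {y} xy≈0 x≉0 with inverse x x≉0
  ... | x⁻¹ , eq = begin
    y                ≈⟨ *-identityˡ y ⟨
    1# * y           ≈⟨ *-congʳ eq ⟨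
    x * x⁻¹ * y      ≈⟨ solve 3 (λ x i y → x :* i :* y := i :* (x :* y)) refl x x⁻¹ y ⟩
    x⁻¹ * (x * y)    ≈⟨ *-congˡ xy≈0 ⟩
    x⁻¹ * 0#         ≈⟨ zeroʳ _ ⟩
    0#               ∎

  0<*0< : ∀ {x y} → 0# < x → 0# < y → 0# < x * y
  0<*0< p q = ≤∧≉⇒< (0≤*0≤ (<⇒≤ p) (<⇒≤ q)) λ eq →
    0<⇒≉0 q (*-zero-divisor (sym eq) (0<⇒≉0 p))

  neg<0 : ∀ {x} → x < 0# → 0# < - x
  neg<0 {x} p = <-resp refl (+-identityˡ (- x)) (<⇒0< p)

  neg≤0 : ∀ {x} → x ≤ 0# → 0# ≤ - x
  neg≤0 {x} p = ≤-resp refl (+-identityˡ (- x)) (≤⇒0≤ p)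

  0≤square : ∀ x → 0# ≤ x * x
  0≤square x with total 0# x
  ... | inj₁ p = 0≤*0≤ p p
  ... | inj₂ p = ≤-resp refl (solve 1 (λ x → (:- x) :* (:- x) := x :* x) refl x) (0≤*0≤ (neg≤0 p) (neg≤0 p))

  0<1 : 0# < 1#
  0<1 = ≤∧≉⇒< (≤-resp refl (*-identityˡ 1#) (0≤square 1#)) 0≉1

  0<inverse : ∀ {x} → 0# < x → ∃[ y ] (0# < y) × (x * y ≈ 1#)
  0<inverse {x} p with inverse x (0<⇒≉0 p)
  ... | y , eq with ≤-<-connex y 0#
  ...   | inj₂ q = y , q , eq
  ...   | inj₁ q = ⊥-elim (<-irrefl refl (<-≤-trans 0<1 (by≤ (0≤*0≤ (<⇒≤ p) (neg≤0 q))
            (trans (+-congˡ (-‿cong (sym eq))) (solve 2 (λ x y → :0 :- x :* y := x :* (:- y)) refl x y)))))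

  common-bound : ∀ {x y} → 0# < x → 0# < y → ∃[ z ] (0# < z) × (z ≤ x) × (z ≤ y)
  common-bound {x} {y} p q with total x y
  ... | inj₁ h = x , p , ≤-refl , h
  ... | inj₂ h = y , q , h , ≤-refl

  abstract

    half : ∃[ h ] (0# < h) × (h + h ≈ 1#)
    half with 0<inverse (0<+0< 0<1 0<1)
    ... | h , p , eq = h , p , trans (solve 1 (λ h → h :+ h := (:1 :+ :1) :* h) refl h) eq

-- Counting with lists

-- The pigeonhole principle: the partner of the head is cut out of `ys`, and injectivity keeps the
-- partners of the tail away from it. A relation is used since partners are often known only to
-- exist.
length-injection : {A B : Set} (R : A → B → Set) {xs : List A} (ys : List B) → Unique xs →
  (∀ {x} → x ∈ xs → ∃[ y ] y ∈ ys × R x y) →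
  (∀ {x x′ y} → x ∈ xs → x′ ∈ xs → R x y → R x′ y → x ≡ x′) →
  length xs ℕ.≤ length ys
length-injection R {[]}     ys _ _ _ = z≤n
length-injection R {x ∷ xs} ys (x∉ ∷ xs!) total inj with total (here ≡.refl)
... | y , y∈ys , xRy with ∈-∃++ y∈ys
...   | as , bs , ≡.refl = begin
  suc (length xs)                   ≤⟨ s≤s (length-injection R (as ++ bs) xs! total′ λ p q → inj (there p) (there q)) ⟩
  suc (length (as ++ bs))           ≡⟨ ≡.cong suc (length-++ as) ⟩
  suc (length as ℕ.+ length bs)     ≡⟨ ℕ.+-suc (length as) (length bs) ⟨
  length as ℕ.+ suc (length bs)     ≡⟨ length-++ as ⟨
  length (as ++ y ∷ bs)             ∎
  where
  open ℕ.≤-Reasoning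
  total′ : ∀ {x′} → x′ ∈ xs → ∃[ y′ ] y′ ∈ as ++ bs × R x′ y′
  total′ x′∈ with total (there x′∈)
  ... | y′ , y′∈ , x′Ry′ with ∈-++⁻ as y′∈
  ...   | inj₁ p             = y′ , ∈-++⁺ˡ p , x′Ry′
  ...   | inj₂ (here ≡.refl) = ⊥-elim (All.lookup x∉ x′∈ (inj (here ≡.refl) (there x′∈) xRy x′Ry′))
  ...   | inj₂ (there p)     = y′ , ∈-++⁺ʳ as p , x′Ry′

length-⊆ : {A : Set} {xs ys : List A} → Unique xs → (∀ {x} → x ∈ xs → x ∈ ys) → length xs ℕ.≤ length ys
length-⊆ {ys = ys} xs! ⊆ = length-injection _≡_ ys xs! (λ p → _ , ⊆ p , ≡.refl) λ { _ _ ≡.refl ≡.refl → ≡.refl }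

module Classical (em : ExcludedMiddle 0ℓ) where

  module _ {A : Set} where

    select : (A → Set) → List A → List A
    select P = filter (λ x → em {P = P x})

    ∈-select⁺ : ∀ {P xs x} → x ∈ xs → P x → x ∈ select P xs
    ∈-select⁺ {P} = ∈-filter⁺ (λ x → em {P = P x})

    ∈-select⁻ : ∀ {P} xs {x} → x ∈ select P xs → x ∈ xs × P x
    ∈-select⁻ {P} xs = ∈-filter⁻ (λ x → em {P = P x}) {xs = xs}

    select-unique : ∀ {P xs} → Unique xs → Unique (select P xs)
    select-unique {P} = Unique.filter⁺ (λ x → em {P = P x})

    length-select-< : ∀ {P Q : A → Set} {xs y} → Unique xs →
      (∀ {x} → x ∈ xs → P x → Q x) → y ∈ xs → Q y → ¬ P y →
      length (select P xs) ℕ.< length (select Q xs)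
    length-select-< {P} {Q} {xs} {y} xs! P⊆Q y∈ Qy ¬Py =
      length-⊆ {xs = y ∷ select P xs} (All.tabulate y∉ ∷ select-unique xs!) λ where
        (here ≡.refl) → ∈-select⁺ y∈ Qy
        (there p)     → let x∈ , Px = ∈-select⁻ xs p in ∈-select⁺ x∈ (P⊆Q x∈ Px)
      where
      y∉ : ∀ {x} → x ∈ select P xs → y ≢ x
      y∉ p ≡.refl = ¬Py (proj₂ (∈-select⁻ xs p))

  by-contradiction : {P : Set} → ¬ ¬ P → P
  by-contradiction {P} h with em {P = P}
  ... | yes p = p
  ... | no ¬p = ⊥-elim (h ¬p)

-- Linear algebra in coordinates

module LinearAlgebra (em : ExcludedMiddle 0ℓ) (ℝ : RealField) where

  open OrderedField em ℝ public
  open Geometry em ℝ public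
  open Classical em public
  open SemiringSum semiring public
    using (sum; sum-cong-≋; ∑-distrib-+; *-distribˡ-sum; *-distribʳ-sum; sum-replicate-zero; ∑-comm)
  module ≈-Reasoning = SetoidReasoning setoid

  abstract

    -- Total, with value `0#` at zero, so that quotients carry no proof argument.
    _⁻¹ : K → K
    x ⁻¹ with em {P = x ≈ 0#}
    ... | yes _  = 0#
    ... | no x≉0 = proj₁ (inverse x x≉0)

    ⁻¹-inverse : ∀ {x} → x ≉ 0# → x * x ⁻¹ ≈ 1#
    ⁻¹-inverse {x} x≉0 with em {P = x ≈ 0#}
    ... | yes x≈0 = ⊥-elim (x≉0 x≈0)
    ... | no x≉0′ = proj₂ (inverse x x≉0′)

    0<⁻¹ : ∀ {x} → 0# < x → 0# < x ⁻¹
    0<⁻¹ {x} 0<x with 0<inverse 0<x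
    ... | y , 0<y , xy≈1 = <-resp refl y≈ 0<y
      where
      y≈ : y ≈ x ⁻¹
      y≈ = begin
        y                  ≈⟨ *-identityʳ y ⟨
        y * 1#             ≈⟨ *-congˡ (⁻¹-inverse (0<⇒≉0 0<x)) ⟨
        y * (x * x ⁻¹)     ≈⟨ solve 3 (λ x y i → y :* (x :* i) := x :* y :* i) refl x y (x ⁻¹) ⟩
        x * y * x ⁻¹       ≈⟨ *-congʳ xy≈1 ⟩
        1# * x ⁻¹          ≈⟨ *-identityˡ _ ⟩
        x ⁻¹               ∎
        where open ≈-Reasoning

  sum-zero : ∀ {n} {f : Fin n → K} → (∀ i → f i ≈ 0#) → sum f ≈ 0#
  sum-zero {n} h = trans (sum-cong-≋ h) (sum-replicate-zero n)

  sum-single : ∀ {n} {f : Fin n → K} i → (∀ j → j ≢ i → f j ≈ 0#) → sum f ≈ f i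
  sum-single zero    h = trans (+-congˡ (sum-zero λ j → h (suc j) λ ())) (+-identityʳ _)
  sum-single (suc i) h = trans (+-cong (h zero λ ()) (sum-single i λ j j≢i → h (suc j) λ { ≡.refl → j≢i ≡.refl }))
    (+-identityˡ _)

  module _ {d : ℕ} where

    ∙-cong : ∀ {u u′ z z′ : Point d} → u ≋ u′ → z ≋ z′ → u ∙ z ≈ u′ ∙ z′
    ∙-cong p q = sum-cong-≋ λ k → *-cong (p k) (q k)

    ∙-comm : ∀ (u z : Point d) → u ∙ z ≈ z ∙ u
    ∙-comm u z = sum-cong-≋ λ k → *-comm (u k) (z k)

    +ᵥ-∙ : ∀ (u w z : Point d) → (u +ᵥ w) ∙ z ≈ u ∙ z + w ∙ z
    +ᵥ-∙ u w z = trans (sum-cong-≋ λ k → distribʳ (z k) (u k) (w k)) (∑-distrib-+ (λ k → u k * z k) (λ k → w k * z k))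

    *ᵥ-∙ : ∀ t (u z : Point d) → (t *ᵥ u) ∙ z ≈ t * (u ∙ z)
    *ᵥ-∙ t u z = trans (sum-cong-≋ λ k → *-assoc t (u k) (z k)) (sym (*-distribˡ-sum t (λ k → u k * z k)))

    ∙-+ᵥ : ∀ (u y z : Point d) → u ∙ (y +ᵥ z) ≈ u ∙ y + u ∙ z
    ∙-+ᵥ u y z = trans (∙-comm u _) (trans (+ᵥ-∙ y z u) (+-cong (∙-comm y u) (∙-comm z u)))

    ∙-*ᵥ : ∀ t (u z : Point d) → u ∙ (t *ᵥ z) ≈ t * (u ∙ z)
    ∙-*ᵥ t u z = trans (∙-comm u _) (trans (*ᵥ-∙ t z u) (*-congˡ (∙-comm z u)))

    ∙--ᵥ : ∀ (u y z : Point d) → u ∙ (y -ᵥ z) ≈ u ∙ y - u ∙ z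
    ∙--ᵥ u y z = begin
      u ∙ (y -ᵥ z)
        ≈⟨ ∙-cong (λ _ → refl) (λ k → +-congˡ (solve 1 (λ x → :- x := (:- :1) :* x) refl (z k))) ⟩
      u ∙ (y +ᵥ (- 1#) *ᵥ z)        ≈⟨ ∙-+ᵥ u y _ ⟩
      u ∙ y + u ∙ ((- 1#) *ᵥ z)     ≈⟨ +-congˡ (∙-*ᵥ (- 1#) u z) ⟩
      u ∙ y + (- 1#) * (u ∙ z)      ≈⟨ solve 2 (λ a b → a :+ (:- :1) :* b := a :- b) refl (u ∙ y) (u ∙ z) ⟩
      u ∙ y - u ∙ z                 ∎
      where open ≈-Reasoning

    line : Point d → K → Point d → Point d
    line u t w = u +ᵥ t *ᵥ w

    line-∙ : ∀ u t w z → line u t w ∙ z ≈ u ∙ z + t * (w ∙ z)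
    line-∙ u t w z = trans (+ᵥ-∙ u _ z) (+-congˡ (*ᵥ-∙ t w z))

    negᵥ : Point d → Point d
    negᵥ u = (- 1#) *ᵥ u

    negᵥ-∙ : ∀ u z → negᵥ u ∙ z ≈ - (u ∙ z)
    negᵥ-∙ u z = trans (*ᵥ-∙ (- 1#) u z) (solve 1 (λ x → (:- :1) :* x := :- x) refl (u ∙ z))

    ∙-negᵥ : ∀ u z → u ∙ negᵥ z ≈ - (u ∙ z)
    ∙-negᵥ u z = trans (∙-*ᵥ (- 1#) u z) (solve 1 (λ x → (:- :1) :* x := :- x) refl (u ∙ z))

    0ᵥ-∙ : ∀ {u z : Point d} → u ≋ 0ᵥ → u ∙ z ≈ 0#
    0ᵥ-∙ {u} {z} h = sum-zero λ k → trans (*-congʳ (h k)) (zeroˡ (z k))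

  unit : ∀ {d} → Fin d → Point d
  unit zero    zero    = 1#
  unit zero    (suc _) = 0#
  unit (suc _) zero    = 0#
  unit (suc i) (suc j) = unit i j

  unit-diagonal : ∀ {d} (i : Fin d) → unit i i ≈ 1#
  unit-diagonal zero    = refl
  unit-diagonal (suc i) = unit-diagonal i

  unit-off-diagonal : ∀ {d} {i j : Fin d} → j ≢ i → unit i j ≈ 0#
  unit-off-diagonal {i = zero}  {zero}  h = ⊥-elim (h ≡.refl)
  unit-off-diagonal {i = zero}  {suc _} h = refl
  unit-off-diagonal {i = suc _} {zero}  h = refl
  unit-off-diagonal {i = suc i} {suc j} h = unit-off-diagonal {i = i} {j} λ { ≡.refl → h ≡.refl }

  unit-∙ : ∀ {d} (i : Fin d) (z : Point d) → unit i ∙ z ≈ z i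
  unit-∙ i z = begin
    unit i ∙ z         ≈⟨ sum-single i (λ j j≢i → trans (*-congʳ (unit-off-diagonal j≢i)) (zeroˡ (z j))) ⟩
    unit i i * z i     ≈⟨ *-congʳ (unit-diagonal i) ⟩
    1# * z i           ≈⟨ *-identityˡ (z i) ⟩
    z i                ∎
    where open ≈-Reasoning

  -- Points are mostly handled through their values under all functionals, where vector identities
  -- become scalar ones for the ring solver. This lemma leads back to coordinates.
  ∙-≋ : ∀ {d} {y z : Point d} → (∀ u → u ∙ y ≈ u ∙ z) → y ≋ z
  ∙-≋ {y = y} {z} h i = trans (sym (unit-∙ i y)) (trans (h (unit i)) (unit-∙ i z))

  abstract

    -- Gaussian elimination with pivot p.
    common-zero : ∀ {d} (ys : List (Point d)) → length ys ℕ.< d →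
      ∃[ u ] ¬ (u ≋ 0ᵥ) × (∀ {y} → y ∈ ys → u ∙ y ≈ 0#)
    common-zero {suc d} ys (s≤s len) with em {P = ∃[ p ] p ∈ ys × p zero ≉ 0#}
    ... | no none = unit zero , (λ h → 0≉1 (sym (h zero))) , λ {y} y∈ →
          trans (unit-∙ zero y) (by-contradiction λ y≉0 → none (y , y∈ , y≉0))
    ... | yes (p , p∈ , p≉0) with ∈-∃++ p∈
    ...   | as , bs , ≡.refl = u , (λ h → u′≉0 (h ∘ suc)) , zeros
      where
      tail : Point (suc d) → Point d
      tail y = y ∘ suc
      r : K
      r = p zero ⁻¹
      eliminate : Point (suc d) → Point d
      eliminate y = tail y -ᵥ (y zero * r) *ᵥ tail p
      len′ : length (map eliminate (as ++ bs)) ℕ.< d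
      len′ = begin
        suc (length (map eliminate (as ++ bs)))
          ≡⟨ ≡.cong suc (≡.trans (length-map eliminate (as ++ bs)) (length-++ as)) ⟩
        suc (length as ℕ.+ length bs)               ≡⟨ ℕ.+-suc (length as) (length bs) ⟨
        length as ℕ.+ suc (length bs)               ≡⟨ length-++ as ⟨
        length (as ++ p ∷ bs)                       ≤⟨ len ⟩
        d                                           ∎
        where open ℕ.≤-Reasoning
      ih : ∃[ u ] ¬ (u ≋ 0ᵥ) × (∀ {y} → y ∈ map eliminate (as ++ bs) → u ∙ y ≈ 0#)
      ih = common-zero (map eliminate (as ++ bs)) len′
      u′ : Point d
      u′ = proj₁ ih
      u′≉0 : ¬ (u′ ≋ 0ᵥ)
      u′≉0 = proj₁ (proj₂ ih)
      u : Point (suc d)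
      u zero    = - (r * (u′ ∙ tail p))
      u (suc k) = u′ k
      others : ∀ {y} → y ∈ as ++ bs → u ∙ y ≈ 0#
      others {y} y∈ = begin
        - (r * (u′ ∙ tail p)) * y zero + u′ ∙ tail y
          ≈⟨ solve 4 (λ r a b c → :- (r :* a) :* b :+ c := c :- b :* r :* a) refl r (u′ ∙ tail p) (y zero)
            (u′ ∙ tail y) ⟩
        u′ ∙ tail y - y zero * r * (u′ ∙ tail p)       ≈⟨ +-congˡ (-‿cong (∙-*ᵥ _ u′ (tail p))) ⟨
        u′ ∙ tail y - u′ ∙ ((y zero * r) *ᵥ tail p)    ≈⟨ ∙--ᵥ u′ _ _ ⟨
        u′ ∙ eliminate y                               ≈⟨ proj₂ (proj₂ ih) (∈-map⁺ eliminate y∈) ⟩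
        0#                                             ∎
        where open ≈-Reasoning
      zeros : ∀ {y} → y ∈ as ++ p ∷ bs → u ∙ y ≈ 0#
      zeros y∈ with ∈-++⁻ as y∈
      ... | inj₁ h             = others (∈-++⁺ˡ h)
      ... | inj₂ (there h)     = others (∈-++⁺ʳ as h)
      ... | inj₂ (here ≡.refl) = begin
        - (r * (u′ ∙ tail p)) * p zero + u′ ∙ tail p
          ≈⟨ solve 3 (λ r a b → :- (r :* a) :* b :+ a := a :- (b :* r) :* a) refl r (u′ ∙ tail p) (p zero) ⟩
        u′ ∙ tail p - (p zero * r) * (u′ ∙ tail p)         ≈⟨ +-congˡ (-‿cong (*-congʳ (⁻¹-inverse p≉0))) ⟩
        u′ ∙ tail p - 1# * (u′ ∙ tail p)                   ≈⟨ solve 1 (λ a → a :- :1 :* a := :0) refl (u′ ∙ tail p) ⟩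
        0#                                                 ∎
        where open ≈-Reasoning

-- Small and large parameters, general position, connectedness

module Perturbation (em : ExcludedMiddle 0ℓ) (ℝ : RealField) where

  open LinearAlgebra em ℝ public

  module _ {A : Set} where

    abstract

      argmax : (g : A → K) (xs : List A) {a : A} → a ∈ xs →
        ∃[ m ] m ∈ xs × (∀ {b} → b ∈ xs → g b ≤ g m)
      argmax g (x ∷ [])     _ = x , here ≡.refl , λ { (here ≡.refl) → ≤-refl }
      argmax g (x ∷ y ∷ xs) _ with argmax g (y ∷ xs) (here ≡.refl)
      ... | m , m∈ , max with total (g x) (g m)
      ...   | inj₁ x≤m = m , there m∈ , λ { (here ≡.refl) → x≤m ; (there p) → max p }
      ...   | inj₂ m≤x = x , here ≡.refl , λ { (here ≡.refl) → ≤-refl ; (there p) → ≤-trans (max p) m≤x }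

      argmin : (g : A → K) (xs : List A) {a : A} → a ∈ xs →
        ∃[ m ] m ∈ xs × (∀ {b} → b ∈ xs → g m ≤ g b)
      argmin g xs a∈ with argmax (-_ ∘ g) xs a∈
      ... | m , m∈ , max = m , m∈ , λ {b} b∈ → by≤ (≤⇒0≤ (max b∈))
        (solve 2 (λ x y → x :- y := :- y :- :- x) refl (g b) (g m))

  Near Far : (K → Set) → Set
  Near P = ∃[ ε ] 0# < ε × (∀ {t} → 0# < t → t ≤ ε → P t)
  Far P  = ∃[ T ] 0# < T × (∀ {t} → T ≤ t → P t)

  abstract

    near-witness : ∀ {P} → Near P → ∃[ t ] 0# < t × P t
    near-witness (ε , 0<ε , h) = ε , 0<ε , h 0<ε ≤-refl

    near-always : ∀ {P} → (∀ {t} → 0# < t → P t) → Near P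
    near-always h = 1# , 0<1 , λ 0<t _ → h 0<t

    near-map : ∀ {P Q : K → Set} → (∀ {t} → P t → Q t) → Near P → Near Q
    near-map f (ε , 0<ε , h) = ε , 0<ε , λ p q → f (h p q)

    near-× : ∀ {P Q : K → Set} → Near P → Near Q → Near (λ t → P t × Q t)
    near-× (ε , p , h) (δ , q , k) with common-bound p q
    ... | m , 0<m , m≤ε , m≤δ = m , 0<m , λ 0<t t≤m → h 0<t (≤-trans t≤m m≤ε) , k 0<t (≤-trans t≤m m≤δ)

    near-all : ∀ {A : Set} {P : A → K → Set} (xs : List A) → (∀ {a} → a ∈ xs → Near (P a)) →
      Near (λ t → ∀ {a} → a ∈ xs → P a t)
    near-all []       _ = 1# , 0<1 , λ _ _ ()
    near-all (x ∷ xs) h = near-map (λ { (p , q) (here ≡.refl) → p ; (p , q) (there a∈) → q a∈ })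
      (near-× (h (here ≡.refl)) (near-all xs (h ∘ there)))

    near-positive : ∀ {α} β → 0# < α → Near (λ t → 0# < α + t * β)
    near-positive {α} β 0<α with ≤-<-connex 0# β
    ... | inj₁ 0≤β = 1# , 0<1 , λ 0<t _ → 0<+0≤ 0<α (0≤*0≤ (<⇒≤ 0<t) 0≤β)
    -- The expression vanishes at `α / - β`; stopping at half of that leaves the margin `h * α`.
    ... | inj₂ β<0 = h * α * i , 0<*0< (0<*0< 0<h 0<α) 0<i , λ {t} _ t≤ε →
          <-resp refl (lemma t) (0<+0≤ (0<*0< 0<h 0<α) (0≤*0≤ (≤⇒0≤ t≤ε) (<⇒≤ (neg<0 β<0))))
      where
      h : K
      h = proj₁ half
      0<h : 0# < h
      0<h = proj₁ (proj₂ half)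
      i : K
      i = (- β) ⁻¹
      0<i : 0# < i
      0<i = 0<⁻¹ (neg<0 β<0)
      lemma : ∀ t → h * α + (h * α * i - t) * - β ≈ α + t * β
      lemma t = begin
        h * α + (h * α * i - t) * - β
          ≈⟨ solve 5 (λ h α i t β → h :* α :+ (h :* α :* i :- t) :* (:- β) := h :* α :+ h :* α :* ((:- β) :* i) :+ t
            :* β) refl h α i t β ⟩
        h * α + h * α * (- β * i) + t * β     ≈⟨ +-congʳ (+-congˡ (*-congˡ (⁻¹-inverse (0<⇒≉0 (neg<0 β<0))))) ⟩
        h * α + h * α * 1# + t * β
          ≈⟨ solve 4 (λ h α t β → h :* α :+ h :* α :* :1 :+ t :* β := (h :+ h) :* α :+ t :* β) refl h α t β ⟩
        (h + h) * α + t * β                   ≈⟨ +-congʳ (*-congʳ (proj₂ (proj₂ half))) ⟩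
        1# * α + t * β                        ≈⟨ +-congʳ (*-identityˡ α) ⟩
        α + t * β                             ∎
        where open ≈-Reasoning

    near-< : ∀ {α α′} β β′ → α < α′ → Near (λ t → α + t * β < α′ + t * β′)
    near-< {α} {α′} β β′ α<α′ = near-map (λ {t} h → by< h
        (solve 5 (λ α α′ β β′ t → (α′ :+ t :* β′) :- (α :+ t :* β) := (α′ :- α) :+ t :* (β′ :- β)) refl α α′ β β′ t))
      (near-positive (β′ - β) (<⇒0< α<α′))

    far-all : ∀ {A : Set} {P : A → K → Set} (xs : List A) → (∀ {a} → a ∈ xs → Far (P a)) →
      Far (λ t → ∀ {a} → a ∈ xs → P a t)
    far-all []       _ = 1# , 0<1 , λ _ ()
    far-all (x ∷ xs) h with h (here ≡.refl) | far-all xs (h ∘ there)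
    ... | S , 0<S , p | T , 0<T , q = S + T , 0<+0< 0<S 0<T , λ where
      S+T≤t (here ≡.refl) → p (≤-trans (by≤ (<⇒≤ 0<T) (solve 2 (λ S T → (S :+ T) :- S := T) refl S T)) S+T≤t)
      S+T≤t (there a∈)    → q (≤-trans (by≤ (<⇒≤ 0<S) (solve 2 (λ S T → (S :+ T) :- T := S) refl S T)) S+T≤t) a∈

    far-positive : ∀ α {β} → 0# < β → Far (λ t → 0# < α + t * β)
    far-positive α {β} 0<β with ≤-<-connex 0# α
    ... | inj₁ 0≤α = 1# , 0<1 , λ 1≤t → 0≤+0< 0≤α (0<*0< (<-≤-trans 0<1 1≤t) 0<β)
    ... | inj₂ α<0 = 1# + - α * i , 0<+0< 0<1 (0<*0< (neg<0 α<0) 0<i) , λ {t} T≤t →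
          <-resp refl (lemma t) (0≤+0< (0≤*0≤ (≤⇒0≤ T≤t) (<⇒≤ 0<β)) 0<β)
      where
      i : K
      i = β ⁻¹
      0<i : 0# < i
      0<i = 0<⁻¹ 0<β
      lemma : ∀ t → (t - (1# + - α * i)) * β + β ≈ α + t * β
      lemma t = begin
        (t - (1# + - α * i)) * β + β
          ≈⟨ solve 4 (λ α i t β → (t :- (:1 :+ (:- α) :* i)) :* β :+ β := t :* β :+ α :* (β :* i)) refl α i t β ⟩
        t * β + α * (β * i)              ≈⟨ +-congˡ (*-congˡ (⁻¹-inverse (0<⇒≉0 0<β))) ⟩
        t * β + α * 1#                   ≈⟨ solve 3 (λ α t β → t :* β :+ α :* :1 := α :+ t :* β) refl α t β ⟩
        α + t * β                        ∎
        where open ≈-Reasoning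

    -- The ratio test of the simplex method: an `a` with rising value reaches zero at `- f a / g a`,
    -- and the least of these times is the first at which anything vanishes. Values that do not rise
    -- stay negative.
    first-exit : ∀ {A : Set} (f g : A → K) (xs : List A) →
      (∀ {a} → a ∈ xs → f a < 0#) → ∃[ a ] a ∈ xs × 0# < g a →
      ∃[ t ] 0# < t × (∀ a → a ∈ xs → f a + t * g a ≤ 0#) ×
        ∃[ a ] a ∈ xs × 0# < g a × f a + t * g a ≈ 0#
    first-exit {A} f g xs f<0 (a₀ , a₀∈ , 0<ga₀) =
      t , 0<t , (λ _ → below) , m , m∈ , 0<gm , exact m 0<gm
      where
      ratio : A → K
      ratio a = - f a * g a ⁻¹
      positive : List A
      positive = select (λ a → 0# < g a) xs
      minimum : ∃[ m ] m ∈ positive × (∀ {b} → b ∈ positive → ratio m ≤ ratio b)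
      minimum = argmin ratio positive (∈-select⁺ a₀∈ 0<ga₀)
      m : A
      m = proj₁ minimum
      m∈ : m ∈ xs
      m∈ = proj₁ (∈-select⁻ xs (proj₁ (proj₂ minimum)))
      0<gm : 0# < g m
      0<gm = proj₂ (∈-select⁻ xs (proj₁ (proj₂ minimum)))
      t : K
      t = ratio m
      0<t : 0# < t
      0<t = 0<*0< (neg<0 (f<0 m∈)) (0<⁻¹ 0<gm)
      exact : ∀ a → 0# < g a → f a + ratio a * g a ≈ 0#
      exact a 0<ga = begin
        f a + (- f a * g a ⁻¹) * g a
          ≈⟨ solve 3 (λ f g i → f :+ ((:- f) :* i) :* g := f :- f :* (g :* i)) refl (f a) (g a) (g a ⁻¹) ⟩
        f a - f a * (g a * g a ⁻¹)       ≈⟨ +-congˡ (-‿cong (*-congˡ (⁻¹-inverse (0<⇒≉0 0<ga)))) ⟩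
        f a - f a * 1#                   ≈⟨ solve 1 (λ f → f :- f :* :1 := :0) refl (f a) ⟩
        0#                               ∎
        where open ≈-Reasoning
      below : ∀ {a} → a ∈ xs → f a + t * g a ≤ 0#
      below {a} a∈ with ≤-<-connex (g a) 0#
      ... | inj₁ ga≤0 = by≤ (0≤+0≤ (<⇒≤ (neg<0 (f<0 a∈))) (0≤*0≤ (<⇒≤ 0<t) (neg≤0 ga≤0)))
              (solve 3 (λ f g t → :0 :- (f :+ t :* g) := (:- f) :+ t :* (:- g)) refl (f a) (g a) t)
      ... | inj₂ 0<ga = by≤ (0≤*0≤ (≤⇒0≤ (proj₂ (proj₂ minimum) (∈-select⁺ a∈ 0<ga))) (<⇒≤ 0<ga)) (begin
        0# - (f a + t * g a)                                             ≈⟨ +-congʳ (exact a 0<ga) ⟨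
        f a + (- f a * g a ⁻¹) * g a - (f a + t * g a)
          ≈⟨ solve 4 (λ f r g t → (f :+ r :* g) :- (f :+ t :* g) := (r :- t) :* g) refl (f a) (- f a * g a ⁻¹) (g a) t ⟩
        (- f a * g a ⁻¹ - t) * g a                                       ∎)
        where open ≈-Reasoning

    -- General position, one vector of `ys` at a time: if the functional found so far kills the new
    -- `y`, a small step in a direction `w` with `w ∙ y` nonzero repairs this, and the finitely many
    -- open conditions already achieved survive small steps.
    perturb : ∀ {d} (ps ys : List (Point d)) (u : Point d) →
      (∀ {p} → p ∈ ps → 0# < u ∙ p) → (∀ {y} → y ∈ ys → ∃[ w ] w ∙ y ≉ 0#) →
      ∃[ u′ ] (∀ p → p ∈ ps → 0# < u′ ∙ p) × (∀ y → y ∈ ys → u′ ∙ y ≉ 0#)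
    perturb ps []       u pos _  = u , (λ _ → pos) , λ _ ()
    perturb {d} ps (y ∷ ys) u pos nz = case em {P = u₁ ∙ y ≈ 0#} of λ where
        (no u₁y≉0)  → u₁ , (λ _ → pos₁) , λ { _ (here ≡.refl) → u₁y≉0 ; _ (there p) → nz₁ p }
        (yes u₁y≈0) →
          let w , wy≉0 = nz (here ≡.refl)
              t , 0<t , kept = near-witness (near-× (near-all ps (keep-positive w)) (near-all ys (keep-nonzero w)))
          in line u₁ t w , (λ _ → proj₁ kept) , λ {
               _ (here ≡.refl) eq → wy≉0 (*-zero-divisor
                 (trans (sym (trans (line-∙ u₁ t w y) (trans (+-congʳ u₁y≈0) (+-identityˡ _)))) eq) (0<⇒≉0 0<t))
               ; _ (there p)        → proj₂ kept p }
      where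
      ih : ∃[ u′ ] (∀ p → p ∈ ps → 0# < u′ ∙ p) × (∀ y → y ∈ ys → u′ ∙ y ≉ 0#)
      ih = perturb ps ys u pos (nz ∘ there)
      u₁ : Point d
      u₁ = proj₁ ih
      pos₁ : ∀ {p} → p ∈ ps → 0# < u₁ ∙ p
      pos₁ = proj₁ (proj₂ ih) _
      nz₁ : ∀ {z} → z ∈ ys → u₁ ∙ z ≉ 0#
      nz₁ = proj₂ (proj₂ ih) _
      keep-positive : ∀ w {p} → p ∈ ps → Near (λ t → 0# < line u₁ t w ∙ p)
      keep-positive w {p} p∈ = near-map (<-resp refl (sym (line-∙ u₁ _ w p))) (near-positive (w ∙ p) (pos₁ p∈))
      keep-nonzero : ∀ w {z} → z ∈ ys → Near (λ t → line u₁ t w ∙ z ≉ 0#)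
      keep-nonzero w {z} z∈ = case <-cmp (u₁ ∙ z) 0# of λ where
        (inj₁ neg) → near-map (λ {t} h eq → <-irrefl
          (sym (trans (solve 3 (λ a t b → (:- a) :+ t :* (:- b) := :- (a :+ t :* b)) refl (u₁ ∙ z) t (w ∙ z))
                          (trans (-‿cong (trans (sym (line-∙ u₁ t w z)) eq)) -0#≈0#))) h)
                            (near-positive (- (w ∙ z)) (neg<0 neg))
        (inj₂ (inj₁ z≈0)) → ⊥-elim (nz₁ z∈ z≈0)
        (inj₂ (inj₂ 0<z)) → near-map (λ {t} h eq → <-irrefl (sym (trans (sym (line-∙ u₁ t w z)) eq)) h)
          (near-positive (w ∙ z) 0<z)

  Open : (K → Set) → Set
  Open P = ∀ {t} → P t → ∃[ ε ] 0# < ε × (∀ {s} → t - ε < s → s < t + ε → P s)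

  abstract

    open-positive : ∀ α β → Open (λ t → 0# < α + t * β)
    open-positive α β {t} 0<γ with near-witness (near-× (near-positive β 0<γ) (near-positive (- β) 0<γ))
    ... | ε , 0<ε , pos₁ , pos₂ = ε , 0<ε , λ {s} t-ε<s s<t+ε → case ≤-<-connex 0# β of λ where
      (inj₁ 0≤β) → <-resp refl (solve 5 (λ α β t ε s → (α :+ t :* β) :+ ε :* (:- β) :+ (s :- (t :- ε)) :* β := α :+ s
        :* β) refl α β t ε s)
        (0<+0≤ pos₂ (0≤*0≤ (<⇒≤ (<⇒0< t-ε<s)) 0≤β))
      (inj₂ β<0) → <-resp refl (solve 5 (λ α β t ε s → (α :+ t :* β) :+ ε :* β :+ ((t :+ ε) :- s) :* (:- β) := α :+ s
        :* β) refl α β t ε s)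
        (0<+0≤ pos₁ (0≤*0≤ (<⇒≤ (<⇒0< s<t+ε)) (<⇒≤ (neg<0 β<0))))

    open-all : ∀ {A : Set} {P : A → K → Set} (xs : List A) → (∀ {a} → a ∈ xs → Open (P a)) →
      Open (λ t → ∀ {a} → a ∈ xs → P a t)
    open-all []       _ _ = 1# , 0<1 , λ _ _ ()
    open-all (x ∷ xs) o {t} p with o (here ≡.refl) (p (here ≡.refl)) | open-all xs (o ∘ there) (p ∘ there)
    ... | ε , 0<ε , h | δ , 0<δ , k with common-bound 0<ε 0<δ
    ...   | m , 0<m , m≤ε , m≤δ = m , 0<m , λ {s} lo hi → λ where
        (here ≡.refl) → h (≤-<-trans (lower m≤ε) lo) (<-≤-trans hi (upper m≤ε))
        (there a∈)    → k (≤-<-trans (lower m≤δ) lo) (<-≤-trans hi (upper m≤δ)) a∈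
      where
      lower : ∀ {e} → m ≤ e → t - e ≤ t - m
      lower {e} m≤e = by≤ (≤⇒0≤ m≤e) (solve 3 (λ t e m → (t :- m) :- (t :- e) := e :- m) refl t e m)
      upper : ∀ {e} → m ≤ e → t + m ≤ t + e
      upper {e} m≤e = by≤ (≤⇒0≤ m≤e) (solve 3 (λ t e m → (t :+ e) :- (t :+ m) := e :- m) refl t e m)

    open-any : ∀ {A : Set} {P : A → K → Set} {xs : List A} → (∀ {a} → a ∈ xs → Open (P a)) →
      Open (λ t → ∃[ a ] a ∈ xs × P a t)
    open-any o (a , a∈ , p) with o a∈ p
    ... | ε , 0<ε , h = ε , 0<ε , λ lo hi → a , a∈ , h lo hi

    -- Connectedness of an interval; completeness enters here. The supremum of the part of the
    -- interval where `P` holds can lie in neither of the two disjoint open sets.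
    between : ∀ {P Q : K → Set} → Open P → Open Q → (∀ {t} → P t → Q t → ⊥) →
      ∀ {a b} → a ≤ b → P a → Q b → ∃[ t ] a ≤ t × ¬ P t × ¬ Q t
    between {P} {Q} openP openQ disjoint {a} {b} a≤b Pa Qb = s , a≤s , ¬Ps , ¬Qs
      where
      S : K → Set
      S t = a ≤ t × t ≤ b × P t
      sup : ∃[ s ] UpperBound S s × (∀ b → UpperBound S b → s ≤ b)
      sup = supremum S (a , ≤-refl , a≤b , Pa) (b , λ t (_ , t≤b , _) → t≤b)
      s : K
      s = proj₁ sup
      ub : UpperBound S s
      ub = proj₁ (proj₂ sup)
      lub : ∀ b → UpperBound S b → s ≤ b
      lub = proj₂ (proj₂ sup)
      a≤s : a ≤ s
      a≤s = ub a (≤-refl , a≤b , Pa)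
      s≤b : s ≤ b
      s≤b = lub b λ t (_ , t≤b , _) → t≤b
      ¬Ps : ¬ P s
      ¬Ps Ps = case ≤-<-connex b s of λ where
          (inj₁ b≤s) → disjoint (h (by< (0<+0≤ 0<ε (≤⇒0≤ s≤b))
            (solve 3 (λ b s e → b :- (s :- e) := e :+ (b :- s)) refl b s ε))
                                   (by< (0<+0≤ 0<ε (≤⇒0≤ b≤s))
                                     (solve 3 (λ b s e → (s :+ e) :- b := e :+ (s :- b)) refl b s ε))) Qb
          (inj₂ s<b) →
            -- Half of `ε` keeps `s + m` strictly inside the ball.
            let m , 0<m , m≤hε , m≤b-s = common-bound (0<*0< 0<½ 0<ε) (<⇒0< s<b)
                s<s+m = by< 0<m (solve 2 (λ s m → (s :+ m) :- s := m) refl s m)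
            in s<s+m (ub (s + m) (≤-trans a≤s (<⇒≤ s<s+m) ,
                by≤ (≤⇒0≤ m≤b-s) (solve 3 (λ b s m → b :- (s :+ m) := (b :- s) :- m) refl b s m) ,
                h (by< (0<+0< 0<ε 0<m) (solve 3 (λ s m e → (s :+ m) :- (s :- e) := e :+ m) refl s m ε))
                  (by< (0<+0≤ (0<*0< 0<½ 0<ε) (≤⇒0≤ m≤hε))
                    (trans (+-congʳ (+-congˡ (trans (sym (*-identityˡ ε)) (*-congʳ (sym ½+½≈1)))))
                    (solve 4 (λ s m e h → (s :+ (h :+ h) :* e) :- (s :+ m) := h :* e :+ (h :* e :- m)) refl s m ε ½)))))
        where
        ball : ∃[ ε ] 0# < ε × (∀ {t} → s - ε < t → t < s + ε → P t)
        ball = openP Ps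
        ε : K
        ε = proj₁ ball
        0<ε : 0# < ε
        0<ε = proj₁ (proj₂ ball)
        h : ∀ {t} → s - ε < t → t < s + ε → P t
        h = proj₂ (proj₂ ball)
        ½ : K
        ½ = proj₁ half
        0<½ : 0# < ½
        0<½ = proj₁ (proj₂ half)
        ½+½≈1 : ½ + ½ ≈ 1#
        ½+½≈1 = proj₂ (proj₂ half)
      ¬Qs : ¬ Q s
      ¬Qs Qs = by< 0<ε (solve 2 (λ s e → s :- (s :- e) := e) refl s ε) (lub (s - ε) bound)
        where
        ball : ∃[ ε ] 0# < ε × (∀ {t} → s - ε < t → t < s + ε → Q t)
        ball = openQ Qs
        ε : K
        ε = proj₁ ball
        0<ε : 0# < ε
        0<ε = proj₁ (proj₂ ball)
        bound : ∀ t → S t → t ≤ s - ε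
        bound t t∈S@(_ , _ , Pt) = by-contradiction λ t≰s-ε → disjoint Pt (proj₂ (proj₂ ball) t≰s-ε
          (by< (0<+0≤ 0<ε (≤⇒0≤ (ub t t∈S))) (solve 3 (λ t s e → (s :+ e) :- t := e :+ (s :- t)) refl t s ε)))

-- Faces, edges and flexes of a polytope

module Families (em : ExcludedMiddle 0ℓ) (ℝ : RealField) where

  open Perturbation em ℝ public

  ≉⇒-≉0 : ∀ {x y} → x ≉ y → x - y ≉ 0#
  ≉⇒-≉0 {x} {y} h eq = h (trans (solve 2 (λ x y → x := (x :- y) :+ y) refl x y) (trans (+-congʳ eq) (+-identityˡ y)))

  -≈0⇒≈ : ∀ {x y} → x - y ≈ 0# → x ≈ y
  -≈0⇒≈ h = by-contradiction λ x≉y → ≉⇒-≉0 x≉y h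

  ≈⇒-≈0 : ∀ {x y} → x ≈ y → x - y ≈ 0#
  ≈⇒-≈0 {x} {y} h = trans (+-congʳ h) (-‿inverseʳ y)

  <⇒≉ : ∀ {x y} → x < y → x ≉ y
  <⇒≉ h eq = <-irrefl eq h

  0<*⇒0< : ∀ {x y} → 0# < x * y → 0# < y → 0# < x
  0<*⇒0< {x} {y} p q x≤0 = p (by≤ (0≤*0≤ (neg≤0 x≤0) (<⇒≤ q)) (solve 2 (λ x y → :0 :- x :* y := (:- x) :* y) refl x y))

  <0⇒-<0 : ∀ {x y} → x < y → x - y < 0#
  <0⇒-<0 {x} {y} h = by< (<⇒0< h) (solve 2 (λ x y → :0 :- (x :- y) := y :- x) refl x y)

  -≤0⇒≤ : ∀ {x y} → x - y ≤ 0# → x ≤ y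
  -≤0⇒≤ {x} {y} h = by≤ (neg≤0 h) (solve 2 (λ x y → y :- x := :- (x :- y)) refl x y)

  -- Two quantities that vanish at the same time satisfy an equation free of `t`, which a generic
  -- direction can avoid.
  proportional : ∀ {t f₁ g₁ f₂ g₂} → f₁ + t * g₁ ≈ 0# → f₂ + t * g₂ ≈ 0# → f₁ * g₂ - f₂ * g₁ ≈ 0#
  proportional {t} {f₁} {g₁} {f₂} {g₂} p q = begin
    f₁ * g₂ - f₂ * g₁
      ≈⟨ solve 5 (λ f₁ g₁ f₂ g₂ t → f₁ :* g₂ :- f₂ :* g₁ := (f₁ :+ t :* g₁) :* g₂ :- (f₂ :+ t :* g₂) :* g₁) refl f₁ g₁
        f₂ g₂ t ⟩
    (f₁ + t * g₁) * g₂ - (f₂ + t * g₂) * g₁        ≈⟨ +-cong (*-congʳ p) (-‿cong (*-congʳ q)) ⟩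
    0# * g₂ - 0# * g₁                              ≈⟨ solve 2 (λ x y → :0 :* x :- :0 :* y := :0) refl g₂ g₁ ⟩
    0#                                             ∎
    where open ≈-Reasoning

  -<0⇒< : ∀ {x y} → x - y < 0# → x < y
  -<0⇒< {x} {y} h = by< (neg<0 h) (solve 2 (λ x y → y :- x := :- (x :- y)) refl x y)

  line-difference : ∀ {d} (u : Point d) t w y z →
    line u t w ∙ y - line u t w ∙ z ≈ (u ∙ y - u ∙ z) + t * (w ∙ y - w ∙ z)
  line-difference u t w y z = trans (+-cong (line-∙ u t w y) (-‿cong (line-∙ u t w z)))
    (solve 5 (λ a b c e t → (a :+ t :* b) :- (c :+ t :* e) := (a :- c) :+ t :* (b :- e)) refl (u ∙ y) (w ∙ y) (u ∙ z)
      (w ∙ z) t)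

  near-line-< : ∀ {d} (u w y z : Point d) → u ∙ y < u ∙ z → Near (λ t → line u t w ∙ y < line u t w ∙ z)
  near-line-< u w y z h = near-map (λ {t} → <-resp (sym (line-∙ u t w y)) (sym (line-∙ u t w z)))
    (near-< (w ∙ y) (w ∙ z) h)

  -- The vertices of a polytope are the points z a with a in L, and a linear
  -- functional is represented by the vector u of its coefficients.
  module Family {d : ℕ} {A : Set} (z : A → Point d) (L : List A) where

    Top : Point d → A → Set
    Top u a = a ∈ L × (∀ {b} → b ∈ L → u ∙ z b ≤ u ∙ z a)

    Exposed : A → Set
    Exposed a = ∃[ u ] (∀ {b} → b ∈ L → b ≢ a → u ∙ z b < u ∙ z a)

    -- An edge, given by a functional whose maximal face has exactly these two vertices.
    Adjacent : A → A → Set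
    Adjacent a b = a ∈ L × b ∈ L × a ≢ b ×
      ∃[ u ] (u ∙ z a ≈ u ∙ z b × (∀ {c} → c ∈ L → c ≢ a → c ≢ b → u ∙ z c < u ∙ z a))

    Adjacent-sym : ∀ {a b} → Adjacent a b → Adjacent b a
    Adjacent-sym (a∈ , b∈ , a≢b , u , tie , below) =
      b∈ , a∈ , a≢b ∘ ≡.sym , u , sym tie , λ c∈ c≢b c≢a → <-resp refl tie (below c∈ c≢a c≢b)

    -- The condition holds if `φ a` is the vertex corresponding to `z a` of a Minkowski summand: two
    -- vertices maximal for `u` have images maximal for `u`. No inequality is imposed, so
    -- differences of summands are covered as well.
    Flexible : (A → Point d) → Set
    Flexible φ = ∀ {u a b} → Top u a → Top u b → u ∙ φ a ≈ u ∙ φ b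

    top : ∀ u {a} → a ∈ L → ∃[ m ] Top u m
    top u = argmax (λ b → u ∙ z b) L

    module _ (exposed : ∀ {a} → a ∈ L → Exposed a) where

      private
        -- As `b` is exposed, `z b` does not lie between `z a` and `z c`; in terms of the
        -- coefficients this is `α < β`.
        steeper : ∀ {a b c} → a ∈ L → b ∈ L → c ∈ L → a ≢ b → b ≢ c → ∀ {α β} → 0# < β →
          (∀ w → α * (w ∙ z b - w ∙ z a) ≈ β * (w ∙ z c - w ∙ z a)) → 0# < β - α
        steeper {a} {b} {c} a∈ b∈ c∈ a≢b b≢c {α} {β} 0<β eq =
          0<*⇒0< (<-resp refl (sym lemma) (0<*0< 0<β (<⇒0< (below c∈ (b≢c ∘ ≡.sym))))) (<⇒0< (below a∈ a≢b))
          where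
          w = proj₁ (exposed b∈)
          below : ∀ {e} → e ∈ L → e ≢ b → w ∙ z e < w ∙ z b
          below = proj₂ (exposed b∈)
          lemma : (β - α) * (w ∙ z b - w ∙ z a) ≈ β * (w ∙ z b - w ∙ z c)
          lemma = begin
            (β - α) * (w ∙ z b - w ∙ z a)
              ≈⟨ solve 3 (λ β α x → (β :- α) :* x := β :* x :- α :* x) refl β α _ ⟩
            β * (w ∙ z b - w ∙ z a) - α * (w ∙ z b - w ∙ z a)              ≈⟨ +-congˡ (-‿cong (eq w)) ⟩
            β * (w ∙ z b - w ∙ z a) - β * (w ∙ z c - w ∙ z a)
              ≈⟨ solve 4 (λ β b a c → β :* (b :- a) :- β :* (c :- a) := β :* (b :- c)) refl β (w ∙ z b) (w ∙ z a)
                (w ∙ z c) ⟩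
            β * (w ∙ z b - w ∙ z c)                                        ∎
            where open ≈-Reasoning

        not-collinear⁺ : ∀ {a b c} → a ∈ L → b ∈ L → c ∈ L → a ≢ b → a ≢ c → b ≢ c →
          ∀ {α β} → 0# < α → β ≉ 0# →
          (∀ w → α * (w ∙ z b - w ∙ z a) ≈ β * (w ∙ z c - w ∙ z a)) → ⊥
        not-collinear⁺ {a} {b} {c} a∈ b∈ c∈ a≢b a≢c b≢c {α} {β} 0<α β≉0 eq = case <-cmp β 0# of λ where
            (inj₁ β<0) → <-irrefl (sym opposite) (0<+0< (0<*0< 0<α (<⇒0< (below b∈ (a≢b ∘ ≡.sym))))
                                                        (0<*0< (neg<0 β<0) (<⇒0< (below c∈ (a≢c ∘ ≡.sym)))))
            (inj₂ (inj₁ β≈0)) → β≉0 β≈0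
            (inj₂ (inj₂ 0<β)) → <-irrefl (sym (solve 2 (λ α β → (β :- α) :+ (α :- β) := :0) refl α β))
              (0<+0< (steeper a∈ b∈ c∈ a≢b b≢c 0<β eq) (steeper a∈ c∈ b∈ a≢c (b≢c ∘ ≡.sym) 0<α (λ w → sym (eq w))))
          where
          w = proj₁ (exposed a∈)
          below : ∀ {e} → e ∈ L → e ≢ a → w ∙ z e < w ∙ z a
          below = proj₂ (exposed a∈)
          opposite : α * (w ∙ z a - w ∙ z b) + (- β) * (w ∙ z a - w ∙ z c) ≈ 0#
          opposite = begin
            α * (w ∙ z a - w ∙ z b) + (- β) * (w ∙ z a - w ∙ z c)
              ≈⟨ solve 5 (λ α β a b c → α :* (a :- b) :+ (:- β) :* (a :- c) := β :* (c :- a) :- α :* (b :- a)) refl α β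
                (w ∙ z a) (w ∙ z b) (w ∙ z c) ⟩
            β * (w ∙ z c - w ∙ z a) - α * (w ∙ z b - w ∙ z a)          ≈⟨ ≈⇒-≈0 (sym (eq w)) ⟩
            0#                                                         ∎
            where open ≈-Reasoning

      -- Of three points on a line the middle one is not exposed. For opposite signs of the
      -- coefficients the middle one is `a`; for equal signs `steeper`, used for `b` and for `c`,
      -- gives contradictory inequalities.
      not-collinear : ∀ {a b c} → a ∈ L → b ∈ L → c ∈ L → a ≢ b → a ≢ c → b ≢ c →
        ∀ {α β} → α ≉ 0# → β ≉ 0# →
        (∀ w → α * (w ∙ z b - w ∙ z a) ≈ β * (w ∙ z c - w ∙ z a)) → ⊥
      not-collinear a∈ b∈ c∈ a≢b a≢c b≢c {α} {β} α≉0 β≉0 eq = case <-cmp α 0# of λ where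
        (inj₁ α<0) → not-collinear⁺ a∈ b∈ c∈ a≢b a≢c b≢c (neg<0 α<0)
          (λ h → β≉0 (trans (sym (-‿involutive β)) (trans (-‿cong h) -0#≈0#)))
          (λ w → trans (sym (-‿distribˡ-* α _)) (trans (-‿cong (eq w)) (-‿distribˡ-* β _)))
        (inj₂ (inj₁ α≈0)) → α≉0 α≈0
        (inj₂ (inj₂ 0<α)) → not-collinear⁺ a∈ b∈ c∈ a≢b a≢c b≢c 0<α β≉0 eq

      private
        -- Lexicographic maximisation: a small multiple of `w` added to `u` orders the maximal face
        -- of `u` by `w` and leaves all other vertices behind.
        tilt : ∀ {u a k} → Top u a → k ∈ L → k ≢ a → u ∙ z k ≈ u ∙ z a →
          ∀ w → w ∙ z k ≈ w ∙ z a →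
          (∀ {c} → c ∈ L → u ∙ z c ≈ u ∙ z a → c ≢ a → c ≢ k → w ∙ z c < w ∙ z a) → Adjacent a k
        tilt {u} {a} {k} (a∈ , a-top) k∈ k≢a k-tie w w-tie w-below =
          let ε , _ , below = near-witness (near-all L near)
          in a∈ , k∈ , k≢a ∘ ≡.sym , line u ε w ,
             trans (line-∙ u ε w (z a)) (trans (+-cong (sym k-tie) (*-congˡ (sym w-tie))) (sym (line-∙ u ε w (z k)))) ,
               below
          where
          near : ∀ {c} → c ∈ L → Near (λ ε → c ≢ a → c ≢ k → line u ε w ∙ z c < line u ε w ∙ z a)
          near {c} c∈ = case em {P = u ∙ z c ≈ u ∙ z a} of λ where
            (yes c-tie) → near-always λ {ε} 0<ε c≢a c≢k → -<0⇒< (<-resp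
              (sym (trans (line-difference u ε w (z c) (z a)) (trans (+-congʳ (≈⇒-≈0 c-tie)) (+-identityˡ _)))) refl
              (by< (0<*0< 0<ε (<⇒0< (w-below c∈ c-tie c≢a c≢k)))
                (solve 3 (λ e x y → :0 :- e :* (x :- y) := e :* (y :- x)) refl ε (w ∙ z c) (w ∙ z a))))
            (no ¬c-tie) → near-map (λ h _ _ → h) (near-line-< u w (z c) (z a) (≤∧≉⇒< (a-top c∈) ¬c-tie))

      -- An edge of the face on which u is maximal.  Starting from w₀ exposing a,
      -- move along a generic direction y until exactly one point k of the face
      -- ties with a.
      adjacent-on-face : ∀ {u a b} → Top u a → b ∈ L → b ≢ a → u ∙ z b ≈ u ∙ z a →
        ∃[ k ] Adjacent a k × u ∙ z k ≈ u ∙ z a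
      adjacent-on-face {u} {a} {b} (a∈ , a-top) b∈ b≢a tie =
        k , tilt (a∈ , a-top) k∈L k≢a k-tie w (-≈0⇒≈ (trans (w-∙ k) k-zero)) w-below , k-tie
        where
        Z : List A
        Z = select (λ c → c ≢ a × u ∙ z c ≈ u ∙ z a) L
        Z⇒ : ∀ {c} → c ∈ Z → c ∈ L × c ≢ a × u ∙ z c ≈ u ∙ z a
        Z⇒ = ∈-select⁻ L
        b∈Z : b ∈ Z
        b∈Z = ∈-select⁺ b∈ (b≢a , tie)
        w₀ = proj₁ (exposed a∈)
        w₀-below : ∀ {c} → c ∈ L → c ≢ a → w₀ ∙ z c < w₀ ∙ z a
        w₀-below = proj₂ (exposed a∈)
        D : A → Point d
        D c = z c -ᵥ z a
        D-∙ : ∀ v c → v ∙ D c ≈ v ∙ z c - v ∙ z a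
        D-∙ v c = ∙--ᵥ v (z c) (z a)
        f : A → K
        f c = w₀ ∙ z c - w₀ ∙ z a
        f<0 : ∀ {c} → c ∈ Z → f c < 0#
        f<0 c∈ = <0⇒-<0 (w₀-below (proj₁ (Z⇒ c∈)) (proj₁ (proj₂ (Z⇒ c∈))))
        -- If `c` and `c′` catch up with `a` at the same time, then `y ∙ Y (c , c′)` is zero. These
        -- vectors are nonzero because no three vertices are collinear, so a generic `y` rules out
        -- such coincidences.
        Y : A × A → Point d
        Y (c , c′) = f c *ᵥ D c′ -ᵥ f c′ *ᵥ D c
        Y-∙ : ∀ v c c′ → v ∙ Y (c , c′) ≈ f c * (v ∙ z c′ - v ∙ z a) - f c′ * (v ∙ z c - v ∙ z a)
        Y-∙ v c c′ = trans (∙--ᵥ v _ _) (+-cong (trans (∙-*ᵥ (f c) v _) (*-congˡ (D-∙ v c′)))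
          (-‿cong (trans (∙-*ᵥ (f c′) v _) (*-congˡ (D-∙ v c)))))
        Distinct : A × A → Set
        Distinct p = proj₁ p ≢ proj₂ p
        pairs : List (A × A)
        pairs = select Distinct (cartesianProduct Z Z)
        Y-nonzero : ∀ {y} → y ∈ map Y pairs → ∃[ v ] v ∙ y ≉ 0#
        Y-nonzero y∈ =
          let (c , c′) , cc′∈ , y≡ = ∈-map⁻ Y y∈
              cc′∈′ , c≢c′ = ∈-select⁻ (cartesianProduct Z Z) cc′∈
              c∈ , c′∈ = ∈-cartesianProduct⁻ Z Z cc′∈′
              c∈L , c≢a , _ = Z⇒ c∈
              c′∈L , c′≢a , _ = Z⇒ c′∈
          in by-contradiction λ none → not-collinear a∈ c∈L c′∈L (c≢a ∘ ≡.sym) (c′≢a ∘ ≡.sym) c≢c′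
               (<⇒≉ (f<0 c′∈)) (<⇒≉ (f<0 c∈))
               λ v → sym (-≈0⇒≈ (trans (sym (Y-∙ v c c′))
                 (by-contradiction λ h → none (v , λ h′ → h (≡.subst (λ y → v ∙ y ≈ 0#) y≡ h′)))))
        generic = perturb (D b ∷ []) (map Y pairs) (proj₁ (exposed b∈))
          (λ { (here ≡.refl) → <-resp refl (sym (D-∙ _ b)) (<⇒0< (proj₂ (exposed b∈) a∈ (b≢a ∘ ≡.sym))) }) Y-nonzero
        y = proj₁ generic
        g : A → K
        g c = y ∙ z c - y ∙ z a
        exit = first-exit f g Z f<0 (b , b∈Z , <-resp refl (D-∙ y b) (proj₁ (proj₂ generic) (D b) (here ≡.refl)))
        t = proj₁ exit
        k = proj₁ (proj₂ (proj₂ (proj₂ exit)))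
        k∈Z = proj₁ (proj₂ (proj₂ (proj₂ (proj₂ exit))))
        k-zero : f k + t * g k ≈ 0#
        k-zero = proj₂ (proj₂ (proj₂ (proj₂ (proj₂ (proj₂ exit)))))
        k∈L = proj₁ (Z⇒ k∈Z)
        k≢a = proj₁ (proj₂ (Z⇒ k∈Z))
        k-tie = proj₂ (proj₂ (Z⇒ k∈Z))
        others : ∀ {c} → c ∈ Z → c ≢ k → f c + t * g c < 0#
        others {c} c∈ c≢k = ≤∧≉⇒< (proj₁ (proj₂ (proj₂ exit)) c c∈) λ c-zero →
            Y-nonzero-at-y (trans (Y-∙ y c k) (proportional {t} c-zero k-zero))
          where
          Y-nonzero-at-y : y ∙ Y (c , k) ≉ 0#
          Y-nonzero-at-y = proj₂ (proj₂ generic) (Y (c , k)) (∈-map⁺ Y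
            (∈-select⁺ {P = Distinct} {xs = cartesianProduct Z Z} (∈-cartesianProduct⁺ c∈ k∈Z) c≢k))
        w = line w₀ t y
        w-∙ : ∀ c → w ∙ z c - w ∙ z a ≈ f c + t * g c
        w-∙ c = line-difference w₀ t y (z c) (z a)
        w-below : ∀ {c} → c ∈ L → u ∙ z c ≈ u ∙ z a → c ≢ a → c ≢ k → w ∙ z c < w ∙ z a
        w-below {c} c∈ c-tie c≢a c≢k = -<0⇒< (<-resp (sym (w-∙ c)) refl (others (∈-select⁺ c∈ (c≢a , c-tie)) c≢k))

      private
        -- Suppose that `w` increases from `a` to `b`. At the first `t` at which another vertex ties
        -- with `a`, the maximal face of `u₀ + t w` contains an edge at `a`. As `w` is constant on
        -- that edge, so is `u₀`, although `u₀` exposes `a`.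
        span-≤ : ∀ {a} w → a ∈ L → (∀ {k} → Adjacent a k → w ∙ z k ≈ w ∙ z a) →
          ∀ {b} → b ∈ L → w ∙ z b ≤ w ∙ z a
        span-≤ {a} w a∈ const {b} b∈ = by-contradiction λ a<b →
          let exit = first-exit f g L′ f<0 (b , ∈-select⁺ b∈ (λ { ≡.refl → <-irrefl refl a<b }) , <⇒0< a<b)
              t = proj₁ exit
              e , e∈ , _ , e-zero = proj₂ (proj₂ (proj₂ exit))
              u* = line u₀ t w
              e∈L , e≢a = ∈-select⁻ L e∈
              a-top : ∀ {c} → c ∈ L → u* ∙ z c ≤ u* ∙ z a
              a-top {c} c∈ = case em {P = c ≡ a} of λ where
                (yes ≡.refl) → ≤-refl
                (no c≢a)     → -≤0⇒≤ (≤-resp (sym (line-difference u₀ t w (z c) (z a))) refl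
                  (proj₁ (proj₂ (proj₂ exit)) c (∈-select⁺ c∈ c≢a)))
              k , adj@(_ , k∈ , a≢k , _) , k-tie = adjacent-on-face {u*} (a∈ , a-top) e∈L e≢a
                (-≈0⇒≈ (trans (line-difference u₀ t w (z e) (z a)) e-zero))
          in <⇒≉ (u₀-below k∈ (a≢k ∘ ≡.sym)) (-≈0⇒≈
            (trans (sym (trans (+-congˡ (trans (*-congˡ (≈⇒-≈0 (const adj))) (zeroʳ t))) (+-identityʳ _)))
               (trans (sym (line-difference u₀ t w (z k) (z a))) (≈⇒-≈0 k-tie))))
          where
          u₀ = proj₁ (exposed a∈)
          u₀-below : ∀ {c} → c ∈ L → c ≢ a → u₀ ∙ z c < u₀ ∙ z a
          u₀-below = proj₂ (exposed a∈)
          L′ = select (_≢ a) L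
          f g : A → K
          f c = u₀ ∙ z c - u₀ ∙ z a
          g c = w ∙ z c - w ∙ z a
          f<0 : ∀ {c} → c ∈ L′ → f c < 0#
          f<0 c∈ = let c∈L , c≢a = ∈-select⁻ L c∈ in <0⇒-<0 (u₀-below c∈L c≢a)

      -- The edges at a vertex span the whole polytope.
      constant-on-neighbours : ∀ {a} w → a ∈ L → (∀ {k} → Adjacent a k → w ∙ z k ≈ w ∙ z a) →
        ∀ {b} → b ∈ L → w ∙ z b ≈ w ∙ z a
      constant-on-neighbours {a} w a∈ const {b} b∈ = antisym (span-≤ w a∈ const b∈)
        (by≤ (≤⇒0≤ (span-≤ (negᵥ w) a∈ (λ {k} adj → trans (negᵥ-∙ w (z k))
          (trans (-‿cong (const adj)) (sym (negᵥ-∙ w (z a))))) b∈))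
          (trans (solve 2 (λ x y → x :- y := :- y :- :- x) refl (w ∙ z b) (w ∙ z a))
            (sym (+-cong (negᵥ-∙ w (z a)) (-‿cong (negᵥ-∙ w (z b)))))))

      module _ {φ : A → Point d} (flex : Flexible φ) where

        -- The functional `u` of the edge remains one after a small multiple of `w` is added; the
        -- two instances of `flex` differ by `ε` times the claim.
        parallel : ∀ {a b} → Adjacent a b → ∀ w → w ∙ z a ≈ w ∙ z b → w ∙ φ a ≈ w ∙ φ b
        parallel {a} {b} (a∈ , b∈ , a≢b , u , tie , below) w w-tie =
          -≈0⇒≈ (*-zero-divisor (begin
            ε * (w ∙ φ a - w ∙ φ b)                                  ≈⟨ +-identityˡ _ ⟨
            0# + ε * (w ∙ φ a - w ∙ φ b)
              ≈⟨ +-congʳ (≈⇒-≈0 (flex (tops u below tie) (tops-b u below tie))) ⟨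
            (u ∙ φ a - u ∙ φ b) + ε * (w ∙ φ a - w ∙ φ b)            ≈⟨ line-difference u ε w (φ a) (φ b) ⟨
            line u ε w ∙ φ a - line u ε w ∙ φ b
              ≈⟨ ≈⇒-≈0 (flex (tops _ below′ tie′) (tops-b _ below′ tie′)) ⟩
            0#                                                       ∎) (0<⇒≉0 0<ε))
          where
          open ≈-Reasoning
          Below : Point d → Set
          Below u = ∀ {c} → c ∈ L → c ≢ a → c ≢ b → u ∙ z c < u ∙ z a
          tops : ∀ u → Below u → u ∙ z a ≈ u ∙ z b → Top u a
          tops u below tie = a∈ , λ {c} c∈ → case em {P = c ≡ a} of λ where
            (yes ≡.refl) → ≤-refl
            (no c≢a)     → case em {P = c ≡ b} of λ where
              (yes ≡.refl) → ≤-reflexive (sym tie)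
              (no c≢b)     → <⇒≤ (below c∈ c≢a c≢b)
          tops-b : ∀ u → Below u → u ∙ z a ≈ u ∙ z b → Top u b
          tops-b u below tie = b∈ , λ c∈ → ≤-trans (proj₂ (tops u below tie) c∈) (≤-reflexive tie)
          near : ∀ {c} → c ∈ L → Near (λ ε → c ≢ a → c ≢ b → line u ε w ∙ z c < line u ε w ∙ z a)
          near {c} c∈ = case em {P = c ≡ a ⊎ c ≡ b} of λ where
            (yes (inj₁ c≡a)) → near-always λ _ c≢a _ → ⊥-elim (c≢a c≡a)
            (yes (inj₂ c≡b)) → near-always λ _ _ c≢b → ⊥-elim (c≢b c≡b)
            (no h)           → near-map (λ h _ _ → h) (near-line-< u w (z c) (z a) (below c∈ (h ∘ inj₁) (h ∘ inj₂)))
          small = near-witness (near-all L near)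
          ε = proj₁ small
          0<ε = proj₁ (proj₂ small)
          below′ : Below (line u ε w)
          below′ = proj₂ (proj₂ small)
          tie′ : line u ε w ∙ z a ≈ line u ε w ∙ z b
          tie′ = trans (line-∙ u ε w (z a)) (trans (+-cong tie (*-congˡ w-tie)) (sym (line-∙ u ε w (z b))))

        -- A functional constant along the edge of `z` is constant along that of `φ`, so the second
        -- edge vector is a multiple of the first. The factor is read off from `w₀`, which is not
        -- constant on the edge.
        slope : ∀ {a b} → Adjacent a b → ∃[ μ ] (∀ w → w ∙ φ b - w ∙ φ a ≈ μ * (w ∙ z b - w ∙ z a))
        slope {a} {b} adj@(a∈ , b∈ , a≢b , _) = (w₀ ∙ φ b - w₀ ∙ φ a) * i , λ w →
          let r = (w ∙ z b - w ∙ z a) * i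
              v = line w (- r) w₀
              v-tie : v ∙ z b - v ∙ z a ≈ 0#
              v-tie = begin
                v ∙ z b - v ∙ z a
                  ≈⟨ line-difference w (- r) w₀ (z b) (z a) ⟩
                (w ∙ z b - w ∙ z a) + (- r) * δ
                  ≈⟨ solve 3 (λ x i e → x :+ (:- (x :* i)) :* e := x :* (:1 :- e :* i)) refl (w ∙ z b - w ∙ z a) i δ ⟩
                (w ∙ z b - w ∙ z a) * (1# - δ * i)                                   ≈⟨ *-congˡ (≈⇒-≈0 (sym δi≈1)) ⟩
                (w ∙ z b - w ∙ z a) * 0#                                             ≈⟨ zeroʳ _ ⟩
                0#                                                                   ∎
          in -≈0⇒≈ (begin
               (w ∙ φ b - w ∙ φ a) - (w₀ ∙ φ b - w₀ ∙ φ a) * i * (w ∙ z b - w ∙ z a)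
                 ≈⟨ solve 4 (λ x y i s → x :- y :* i :* s := x :+ (:- (s :* i)) :* y) refl (w ∙ φ b - w ∙ φ a)
                   (w₀ ∙ φ b - w₀ ∙ φ a) i (w ∙ z b - w ∙ z a) ⟩
               (w ∙ φ b - w ∙ φ a) + (- r) * (w₀ ∙ φ b - w₀ ∙ φ a)
                 ≈⟨ line-difference w (- r) w₀ (φ b) (φ a) ⟨
               v ∙ φ b - v ∙ φ a
                 ≈⟨ ≈⇒-≈0 (sym (parallel adj v (sym (-≈0⇒≈ v-tie)))) ⟩
               0#                                                                      ∎)
          where
          open ≈-Reasoning
          w₀ = proj₁ (exposed b∈)
          δ = w₀ ∙ z b - w₀ ∙ z a
          i = δ ⁻¹
          δi≈1 : δ * i ≈ 1#
          δi≈1 = ⁻¹-inverse (0<⇒≉0 (<⇒0< (proj₂ (exposed b∈) a∈ a≢b)))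

-- Polytopes with a non-homothetic flex

length-disjoint : {A : Set} {xs ys zs : List A} → Unique xs → Unique ys →
  (∀ {x} → x ∈ xs → x ∉ ys) → (∀ {x} → x ∈ xs → x ∈ zs) → (∀ {x} → x ∈ ys → x ∈ zs) →
  length xs ℕ.+ length ys ℕ.≤ length zs
length-disjoint {xs = xs} {ys} {zs} xs! ys! disjoint xs⊆ ys⊆ = begin
  length xs ℕ.+ length ys     ≡⟨ length-++ xs ⟨
  length (xs ++ ys)
    ≤⟨ length-⊆ (Unique.++⁺ xs! ys! λ (p , q) → disjoint p q) (λ p → case ∈-++⁻ xs p of λ where
      (inj₁ q) → xs⊆ q
      (inj₂ q) → ys⊆ q) ⟩
  length zs                   ∎
  where open ℕ.≤-Reasoning

module Rigidity (em : ExcludedMiddle 0ℓ) (ℝ : RealField) where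

  open Families em ℝ public

  length-disjoint-union : {A : Set} (N : A → List A) (q : ℕ) {xs ys : List A} → Unique xs → Unique ys →
    (∀ {x} → x ∈ xs → Unique (N x) × q ℕ.≤ length (N x)) →
    (∀ {x y} → x ∈ xs → y ∈ N x → y ∈ ys) →
    (∀ {x x′ y} → x ∈ xs → x′ ∈ xs → y ∈ N x → y ∈ N x′ → x ≡ x′) →
    length xs ℕ.* q ℕ.≤ length ys
  length-disjoint-union N q {[]}     _          _   _   _   _        = z≤n
  length-disjoint-union N q {x ∷ xs} {ys} (x∉ ∷ xs!) ys! big sub disjoint = begin
    q ℕ.+ length xs ℕ.* q           ≤⟨ ℕ.+-mono-≤ (proj₂ (big (here ≡.refl))) ih ⟩
    length (N x) ℕ.+ length rest    ≤⟨ length-disjoint (proj₁ (big (here ≡.refl))) (select-unique ys!)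
        (λ p q → proj₂ (∈-select⁻ ys q) p) (sub (here ≡.refl)) (λ p → proj₁ (∈-select⁻ ys p)) ⟩
    length ys                       ∎
    where
    open ℕ.≤-Reasoning
    rest = select (_∉ N x) ys
    ih = length-disjoint-union N q {xs} {rest} xs! (select-unique ys!) (big ∘ there)
      (λ {x′} {y} x′∈ y∈ → ∈-select⁺ {P = _∉ N x} (sub (there x′∈) y∈) λ y∈Nx →
        All.lookup x∉ x′∈ (disjoint (here ≡.refl) (there x′∈) y∈Nx y∈))
      (λ p q → disjoint (there p) (there q))

  length-remove : {A : Set} {xs : List A} {x : A} → Unique xs → x ∈ xs → suc (length (select (_≢ x) xs)) ℕ.≤ length xs
  length-remove {xs = xs} {x} xs! x∈ = length-⊆ {xs = x ∷ select (_≢ x) xs}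
    (All.tabulate (λ p x≡ → proj₂ (∈-select⁻ xs p) (≡.sym x≡)) ∷ select-unique xs!)
    λ { (here ≡.refl) → x∈ ; (there p) → proj₁ (∈-select⁻ xs p) }

  module RigidFamily {d : ℕ} {A : Set} (z φ : A → Point d) (L : List A)
    (exposed : ∀ {a} → a ∈ L → Family.Exposed z L a) (flex : Family.Flexible z L φ) where

    open Family z L

    -- On rigid elements φ is the homothety z ↦ λ z + c.
    record Rigid (λ′ : K) (c : Point d) (b : A) : Set where
      constructor rigid
      field value : ∀ w → w ∙ φ b ≈ λ′ * (w ∙ z b) + w ∙ c
    open Rigid public

    -- From the common value at `o`, the homothety runs along the edge with ratio `λ′` and `φ` with
    -- the slope `μ` of the edge; at `k` they differ by a multiple of the edge vector.
    defect : ∀ {λ′ c k o} → Adjacent k o → Rigid λ′ c o → ¬ Rigid λ′ c k →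
      ∃[ α ] α ≉ 0# × (∀ w → w ∙ φ k - (λ′ * (w ∙ z k) + w ∙ c) ≈ α * (w ∙ z o - w ∙ z k))
    defect {λ′} {c} {k} {o} adj rigid-o nonrigid-k = λ′ - μ , λ-μ≉0 , eq
      where
      μ = proj₁ (slope exposed flex adj)
      eq : ∀ w → w ∙ φ k - (λ′ * (w ∙ z k) + w ∙ c) ≈ (λ′ - μ) * (w ∙ z o - w ∙ z k)
      eq w = begin
        w ∙ φ k - (λ′ * (w ∙ z k) + w ∙ c)
          ≈⟨ solve 5 (λ φo φk l zk c → φk :- (l :* zk :+ c) := φo :- (φo :- φk) :- (l :* zk :+ c)) refl (w ∙ φ o)
            (w ∙ φ k) λ′ (w ∙ z k) (w ∙ c) ⟩
        w ∙ φ o - (w ∙ φ o - w ∙ φ k) - (λ′ * (w ∙ z k) + w ∙ c)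
          ≈⟨ +-congʳ (+-cong (value rigid-o w) (-‿cong (proj₂ (slope exposed flex adj) w))) ⟩
        (λ′ * (w ∙ z o) + w ∙ c) - μ * (w ∙ z o - w ∙ z k) - (λ′ * (w ∙ z k) + w ∙ c)
          ≈⟨ solve 5 (λ l zo c μ zk → (l :* zo :+ c) :- μ :* (zo :- zk) :- (l :* zk :+ c) := (l :- μ) :* (zo :- zk))
          refl λ′ (w ∙ z o) (w ∙ c) μ (w ∙ z k) ⟩
        (λ′ - μ) * (w ∙ z o - w ∙ z k)                                               ∎
        where open ≈-Reasoning
      λ-μ≉0 : λ′ - μ ≉ 0#
      λ-μ≉0 h = nonrigid-k (rigid λ w → -≈0⇒≈ (trans (eq w) (trans (*-congʳ h) (zeroˡ _))))

    -- The defect at `k` is a nonzero multiple of both edge vectors, which would put the three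
    -- vertices on a line. The counting arguments below rest on this.
    unique-rigid-neighbour : ∀ {λ′ c k o o′} → ¬ Rigid λ′ c k → Rigid λ′ c o → Rigid λ′ c o′ →
      Adjacent k o → Adjacent k o′ → o ≡ o′
    unique-rigid-neighbour {λ′} {c} {k} {o} {o′} nonrigid rigid-o rigid-o′ adj@(k∈ , o∈ , k≢o , _)
      adj′@(_ , o′∈ , k≢o′ , _) =
      by-contradiction λ o≢o′ →
        let α , α≉0 , eq = defect adj rigid-o nonrigid
            β , β≉0 , eq′ = defect adj′ rigid-o′ nonrigid
        in not-collinear exposed k∈ o∈ o′∈ k≢o k≢o′ o≢o′ α≉0 β≉0 λ w → trans (sym (eq w)) (eq′ w)

    module _ (spanning : ∀ w → (∀ {a} → a ∈ L → w ∙ z a ≈ 0#) → w ≋ 0ᵥ) where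

      -- A functional that vanishes at `z a` and along the edges at `a` vanishes on the family,
      -- hence is zero; so `z a` and the edge vectors number at least `d`. The family will be a
      -- facet, which has dimension `d - 1`.
      many-neighbours : ∀ {a} → a ∈ L → (N : List A) → (∀ {k} → Adjacent a k → k ∈ N) → d ℕ.≤ suc (length N)
      many-neighbours {a} a∈ N nbrs = ℕ.≮⇒≥ λ short →
        let ys = z a ∷ map (λ b → z b -ᵥ z a) N
            u , u≉0 , zeros = common-zero ys (≡.subst (λ n → suc n ℕ.< d) (≡.sym (length-map _ N)) short)
            const : ∀ {k} → Adjacent a k → u ∙ z k ≈ u ∙ z a
            const {k} adj = -≈0⇒≈ (trans (sym (∙--ᵥ u (z k) (z a)))
              (zeros′ u ys (λ y → zeros {y}) (there (∈-map⁺ (λ b → z b -ᵥ z a) (nbrs adj)))))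
        in u≉0 (spanning u λ b∈ → trans (constant-on-neighbours exposed u a∈ const b∈) (zeros (here ≡.refl)))
        where
        zeros′ : ∀ u ys → (∀ y → y ∈ ys → u ∙ y ≈ 0#) → ∀ {y} → y ∈ ys → u ∙ y ≈ 0#
        zeros′ u ys h y∈ = h _ y∈

      has-neighbour : 2 ℕ.≤ d → ∀ {a} → a ∈ L → ∃[ k ] Adjacent a k
      has-neighbour 2≤d {a} a∈ = by-contradiction λ none →
        ℕ.<-irrefl ≡.refl (ℕ.≤-trans 2≤d (many-neighbours a∈ [] λ {k} adj → ⊥-elim (none (k , adj))))

      -- All neighbours of `k` but at most one are nonrigid, and `k` itself makes up for the
      -- exception.
      many-nonrigid : Unique L → ∀ {λ′ c k} → k ∈ L → ¬ Rigid λ′ c k →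
        d ℕ.≤ suc (length (select (¬_ ∘ Rigid λ′ c) L))
      many-nonrigid L! {λ′} {c} {k} k∈ nonrigid = case em {P = ∃[ o ] Rigid λ′ c o × Adjacent k o} of λ where
          (yes (o , rigid-o , adj)) → count o λ adj′ rigid-k → unique-rigid-neighbour nonrigid rigid-k rigid-o adj′ adj
          -- There is no exceptional neighbour; `k` is a placeholder for it.
          (no none)                 → count k λ adj′ rigid-k → ⊥-elim (none (_ , rigid-k , adj′))
        where
        κ = select (¬_ ∘ Rigid λ′ c) L
        count : ∀ o → (∀ {n} → Adjacent k n → Rigid λ′ c n → n ≡ o) → d ℕ.≤ suc (length κ)
        count o partner = ℕ.≤-trans (many-neighbours k∈ (o ∷ select (_≢ k) κ) nbrs)
          (s≤s (length-remove (select-unique L!) (∈-select⁺ {P = ¬_ ∘ Rigid λ′ c} k∈ nonrigid)))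
          where
          nbrs : ∀ {n} → Adjacent k n → n ∈ o ∷ select (_≢ k) κ
          nbrs {n} adj@(_ , n∈ , k≢n , _) = case em {P = Rigid λ′ c n} of λ where
            (yes rigid-n) → here (partner adj rigid-n)
            (no ¬rigid-n) → there (∈-select⁺ {P = _≢ k} (∈-select⁺ {P = ¬_ ∘ Rigid λ′ c} n∈ ¬rigid-n) (k≢n ∘ ≡.sym))

      -- Let n be the number of rigid vertices. If n ≥ d - 1, the nonrigid ones, at least d - 1 in
      -- number, complete the count. Otherwise each rigid vertex has at least d - n nonrigid
      -- neighbours, different rigid vertices have different ones, and n + n (d - n) ≥ 2 (d - 1) for
      -- 2 ≤ n ≤ d - 1.
      large-family : Unique L → ∀ {λ′ c a a′ k} → 2 ℕ.≤ d → a ∈ L → a′ ∈ L → a ≢ a′ → Rigid λ′ c a → Rigid λ′ c a′ →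
        k ∈ L → ¬ Rigid λ′ c k → 2 ℕ.* ℕ.pred d ℕ.≤ length L
      large-family L! {λ′} {c} {a} {a′} {k} 2≤d a∈ a′∈ a≢a′ rigid-a rigid-a′ k∈ nonrigid = large
        where
        R : A → Set
        R = Rigid λ′ c
        S κ : List A
        S = select R L
        κ = select (¬_ ∘ R) L
        two : 2 ℕ.≤ length S
        two = length-⊆ {xs = a ∷ a′ ∷ []} ((a≢a′ ∷ []) ∷ [] ∷ []) λ where
          (here ≡.refl)         → ∈-select⁺ {P = R} a∈ rigid-a
          (there (here ≡.refl)) → ∈-select⁺ {P = R} a′∈ rigid-a′
        S+κ≤L : length S ℕ.+ length κ ℕ.≤ length L
        S+κ≤L = length-disjoint (select-unique L!) (select-unique L!)
          (λ p q → proj₂ (∈-select⁻ L q) (proj₂ (∈-select⁻ L p))) (λ p → proj₁ (∈-select⁻ L p))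
            (λ p → proj₁ (∈-select⁻ L p))
        N : A → List A
        N s = select (Adjacent s) κ
        N-large : ∀ {s} → s ∈ S → d ℕ.≤ length S ℕ.+ length (N s)
        N-large {s} s∈ = begin
          d
            ≤⟨ many-neighbours (proj₁ (∈-select⁻ L s∈)) (select (_≢ s) S ++ N s) nbrs ⟩
          suc (length (select (_≢ s) S ++ N s))                  ≡⟨ ≡.cong suc (length-++ (select (_≢ s) S)) ⟩
          suc (length (select (_≢ s) S)) ℕ.+ length (N s)
            ≤⟨ ℕ.+-monoˡ-≤ (length (N s)) (length-remove (select-unique L!) s∈) ⟩
          length S ℕ.+ length (N s)                              ∎
          where
          open ℕ.≤-Reasoning
          nbrs : ∀ {n} → Adjacent s n → n ∈ select (_≢ s) S ++ N s
          nbrs {n} adj@(_ , n∈ , s≢n , _) = case em {P = R n} of λ where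
            (yes rigid-n) → ∈-++⁺ˡ (∈-select⁺ {P = _≢ s} (∈-select⁺ {P = R} n∈ rigid-n) (s≢n ∘ ≡.sym))
            (no ¬rigid-n) → ∈-++⁺ʳ _ (∈-select⁺ {P = Adjacent s} (∈-select⁺ {P = ¬_ ∘ R} n∈ ¬rigid-n) adj)
        κ-large : ∀ q → d ℕ.≤ length S ℕ.+ q → (∀ {s} → s ∈ S → q ℕ.≤ length (N s)) → length S ℕ.* q ℕ.≤ length κ
        κ-large q _ big = length-disjoint-union N q (select-unique L!) (select-unique L!)
          (λ s∈ → select-unique (select-unique L!) , big s∈) (λ _ y∈ → proj₁ (∈-select⁻ κ y∈))
          λ {s} {s′} s∈ s′∈ y∈ y∈′ → let y∈κ , adj₁ = ∈-select⁻ κ y∈ in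
            unique-rigid-neighbour (proj₂ (∈-select⁻ L y∈κ)) (proj₂ (∈-select⁻ L s∈)) (proj₂ (∈-select⁻ L s′∈))
              (Adjacent-sym adj₁) (Adjacent-sym (proj₂ (∈-select⁻ κ y∈′)))
        large : 2 ℕ.* ℕ.pred d ℕ.≤ length L
        large = case ℕ.≤-total (ℕ.pred d) (length S) of λ where
            (inj₁ D≤S) → ℕ.≤-trans (ℕ.≤-trans (ℕ.≤-reflexive (≡.cong (ℕ.pred d ℕ.+_) (ℕ.+-identityʳ _)))
                           (ℕ.+-mono-≤ D≤S (ℕ.pred-mono-≤ (many-nonrigid L! k∈ nonrigid)))) S+κ≤L
            (inj₂ S≤D) → ℕ.≤-trans (ℕ.≤-trans (arithmetic S≤D) (ℕ.+-monoʳ-≤ (length S)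
                           (κ-large (d ℕ.∸ length S) (ℕ.≤-reflexive (≡.sym (ℕ.m+[n∸m]≡n (ℕ.≤-trans S≤D ℕ.pred[n]≤n))))
                              λ s∈ → ℕ.m≤n+o⇒m∸n≤o d (length S) (N-large s∈)))) S+κ≤L
          where
          arithmetic : length S ℕ.≤ ℕ.pred d → 2 ℕ.* ℕ.pred d ℕ.≤ length S ℕ.+ length S ℕ.* (d ℕ.∸ length S)
          arithmetic = sharp d (length S) 2≤d two
            where
            sharp : ∀ d n → 2 ℕ.≤ d → 2 ℕ.≤ n → n ℕ.≤ ℕ.pred d → 2 ℕ.* ℕ.pred d ℕ.≤ n ℕ.+ n ℕ.* (d ℕ.∸ n)
            sharp (suc D) n _ 2≤n n≤D = begin
              2 ℕ.* D                                  ≡⟨ ≡.cong (2 ℕ.*_) (ℕ.m+[n∸m]≡n n≤D) ⟨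
              2 ℕ.* (n ℕ.+ (D ℕ.∸ n))                  ≡⟨ ℕ.*-distribˡ-+ 2 n (D ℕ.∸ n) ⟩
              2 ℕ.* n ℕ.+ 2 ℕ.* (D ℕ.∸ n)              ≤⟨ ℕ.+-monoʳ-≤ (2 ℕ.* n) (ℕ.*-monoˡ-≤ (D ℕ.∸ n) 2≤n) ⟩
              2 ℕ.* n ℕ.+ n ℕ.* (D ℕ.∸ n)
                ≡⟨ ≡.cong (ℕ._+ n ℕ.* (D ℕ.∸ n)) (≡.cong (n ℕ.+_) (ℕ.+-identityʳ n)) ⟩
              n ℕ.+ n ℕ.+ n ℕ.* (D ℕ.∸ n)              ≡⟨ ℕ.+-assoc n n _ ⟩
              n ℕ.+ (n ℕ.+ n ℕ.* (D ℕ.∸ n))            ≡⟨ ≡.cong (n ℕ.+_) (ℕ.*-suc n (D ℕ.∸ n)) ⟨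
              n ℕ.+ n ℕ.* suc (D ℕ.∸ n)                ≡⟨ ≡.cong (λ k → n ℕ.+ n ℕ.* k) (ℕ.+-∸-assoc 1 n≤D) ⟨
              n ℕ.+ n ℕ.* (suc D ℕ.∸ n)                ∎
              where open ℕ.≤-Reasoning

      -- A polytope of dimension d ∸ 1 with a non-homothetic flex has at least
      -- 2 (d ∸ 1) vertices (Shephard).
      rigid-or-large : 2 ℕ.≤ d → Unique L → ∀ {a} → a ∈ L →
        (∃[ λ′ ] ∃[ c ] (∀ b → b ∈ L → Rigid λ′ c b)) ⊎ 2 ℕ.* ℕ.pred d ℕ.≤ length L
      rigid-or-large 2≤d L! {a} a∈ =
        let a′ , adj@(_ , a′∈ , a≢a′ , _) = has-neighbour 2≤d a∈
            λ′ , slope-eq = slope exposed flex adj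
        in along λ′ a′∈ a≢a′ slope-eq
        where
        along : ∀ λ′ {a′} → a′ ∈ L → a ≢ a′ → (∀ w → w ∙ φ a′ - w ∙ φ a ≈ λ′ * (w ∙ z a′ - w ∙ z a)) →
          (∃[ λ′ ] ∃[ c ] (∀ b → b ∈ L → Rigid λ′ c b)) ⊎ 2 ℕ.* ℕ.pred d ℕ.≤ length L
        along λ′ {a′} a′∈ a≢a′ slope-eq = case em {P = ∃[ k ] k ∈ L × ¬ Rigid λ′ c k} of λ where
            (no none)               → inj₁ (λ′ , c , λ b b∈ → by-contradiction λ h → none (b , b∈ , h))
            (yes (k , k∈ , ¬rigid)) → inj₂ (large-family L! 2≤d a∈ a′∈ a≢a′ rigid-a rigid-a′ k∈ ¬rigid)
          where
          c : Point d
          -- Together with the slope `λ′` of the edge from `a` to `a′`, this makes both ends of the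
          -- edge rigid.
          c = φ a -ᵥ λ′ *ᵥ z a
          c-∙ : ∀ w → w ∙ c ≈ w ∙ φ a - λ′ * (w ∙ z a)
          c-∙ w = trans (∙--ᵥ w _ _) (+-congˡ (-‿cong (∙-*ᵥ λ′ w (z a))))
          rigid-a : Rigid λ′ c a
          rigid-a = rigid λ w → trans (solve 2 (λ p s → p := s :+ (p :- s)) refl (w ∙ φ a) (λ′ * (w ∙ z a)))
            (+-congˡ (sym (c-∙ w)))
          rigid-a′ : Rigid λ′ c a′
          rigid-a′ = rigid λ w → begin
            w ∙ φ a′
              ≈⟨ solve 2 (λ p q → p := (p :- q) :+ q) refl (w ∙ φ a′) (w ∙ φ a) ⟩
            (w ∙ φ a′ - w ∙ φ a) + w ∙ φ a                                      ≈⟨ +-congʳ (slope-eq w) ⟩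
            λ′ * (w ∙ z a′ - w ∙ z a) + w ∙ φ a
              ≈⟨ solve 4 (λ l x y p → l :* (x :- y) :+ p := l :* x :+ (p :- l :* y)) refl λ′ (w ∙ z a′) (w ∙ z a)
                (w ∙ φ a) ⟩
            λ′ * (w ∙ z a′) + (w ∙ φ a - λ′ * (w ∙ z a))                        ≈⟨ +-congˡ (sym (c-∙ w)) ⟩
            λ′ * (w ∙ z a′) + w ∙ c                                             ∎
            where open ≈-Reasoning

-- Centrally symmetric polytopes and their facet normals

unique-map : {A B : Set} (f : A → B) {xs : List A} → Unique xs →
  (∀ {x y} → x ∈ xs → y ∈ xs → f x ≡ f y → x ≡ y) → Unique (map f xs)
unique-map f {[]}     _          _   = []
unique-map f {x ∷ xs} (x∉ ∷ xs!) inj =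
  All.tabulate (λ fy∈ fx≡ → let y , y∈ , eq = ∈-map⁻ f fy∈ in
    All.lookup x∉ y∈ (inj (here ≡.refl) (there y∈) (≡.trans fx≡ eq)))
  ∷ unique-map f xs! (λ p q → inj (there p) (there q))

length-allFin : ∀ n → length (allFin n) ≡ n
length-allFin n = length-tabulate (λ i → i)

module Configurations (em : ExcludedMiddle 0ℓ) (ℝ : RealField) where

  open Rigidity em ℝ public

  combination-∙ : ∀ {d n} (w : Fin n → K) (x : Fin n → Point d) (y : Point d) →
    combination w x ∙ y ≈ sum (λ i → w i * (x i ∙ y))
  combination-∙ {d} {n} w x y = begin
    sum (λ k → sum (λ i → w i * x i k) * y k)       ≈⟨ sum-cong-≋ (λ k → *-distribʳ-sum (y k) (λ i → w i * x i k)) ⟩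
    sum (λ k → sum (λ i → w i * x i k * y k))       ≈⟨ ∑-comm (λ k i → w i * x i k * y k) ⟩
    sum (λ i → sum (λ k → w i * x i k * y k))
      ≈⟨ sum-cong-≋ (λ i → trans (sum-cong-≋ λ k → *-assoc (w i) (x i k) (y k))
        (sym (*-distribˡ-sum (w i) (λ k → x i k * y k)))) ⟩
    sum (λ i → w i * sum (λ k → x i k * y k))       ∎
    where open ≈-Reasoning

  -- The vertices ± v i of a centrally symmetric polytope.  In a configuration the
  -- two vertices of a pair carry the same vector φ i.
  module Signed {d m : ℕ} (v : Fin m → Point d) where

    W : Set
    W = Fin m × Bool

    z : W → Point d
    z (i , true)  = v i
    z (i , false) = negᵥ (v i)

    L : List W
    L = cartesianProduct (allFin m) (true ∷ false ∷ [])

    L! : Unique L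
    L! = Unique.cartesianProduct⁺ (Unique.allFin⁺ m) (((λ ()) ∷ []) ∷ [] ∷ [])

    L-complete : ∀ a → a ∈ L
    L-complete (i , true)  = ∈-cartesianProduct⁺ (∈-allFin i) (here ≡.refl)
    L-complete (i , false) = ∈-cartesianProduct⁺ (∈-allFin i) (there (here ≡.refl))

    opposite : W → W
    opposite (i , b) = i , not b

    z-opposite : ∀ u a → u ∙ z (opposite a) ≈ - (u ∙ z a)
    z-opposite u (i , true)  = ∙-negᵥ u (v i)
    z-opposite u (i , false) = sym (trans (-‿cong (∙-negᵥ u (v i))) (-‿involutive _))

    same-index : ∀ {a b : W} → proj₁ a ≡ proj₁ b → a ≢ b → b ≡ opposite a
    same-index {i , true}  {.i , true}  ≡.refl a≢b = ⊥-elim (a≢b ≡.refl)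
    same-index {i , true}  {.i , false} ≡.refl a≢b = ≡.refl
    same-index {i , false} {.i , true}  ≡.refl a≢b = ≡.refl
    same-index {i , false} {.i , false} ≡.refl a≢b = ⊥-elim (a≢b ≡.refl)

    open Family z L public

    record IsConfiguration (φ : Fin m → Point d) : Set where
      field
        exposed  : ∀ {a} → a ∈ L → Exposed a
        flex     : Flexible (φ ∘ proj₁)
        spanning : ∀ u → (∀ a → u ∙ z a ≈ 0#) → u ≋ 0ᵥ

  module Vertices {d m : ℕ} (v φ : Fin m → Point d) (conf : Signed.IsConfiguration v φ) where

    open Signed v public
    open IsConfiguration conf public

    φ̂ : W → Point d
    φ̂ = φ ∘ proj₁

    tops-≈ : ∀ {u a b} → Top u a → Top u b → u ∙ z a ≈ u ∙ z b
    tops-≈ (a∈ , a-top) (b∈ , b-top) = antisym (b-top a∈) (a-top b∈)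

    top-positive : ∀ {u a} → ¬ (u ≋ 0ᵥ) → Top u a → 0# < u ∙ z a
    top-positive {u} {a} u≉0 (a∈ , a-top) ua≤0 = u≉0 (spanning u λ b → antisym (≤-trans (a-top (L-complete b)) ua≤0)
      (by≤ (neg≤0 (≤-trans (a-top (L-complete (opposite b))) ua≤0))
        (trans (solve 1 (λ x → x :- :0 := :- :- x) refl (u ∙ z b)) (-‿cong (sym (z-opposite u b))))))

    not-both-top : ∀ {u a} → ¬ (u ≋ 0ᵥ) → Top u a → ¬ Top u (opposite a)
    not-both-top {u} {a} u≉0 ⊤a ⊤ā = <-irrefl refl (<-trans (top-positive u≉0 ⊤ā)
      (<-resp (sym (z-opposite u a)) refl (by< (top-positive u≉0 ⊤a) (solve 1 (λ x → :0 :- :- x := x) refl (u ∙ z a)))))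

    tops : Point d → List W
    tops u = select (Top u) L

    ∈-tops : ∀ {u a} → Top u a → a ∈ tops u
    ∈-tops {u} ⊤a = ∈-select⁺ {P = Top u} (L-complete _) ⊤a

    tops⇒ : ∀ {u a} → a ∈ tops u → Top u a
    tops⇒ a∈ = proj₂ (∈-select⁻ L a∈)

    top-indices : Point d → List (Fin m)
    top-indices u = map proj₁ (tops u)

    top-indices-unique : ∀ {u} → ¬ (u ≋ 0ᵥ) → Unique (top-indices u)
    top-indices-unique u≉0 = unique-map proj₁ (select-unique L!) λ {a} {b} a∈ b∈ eq → by-contradiction λ a≢b →
      not-both-top u≉0 (tops⇒ a∈) (≡.subst (Top _) (same-index eq a≢b) (tops⇒ b∈))

    -- A vertex of the polar polytope, that is, a facet normal.
    record Vertex (q : Point d) : Set where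
      field
        nonzero    : ¬ (q ≋ 0ᵥ)
        determined : ∀ w → (∀ {a} → Top q a → w ∙ z a ≈ 0#) → w ≋ 0ᵥ
    open Vertex public

    many-tops : ∀ {q} → Vertex q → d ℕ.≤ length (tops q)
    many-tops {q} vertex = ℕ.≮⇒≥ λ short →
      let w , w≉0 , zeros = common-zero (map z (tops q)) (≡.subst (ℕ._< d) (≡.sym (length-map z (tops q))) short)
      in w≉0 (determined vertex w λ ⊤a → zeros (∈-map⁺ z (∈-tops ⊤a)))

    private
      shared-value : ∀ {u w a} → Top u a → (∀ {b} → Top u b → w ∙ z b ≈ 0#) → ∀ t →
        (∀ c → c ∈ L → ¬ Top u c → (u ∙ z c - u ∙ z a) + t * (w ∙ z c) ≤ 0#) →
        ∀ {b} → (u ∙ z b - u ∙ z a) + t * (w ∙ z b) ≈ 0# → Top (line u t w) b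
      shared-value {u} {w} {a} ⊤a w⊥ t below {b} eq = L-complete b , λ {c} _ → -≤0⇒≤ (≤-resp (difference c) refl (c≤ c))
        where
        difference : ∀ c → (u ∙ z c - u ∙ z a) + t * (w ∙ z c) ≈ line u t w ∙ z c - line u t w ∙ z b
        difference c = begin
          (u ∙ z c - u ∙ z a) + t * (w ∙ z c)
            ≈⟨ solve 1 (λ x → x := x :- :0) refl _ ⟩
          (u ∙ z c - u ∙ z a) + t * (w ∙ z c) - 0#
            ≈⟨ +-congˡ (-‿cong (sym eq)) ⟩
          (u ∙ z c - u ∙ z a) + t * (w ∙ z c) - ((u ∙ z b - u ∙ z a) + t * (w ∙ z b))
            ≈⟨ rearrange (u ∙ z c) (u ∙ z a) (w ∙ z c) (u ∙ z b) (w ∙ z b) ⟩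
          (u ∙ z c - u ∙ z b) + t * (w ∙ z c - w ∙ z b)
            ≈⟨ line-difference u t w (z c) (z b) ⟨
          line u t w ∙ z c - line u t w ∙ z b                                                  ∎
          where
          open ≈-Reasoning
          rearrange : ∀ uc ua wc ub wb → (uc - ua) + t * wc - ((ub - ua) + t * wb) ≈ (uc - ub) + t * (wc - wb)
          rearrange = solve 6 (λ t uc ua wc ub wb → (uc :- ua) :+ t :* wc :- ((ub :- ua) :+ t :* wb) := (uc :- ub) :+ t
            :* (wc :- wb)) refl t
        c≤ : ∀ c → (u ∙ z c - u ∙ z a) + t * (w ∙ z c) ≤ 0#
        c≤ c = case em {P = Top u c} of λ where
          (yes ⊤c) → ≤-reflexive (trans (+-cong (≈⇒-≈0 (tops-≈ ⊤c ⊤a)) (*-congˡ (w⊥ ⊤c)))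
            (solve 1 (λ t → :0 :+ t :* :0 := :0) refl t))
          (no ¬⊤c) → below c (L-complete c) ¬⊤c

      -- The direction `w` vanishes on the maximal face of `u`, so the face is kept until the ratio
      -- test adds a vertex to it. By central symmetry a nonzero `w` is positive somewhere, so this
      -- happens.
      advance : ∀ {u w a} → Top u a → (∀ {b} → Top u b → w ∙ z b ≈ 0#) → ¬ (w ≋ 0ᵥ) →
        ∃[ t ] 0# < t × (∀ b → Top u b → Top (line u t w) b) × ∃[ b ] ¬ Top u b × Top (line u t w) b
      advance {u} {w} {a} ⊤a w⊥ w≉0 =
        let t , 0<t , below , e , e∈ , _ , e-zero = exit
            top′ = shared-value ⊤a w⊥ t λ c c∈ ¬⊤c → below c (∈-select⁺ {P = ¬_ ∘ Top u} c∈ ¬⊤c)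
        in t , 0<t , (λ b ⊤b → shared-value ⊤a w⊥ t (λ c c∈ ¬⊤c → below c (∈-select⁺ {P = ¬_ ∘ Top u} c∈ ¬⊤c))
                        (trans (+-cong (≈⇒-≈0 (tops-≈ ⊤b ⊤a)) (*-congˡ (w⊥ ⊤b)))
                          (solve 1 (λ t → :0 :+ t :* :0 := :0) refl t))) ,
           e , proj₂ (∈-select⁻ L e∈) , shared-value ⊤a w⊥ t (λ c c∈ ¬⊤c → below c (∈-select⁺ {P = ¬_ ∘ Top u} c∈ ¬⊤c))
             e-zero
        where
        L′ = select (¬_ ∘ Top u) L
        f g : W → K
        f c = u ∙ z c - u ∙ z a
        g c = w ∙ z c
        f<0 : ∀ {c} → c ∈ L′ → f c < 0#
        f<0 {c} c∈ = <0⇒-<0 (≤∧≉⇒< (proj₂ ⊤a (L-complete c)) λ tie →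
          proj₂ (∈-select⁻ L c∈) (L-complete c , λ b∈ → ≤-trans (proj₂ ⊤a b∈) (≤-reflexive (sym tie))))
        positive⇒ : ∀ c → 0# < g c → ∃[ c ] c ∈ L′ × 0# < g c
        positive⇒ c 0<gc = c , ∈-select⁺ {P = ¬_ ∘ Top u} (L-complete c) (λ ⊤c → 0<⇒≉0 0<gc (w⊥ ⊤c)) , 0<gc
        rising : ∃[ c ] c ∈ L′ × 0# < g c
        rising = by-contradiction λ none → w≉0 (spanning w λ c → case <-cmp (g c) 0# of λ where
          (inj₁ gc<0)        → ⊥-elim (none (positive⇒ (opposite c) (<-resp refl (sym (z-opposite w c)) (neg<0 gc<0))))
          (inj₂ (inj₁ gc≈0)) → gc≈0
          (inj₂ (inj₂ 0<gc)) → ⊥-elim (none (positive⇒ c 0<gc)))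
        exit = first-exit f g L′ f<0 rising

      bigger : ∀ {u u′} → (∀ b → Top u b → Top u′ b) → ∃[ b ] ¬ Top u b × Top u′ b →
        length (tops u) ℕ.< length (tops u′)
      bigger {u} {u′} sub (b , ¬⊤b , ⊤b) = length-select-< {P = Top u} {Q = Top u′} L! (λ _ → sub _)
        (L-complete b) ⊤b ¬⊤b

      one-nonzero : ∀ {x y s t} → 0# < s → 0# < t → x ≉ 0# → x + s * y ≈ 0# → x + t * - y ≉ 0#
      one-nonzero {x} {y} {s} {t} 0<s 0<t x≉0 p q = x≉0 (*-zero-divisor (begin
        (s + t) * x
          ≈⟨ solve 4 (λ x y s t → (s :+ t) :* x := t :* (x :+ s :* y) :+ s :* (x :+ t :* :- y)) refl x y s t ⟩
        t * (x + s * y) + s * (x + t * - y)          ≈⟨ +-cong (*-congˡ p) (*-congˡ q) ⟩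
        t * 0# + s * 0#                              ≈⟨ solve 2 (λ s t → t :* :0 :+ s :* :0 := :0) refl s t ⟩
        0#                                           ∎) (0<⇒≉0 (0<+0< 0<s 0<t)))
        where open ≈-Reasoning

      -- As long as the vertices of the maximal face do not span, there is a `w` that vanishes on
      -- them, and one can advance along `w` and along `- w`; by `one-nonzero`, `y` is not killed at
      -- both ends. The face grows each time, and the fuel `n` bounds the vertices still missing.
      climb : ∀ n (y : Point d) {u a} → length L ℕ.≤ length (tops u) ℕ.+ n → Top u a → u ∙ y ≉ 0# →
        ∃[ q ] Vertex q × Top q a × q ∙ y ≉ 0#
      climb n y {u} {a} fuel ⊤a uy≉0 = case em {P = ∃[ w ] ¬ (w ≋ 0ᵥ) × (∀ b → Top u b → w ∙ z b ≈ 0#)} of λ where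
          (no none) → u , record
            { nonzero    = λ u≋0 → uy≉0 (0ᵥ-∙ u≋0)
            ; determined = λ w w⊥ → by-contradiction λ w≉0 → none (w , w≉0 , λ _ → w⊥) } , ⊤a , uy≉0
          (yes (w , w≉0 , w⊥)) → move w (advance ⊤a (w⊥ _) w≉0)
            (advance {w = negᵥ w} ⊤a (λ ⊤b → trans (negᵥ-∙ w _) (trans (-‿cong (w⊥ _ ⊤b)) -0#≈0#))
              λ w≋0 → w≉0 λ k → trans (solve 1 (λ x → x := (:- :1) :* ((:- :1) :* x)) refl (w k))
                (trans (*-congˡ (w≋0 k)) (zeroʳ _)))
        where
        Advance : Point d → Set
        Advance w = ∃[ t ] 0# < t × (∀ b → Top u b → Top (line u t w) b) × ∃[ b ] ¬ Top u b × Top (line u t w) b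
        next : ∀ n {u′} → length L ℕ.≤ length (tops u) ℕ.+ n → length (tops u) ℕ.< length (tops u′) →
          Top u′ a → u′ ∙ y ≉ 0# → ∃[ q ] Vertex q × Top q a × q ∙ y ≉ 0#
        next zero    fuel more _ _ = ⊥-elim (ℕ.<-irrefl ≡.refl (ℕ.<-≤-trans more (ℕ.≤-trans
          (length-⊆ (select-unique L!) (λ _ → L-complete _)) (ℕ.≤-trans fuel (ℕ.≤-reflexive (ℕ.+-identityʳ _))))))
        next (suc n) fuel more = climb n y (ℕ.≤-trans fuel
          (ℕ.≤-trans (ℕ.≤-reflexive (ℕ.+-suc _ n)) (ℕ.+-monoˡ-≤ n more)))
        move : ∀ w → Advance w → Advance (negᵥ w) → ∃[ q ] Vertex q × Top q a × q ∙ y ≉ 0#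
        move w (s , 0<s , sub , new) (t , 0<t , sub′ , new′) = case em {P = line u s w ∙ y ≈ 0#} of λ where
          (no h)  → next n fuel (bigger sub new) (sub a ⊤a) h
          (yes h) → next n fuel (bigger sub′ new′) (sub′ a ⊤a) λ h′ →
            one-nonzero 0<s 0<t uy≉0 (trans (sym (line-∙ u s w y)) h)
              (trans (sym (trans (line-∙ u t (negᵥ w) y) (+-congˡ (*-congˡ (negᵥ-∙ w y))))) h′)

    -- Expresses that the normals of the facets at a vertex span the space, in the form needed to
    -- detect a nonzero `y`.
    vertex-at : ∀ a y → ∃[ w ] w ∙ y ≉ 0# → ∃[ q ] Vertex q × Top q a × q ∙ y ≉ 0#
    vertex-at a y y≉0 =
      let u , positive , nonzero = perturb (map (λ b → z a -ᵥ z b) (select (_≢ a) L)) (y ∷ [])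
            (proj₁ (exposed (L-complete a)))
            ps>0 λ { (here ≡.refl) → y≉0 }
          a-top : ∀ {b} → b ∈ L → u ∙ z b ≤ u ∙ z a
          a-top {b} b∈ = case em {P = b ≡ a} of λ where
            (yes ≡.refl) → ≤-refl
            (no b≢a)     → <⇒≤ (0<⇒< (<-resp refl (∙--ᵥ u (z a) (z b))
              (positive _ (∈-map⁺ (λ b → z a -ᵥ z b) (∈-select⁺ {P = _≢ a} b∈ b≢a)))))
      in climb (length L) y (ℕ.m≤n+m _ _) (L-complete a , a-top) (nonzero y (here ≡.refl))
      where
      ps>0 : ∀ {p} → p ∈ map (λ b → z a -ᵥ z b) (select (_≢ a) L) → 0# < proj₁ (exposed (L-complete a)) ∙ p
      ps>0 p∈ =
        let b , b∈ , p≡ = ∈-map⁻ (λ b → z a -ᵥ z b) p∈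
            b∈L , b≢a = ∈-select⁻ L b∈
            u , below = exposed (L-complete a)
        in ≡.subst (λ p → 0# < u ∙ p) (≡.sym p≡) (<-resp refl (sym (∙--ᵥ u (z a) (z b))) (<⇒0< (below b∈L b≢a)))

-- The case in which every facet is large

module Nonrigid (em : ExcludedMiddle 0ℓ) (ℝ : RealField) where

  open Configurations em ℝ public

  module _ {d m : ℕ} (v φ : Fin m → Point d) (conf : Signed.IsConfiguration v φ)
    (3≤d : 3 ℕ.≤ d) (m<2d : m ℕ.< 2 ℕ.* d) where

    open Vertices v φ conf

    private
      module _ (large : ∀ {q} → Vertex q → 2 ℕ.* ℕ.pred d ℕ.≤ length (tops q))
        (q : Fin m → Point d) (q-vertex : ∀ j → Vertex (q j)) (q-misses : ∀ j b → ¬ Top (q j) (j , b))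
        (q-differs : ∀ j → ∃[ i ] ∃[ b ] Top (q j) (i , b) × q j ∙ φ i ≉ q j ∙ φ j) where

        misses : ∀ j → j ∉ top-indices (q j)
        misses j j∈ = let a , a∈ , eq = ∈-map⁻ proj₁ j∈ in
          q-misses j (proj₂ a) (≡.subst (λ i → Top (q j) (i , proj₂ a)) (≡.sym eq) (tops⇒ a∈))

        -- A pair contributes at most one vertex to a facet. A facet with `2 (d - 1)` vertices that
        -- missed both `j` and `k` would therefore require `2 d` pairs.
        others : ∀ {j k} → k ≢ j → ∃[ b ] Top (q j) (k , b)
        others {j} {k} k≢j = by-contradiction λ none → ℕ.<-irrefl ≡.refl (ℕ.<-≤-trans m<2d (begin
          2 ℕ.* d                                        ≡⟨ double d 3≤d ⟨
          2 ℕ.* ℕ.pred d ℕ.+ 2                           ≤⟨ ℕ.+-monoˡ-≤ 2 (large (q-vertex j)) ⟩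
          length (tops (q j)) ℕ.+ 2                      ≡⟨ ≡.cong (ℕ._+ 2) (length-map proj₁ (tops (q j))) ⟨
          length (top-indices (q j)) ℕ.+ 2
            ≤⟨ length-disjoint {ys = j ∷ k ∷ []} (top-indices-unique (nonzero (q-vertex j)))
              (((k≢j ∘ ≡.sym) ∷ []) ∷ [] ∷ []) (λ { i∈ (here ≡.refl) → misses j i∈
                ; i∈ (there (here ≡.refl)) → let a , a∈ , eq = ∈-map⁻ proj₁ i∈ in
                    none (proj₂ a , ≡.subst (λ i → Top (q j) (i , proj₂ a)) (≡.sym eq) (tops⇒ a∈)) })
              (λ _ → ∈-allFin _) (λ _ → ∈-allFin _) ⟩
          length (allFin m)                              ≡⟨ length-allFin m ⟩
          m                                              ∎))
          where
          open ℕ.≤-Reasoning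
          double : ∀ d → 3 ℕ.≤ d → 2 ℕ.* ℕ.pred d ℕ.+ 2 ≡ 2 ℕ.* d
          double (suc D) _ = ≡.trans (ℕ.+-comm (2 ℕ.* D) 2) (≡.sym (ℕ.*-suc 2 D))

        agree : ∀ {j k l} → k ≢ j → l ≢ j → q j ∙ φ k ≈ q j ∙ φ l
        agree k≢j l≢j = flex (proj₂ (others k≢j)) (proj₂ (others l≢j))

        disagree : ∀ {j k} → k ≢ j → q j ∙ φ k ≉ q j ∙ φ j
        disagree {j} {k} k≢j eq =
          let i , b , ⊤i , φi≉φj = q-differs j
              i≢j : i ≢ j
              i≢j i≡j = q-misses j b (≡.subst (λ i → Top (q j) (i , b)) i≡j ⊤i)
          in φi≉φj (trans (agree i≢j k≢j) eq)

        -- At least `2 (d - 1)` pairs meet the facet and `j` does not; since `d ≥ 3`, this leaves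
        -- enough unknowns for the linear system in `impossible`.
        d+2≤m : Fin m → suc (suc d) ℕ.≤ m
        d+2≤m j = begin
          2 ℕ.+ d                                 ≤⟨ small d 3≤d ⟩
          suc (2 ℕ.* ℕ.pred d)                    ≤⟨ s≤s (large (q-vertex j)) ⟩
          suc (length (tops (q j)))               ≡⟨ ≡.cong suc (length-map proj₁ (tops (q j))) ⟨
          suc (length (top-indices (q j)))
            ≤⟨ length-disjoint {xs = j ∷ []} ([] ∷ []) (top-indices-unique (nonzero (q-vertex j)))
              (λ { (here ≡.refl) → misses j }) (λ _ → ∈-allFin _) (λ _ → ∈-allFin _) ⟩
          length (allFin m)                       ≡⟨ length-allFin m ⟩
          m                                       ∎
          where
          open ℕ.≤-Reasoning
          small : ∀ d → 3 ℕ.≤ d → 2 ℕ.+ d ℕ.≤ suc (2 ℕ.* ℕ.pred d)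
          small (suc D) (s≤s 2≤D) = s≤s (ℕ.≤-trans (ℕ.+-monoˡ-≤ D 2≤D)
            (ℕ.≤-reflexive (≡.cong (D ℕ.+_) (≡.sym (ℕ.+-identityʳ D)))))

        relation-trivial : ∀ c j → c j ≈ 0# → combination c q ≋ 0ᵥ → ∀ i → i ≢ j → c i ≈ 0#
        relation-trivial c j cj≈0 relation i i≢j = *-zero-divisor (begin
            (q i ∙ δ) * c i                    ≈⟨ *-comm _ _ ⟩
            c i * (q i ∙ δ)                    ≈⟨ sum-single i vanish ⟨
            sum (λ k → c k * (q k ∙ δ))        ≈⟨ combination-∙ c q δ ⟨
            combination c q ∙ δ                ≈⟨ 0ᵥ-∙ relation ⟩
            0#                                 ∎) λ eq → disagree (i≢j ∘ ≡.sym)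
              (sym (-≈0⇒≈ (trans (sym (∙--ᵥ (q i) (φ i) (φ j))) eq)))
          where
          open ≈-Reasoning
          δ : Point d
          δ = φ i -ᵥ φ j
          vanish : ∀ k → k ≢ i → c k * (q k ∙ δ) ≈ 0#
          vanish k k≢i = case k Fin.≟ j of λ where
            (yes ≡.refl) → trans (*-congʳ cj≈0) (zeroˡ _)
            (no k≢j)     → trans (*-congˡ (trans (∙--ᵥ (q k) (φ i) (φ j)) (≈⇒-≈0 (agree (k≢i ∘ ≡.sym) (k≢j ∘ ≡.sym)))))
              (zeroʳ _)

        impossible : Fin m → ⊥
        impossible j =
          -- One equation for `c j ≈ 0#` and `d` for the coordinates of the relation, in at least
          -- `d + 2` unknowns.
          let c , c≉0 , zeros = common-zero (unit j ∷ columns)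
                (≡.subst (λ n → suc n ℕ.< m) (≡.sym (length-tabulate {n = d} _)) (d+2≤m j))
              cj≈0 : c j ≈ 0#
              cj≈0 = trans (sym (unit-∙ j c)) (trans (∙-comm (unit j) c) (zeros (here ≡.refl)))
          in c≉0 λ i → case i Fin.≟ j of λ where
               (yes i≡j) → ≡.subst (λ i → c i ≈ 0#) (≡.sym i≡j) cj≈0
               (no i≢j)  → relation-trivial c j cj≈0 (zeros′ c λ _ y∈ → zeros (there y∈)) i i≢j
          where
          columns : List (Point m)
          columns = tabulate (λ (k : Fin d) (j : Fin m) → q j k)
          zeros′ : ∀ c → (∀ y → y ∈ columns → c ∙ y ≈ 0#) → ∀ k → combination c q k ≈ 0#
          zeros′ c zeros k = zeros (λ j → q j k) (∈-tabulate⁺ k)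

    -- If every polar vertex lies on all but at most one pair of facets ± i, then
    -- each index is missed by some polar vertex q.  These m vertices satisfy only
    -- one linear relation, because applying φ i - φ j to a relation leaves just
    -- the terms of index i and j.
    all-large⇒constant : (∀ {q} → Vertex q → 2 ℕ.* ℕ.pred d ℕ.≤ length (tops q)) →
      ∀ i j w → w ∙ φ i ≈ w ∙ φ j
    all-large⇒constant large i₀ j₀ w₀ = by-contradiction λ φ≉ →
      impossible large (λ j → proj₁ (missing φ≉ j)) (λ j → proj₁ (proj₂ (missing φ≉ j)))
        (λ j → proj₁ (proj₂ (proj₂ (missing φ≉ j)))) (λ j → proj₂ (proj₂ (proj₂ (missing φ≉ j)))) j₀
      where
      module _ (φ≉ : w₀ ∙ φ i₀ ≉ w₀ ∙ φ j₀) where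
        different : ∀ j → ∃[ i ] ∃[ w ] w ∙ (φ i -ᵥ φ j) ≉ 0#
        different j = by-contradiction λ none →
          let same : ∀ i → w₀ ∙ φ i ≈ w₀ ∙ φ j
              same i = by-contradiction λ h → none (i , w₀ , λ eq → h (-≈0⇒≈ (trans (sym (∙--ᵥ w₀ (φ i) (φ j))) eq)))
          in φ≉ (trans (same i₀) (sym (same j₀)))
        missing : ∀ j → ∃[ q ] Vertex q × (∀ b → ¬ Top q (j , b)) × (∃[ i ] ∃[ b ] Top q (i , b) × q ∙ φ i ≉ q ∙ φ j)
        missing j =
          let i , w , h = different j
              q , vertex , ⊤i , q≉ = vertex-at (i , true) (φ i -ᵥ φ j) (w , h)
              φi≉φj : q ∙ φ i ≉ q ∙ φ j
              φi≉φj eq = q≉ (trans (∙--ᵥ q (φ i) (φ j)) (≈⇒-≈0 eq))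
          in q , vertex , (λ b ⊤j → φi≉φj (flex ⊤i ⊤j)) , i , true , ⊤i , φi≉φj

-- The case in which some facet is homothetic

two-distinct : {A : Set} {xs : List A} → Unique xs → 2 ℕ.≤ length xs → ∃[ x ] ∃[ y ] x ∈ xs × y ∈ xs × x ≢ y
two-distinct {xs = x ∷ y ∷ _} ((x≢y ∷ _) ∷ _) _ = x , y , here ≡.refl , there (here ≡.refl) , x≢y
two-distinct {xs = _ ∷ []} _ (s≤s ())

module RigidVertex (em : ExcludedMiddle 0ℓ) (ℝ : RealField) where

  open Nonrigid em ℝ public

  ≈-⇒≈0 : ∀ {x} → x ≈ - x → x ≈ 0#
  ≈-⇒≈0 {x} eq = *-zero-divisor (trans (solve 1 (λ x → (:1 :+ :1) :* x := x :- :- x) refl x) (≈⇒-≈0 eq))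
    (0<⇒≉0 (0<+0< 0<1 0<1))

  module _ {d m : ℕ} (v φ : Fin m → Point d) (conf : Signed.IsConfiguration v φ)
    (3≤d : 3 ℕ.≤ d) (m<2d : m ℕ.< 2 ℕ.* d) where

    open Vertices v φ conf

    z-nonzero : ∀ a → ∃[ u ] 0# < u ∙ z a
    z-nonzero a = u , λ ua≤0 → proj₂ (exposed (L-complete a)) (L-complete (opposite a)) (λ eq → ≢opposite a (≡.sym eq))
        (≤-trans ua≤0 (by≤ (neg≤0 ua≤0) (trans (solve 1 (λ x → x :- :0 := x) refl _) (z-opposite u a))))
      where
      u = proj₁ (exposed (L-complete a))
      ≢opposite : ∀ a → a ≢ opposite a
      ≢opposite (i , true)  ()
      ≢opposite (i , false) ()

    opposite-involutive : ∀ a → opposite (opposite a) ≡ a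
    opposite-involutive (i , true)  = ≡.refl
    opposite-involutive (i , false) = ≡.refl

    index-length : {xs : List W} {is : List (Fin m)} → Unique (map proj₁ xs) → Unique is →
      (∀ {a} → a ∈ xs → proj₁ a ∉ is) → length xs ℕ.+ length is ℕ.≤ m
    index-length {xs} {is} xs! is! disjoint = begin
      length xs ℕ.+ length is                  ≡⟨ ≡.cong (ℕ._+ length is) (length-map proj₁ xs) ⟨
      length (map proj₁ xs) ℕ.+ length is
        ≤⟨ length-disjoint xs! is! (λ i∈ i∈is → let a , a∈ , eq = ∈-map⁻ proj₁ i∈ in
          disjoint a∈ (≡.subst (_∈ is) eq i∈is)) (λ _ → ∈-allFin _) (λ _ → ∈-allFin _) ⟩
      length (allFin m)                        ≡⟨ length-allFin m ⟩
      m                                        ∎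
      where open ℕ.≤-Reasoning

    -- Each facet meets at least `d` pairs, and there are fewer than `2 d`. Only the index is
    -- shared; the vertices may be opposite.
    shared-index : ∀ {p q} → Vertex p → Vertex q → ∃[ i ] ∃[ b ] ∃[ b′ ] Top p (i , b) × Top q (i , b′)
    shared-index {p} {q} vp vq = by-contradiction λ none → ℕ.<-irrefl ≡.refl (ℕ.<-≤-trans m<2d (begin
      2 ℕ.* d                                                ≡⟨ ≡.cong (d ℕ.+_) (ℕ.+-identityʳ d) ⟩
      d ℕ.+ d                                                ≤⟨ ℕ.+-mono-≤ (many-tops vp) (many-tops vq) ⟩
      length (tops p) ℕ.+ length (tops q)
        ≡⟨ ≡.cong (length (tops p) ℕ.+_) (length-map proj₁ (tops q)) ⟨
      length (tops p) ℕ.+ length (top-indices q)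
        ≤⟨ index-length (top-indices-unique (nonzero vp)) (top-indices-unique (nonzero vq))
          (λ {a} a∈ i∈ → let b , b∈ , eq = ∈-map⁻ proj₁ i∈ in
            none (proj₁ a , proj₂ a , proj₂ b , tops⇒ a∈ , ≡.subst (λ i → Top q (i , proj₂ b)) (≡.sym eq) (tops⇒ b∈))) ⟩
      m                                                      ∎))
      where open ℕ.≤-Reasoning

    -- A functional constant along the edges at `a` is constant on the polytope, and by central
    -- symmetry this constant is zero. So the edge vectors alone span.
    all-neighbours : ∀ a (N : List W) → (∀ {k} → Adjacent a k → k ∈ N) → d ℕ.≤ length N
    all-neighbours a N nbrs = ℕ.≮⇒≥ λ short →
      let u , u≉0 , zeros = common-zero (map (λ b → z b -ᵥ z a) N) (≡.subst (ℕ._< d) (≡.sym (length-map _ N)) short)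
      in u≉0 (all-zero u λ adj → -≈0⇒≈ (trans (sym (∙--ᵥ u _ (z a))) (zeros (∈-map⁺ (λ b → z b -ᵥ z a) (nbrs adj)))))
      where
      all-zero : ∀ u → (∀ {k} → Adjacent a k → u ∙ z k ≈ u ∙ z a) → u ≋ 0ᵥ
      all-zero u const = spanning u λ b → trans (same b) (≈-⇒≈0 (trans (sym (same (opposite a))) (z-opposite u a)))
        where
        same : ∀ b → u ∙ z b ≈ u ∙ z a
        same b = constant-on-neighbours exposed u (L-complete a) const (L-complete b)

    module _ {p} (vertex : Vertex p) (λ′ : K) (homothety : ∀ b → Top p b → ∀ w → w ∙ φ̂ b ≈ λ′ * (w ∙ z b)) where

      -- Now `φ` vanishes on the facet `p`, and every facet shares a pair with `p`. So `q ∙ φ` is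
      -- zero on the facet of every normal `q`, whereas a nonzero `φ i` would be detected by some
      -- facet at `i`.
      zero-slope⇒constant : λ′ ≈ 0# → ∀ i w → w ∙ φ i ≈ 0#
      zero-slope⇒constant λ′≈0 i w = by-contradiction λ h →
        let q , vq , ⊤i , q≉0 = vertex-at (i , true) (φ i) (w , h)
            j , b , b′ , ⊤p , ⊤q = shared-index vertex vq
        in q≉0 (trans (flex ⊤i ⊤q) (trans (homothety (j , b) ⊤p q) (trans (*-congʳ λ′≈0) (zeroˡ _))))

      -- S collects the vertices in the homothety class of the facet p.  A pair ± a
      -- is in S ∪ - S or else its index is in R.
      record InS (a : W) : Set where
        constructor inS
        field scaled : ∀ w → w ∙ φ̂ a ≈ λ′ * (w ∙ z a)
      open InS

      OutS : Fin m → Set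
      OutS i = ¬ InS (i , true) × ¬ InS (i , false)

      S : List W
      S = select InS L

      R : List (Fin m)
      R = select OutS (allFin m)

      ∈S⇒ : ∀ {a} → a ∈ S → InS a
      ∈S⇒ a∈ = proj₂ (∈-select⁻ L a∈)

      ∈S : ∀ {a} → InS a → a ∈ S
      ∈S {a} = ∈-select⁺ {P = InS} (L-complete a)

      ∈R⇒ : ∀ {a} → proj₁ a ∈ R → ¬ InS a
      ∈R⇒ {i , true}  i∈ = proj₁ (proj₂ (∈-select⁻ (allFin m) i∈))
      ∈R⇒ {i , false} i∈ = proj₂ (proj₂ (∈-select⁻ (allFin m) i∈))

      trichotomy : ∀ a → InS a ⊎ InS (opposite a) ⊎ proj₁ a ∈ R
      trichotomy a@(i , σ) = case em {P = InS a} of λ where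
          (yes h) → inj₁ h
          (no h)  → case em {P = InS (opposite a)} of λ where
            (yes h′) → inj₂ (inj₁ h′)
            (no h′)  → inj₂ (inj₂ (∈-select⁺ {P = OutS} (∈-allFin i) (out σ h h′)))
        where
        out : ∀ σ → ¬ InS (i , σ) → ¬ InS (i , not σ) → OutS i
        out true  h h′ = h , h′
        out false h h′ = h′ , h

      S-large : d ℕ.≤ length S
      S-large = ℕ.≤-trans (many-tops vertex) (length-⊆ (select-unique L!) λ a∈ → ∈S (inS (homothety _ (tops⇒ a∈))))

      module _ (λ′≉0 : λ′ ≉ 0#) where

        not-both-in-S : ∀ {a} → InS a → ¬ InS (opposite a)
        not-both-in-S {a} sa sā = let u , 0<ua = z-nonzero a in
          0<⇒≉0 0<ua (≈-⇒≈0 (-≈0⇒≈ (*-zero-divisor (begin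
            λ′ * (u ∙ z a - - (u ∙ z a))
              ≈⟨ solve 3 (λ l x y → l :* (x :- y) := l :* x :- l :* y) refl λ′ (u ∙ z a) (- (u ∙ z a)) ⟩
            λ′ * (u ∙ z a) - λ′ * - (u ∙ z a)
              ≈⟨ +-cong (sym (scaled sa u)) (-‿cong (trans (*-congˡ (sym (z-opposite u a))) (sym (scaled sā u)))) ⟩
            u ∙ φ̂ a - u ∙ φ̂ a                             ≈⟨ -‿inverseʳ _ ⟩
            0#                                            ∎) λ′≉0)))
          where open ≈-Reasoning

        -- The common value of `u ∙ φ` would be both `λ′` and `- λ′` times the positive maximum of
        -- `u`.
        conflict : ∀ {u a b} → ¬ (u ≋ 0ᵥ) → Top u a → InS a → Top u b → InS (opposite b) → ⊥
        conflict {u} {a} {b} u≉0 ⊤a sa ⊤b sb = 0<⇒≉0 (top-positive u≉0 ⊤b) (≈-⇒≈0 (-≈0⇒≈ (*-zero-divisor (begin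
            λ′ * (u ∙ z b - - (u ∙ z b))
              ≈⟨ solve 3 (λ l x y → l :* (x :- y) := l :* x :- l :* y) refl λ′ (u ∙ z b) (- (u ∙ z b)) ⟩
            λ′ * (u ∙ z b) - λ′ * - (u ∙ z b)
              ≈⟨ +-cong (*-congˡ (tops-≈ ⊤b ⊤a)) (-‿cong (*-congˡ (sym (z-opposite u b)))) ⟩
            λ′ * (u ∙ z a) - λ′ * (u ∙ z (opposite b))    ≈⟨ +-cong (sym (scaled sa u)) (-‿cong (sym (scaled sb u))) ⟩
            u ∙ φ̂ a - u ∙ φ̂ b                             ≈⟨ ≈⇒-≈0 (flex ⊤a ⊤b) ⟩
            0#                                            ∎) λ′≉0)))
          where open ≈-Reasoning

        S+R≤m : length S ℕ.+ length R ℕ.≤ m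
        S+R≤m = index-length (unique-map proj₁ (select-unique L!) λ {a} {b} a∈ b∈ eq → by-contradiction λ a≢b →
            not-both-in-S (∈S⇒ a∈) (≡.subst InS (same-index eq a≢b) (∈S⇒ b∈)))
          (select-unique (Unique.allFin⁺ m)) λ a∈ i∈ → ∈R⇒ i∈ (∈S⇒ a∈)

        R-small : length R ℕ.< d
        R-small = ℕ.+-cancelˡ-< d _ _ (begin-strict
          d ℕ.+ length R            ≤⟨ ℕ.+-monoˡ-≤ (length R) S-large ⟩
          length S ℕ.+ length R     ≤⟨ S+R≤m ⟩
          m                         <⟨ m<2d ⟩
          2 ℕ.* d                   ≡⟨ ≡.cong (d ℕ.+_) (ℕ.+-identityʳ d) ⟩
          d ℕ.+ d                   ∎)
          where open ℕ.≤-Reasoning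

        top-negᵥ : ∀ {u a} → Top u a → Top (negᵥ u) (opposite a)
        top-negᵥ {u} {a} (_ , a-top) = L-complete _ , λ {b} _ → ≤-resp
          (trans (z-opposite u b) (sym (negᵥ-∙ u (z b)))) 
          (trans (solve 1 (λ x → x := :- :- x) refl (u ∙ z a))
            (trans (-‿cong (sym (z-opposite u a))) (sym (negᵥ-∙ u (z (opposite a))))))
          (a-top (L-complete (opposite b)))

        negᵥ-nonzero : ∀ {u : Point d} → ¬ (u ≋ 0ᵥ) → ¬ (negᵥ u ≋ 0ᵥ)
        negᵥ-nonzero {u} u≉0 h = u≉0 λ k → trans (solve 1 (λ x → x := (:- :1) :* ((:- :1) :* x)) refl (u k))
          (trans (*-congˡ (h k)) (zeroʳ _))

        -- Fewer than `d` pairs lie in `R`, so some nonzero `n` vanishes on all of them. Its maximum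
        -- is positive, hence attained outside `R`, and on `S` after a change of sign.
        axis : ∃[ n ] ∃[ a ] ¬ (n ≋ 0ᵥ) × (∀ i → i ∈ R → n ∙ v i ≈ 0#) × Top n a × InS a
        axis =
          let n , n≉0 , zeros = common-zero (map v R) (≡.subst (ℕ._< d) (≡.sym (length-map v R)) R-small)
              a , ⊤a = top n (L-complete (proj₁ (shared-index vertex vertex) , true))
          in orient n a n≉0 (λ i i∈ → zeros (∈-map⁺ v i∈)) ⊤a
          where
          orient : ∀ n a → ¬ (n ≋ 0ᵥ) → (∀ i → i ∈ R → n ∙ v i ≈ 0#) → Top n a →
            ∃[ n ] ∃[ a ] ¬ (n ≋ 0ᵥ) × (∀ i → i ∈ R → n ∙ v i ≈ 0#) × Top n a × InS a
          orient n a n≉0 zeros ⊤a = case trichotomy a of λ where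
              (inj₁ sa)        → n , a , n≉0 , zeros , ⊤a , sa
              (inj₂ (inj₁ sā)) → negᵥ n , opposite a , negᵥ-nonzero n≉0 ,
                (λ i i∈ → trans (negᵥ-∙ n (v i)) (trans (-‿cong (zeros i i∈)) -0#≈0#)) , top-negᵥ ⊤a , sā
              (inj₂ (inj₂ i∈)) → ⊥-elim (0<⇒≉0 (top-positive n≉0 ⊤a) (R-zero a i∈))
            where
            R-zero : ∀ a → proj₁ a ∈ R → n ∙ z a ≈ 0#
            R-zero (i , true)  i∈ = zeros i i∈
            R-zero (i , false) i∈ = trans (∙-negᵥ n (v i)) (trans (-‿cong (zeros i i∈)) -0#≈0#)

        -- The lines u + t n in a direction n that is constant on R.
        module Axis (n : Point d) (a₀ : W) (n≉0 : ¬ (n ≋ 0ᵥ)) (n⊥R : ∀ i → i ∈ R → n ∙ v i ≈ 0#)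
          (⊤a₀ : Top n a₀) (sa₀ : InS a₀) where

          n⊥ : ∀ {a} → proj₁ a ∈ R → n ∙ z a ≈ 0#
          n⊥ {i , true}  i∈ = n⊥R i i∈
          n⊥ {i , false} i∈ = trans (∙-negᵥ n (v i)) (trans (-‿cong (n⊥R i i∈)) -0#≈0#)

          0<na₀ : 0# < n ∙ z a₀
          0<na₀ = top-positive n≉0 ⊤a₀

          -- Otherwise the vertex opposite to `b` would share the maximum of `n` with `a₀`, against
          -- `conflict`.
          dominant : ∀ {b} → InS b → 0# < n ∙ z a₀ + n ∙ z b
          dominant {b} sb h = conflict n≉0 ⊤a₀ sa₀ ⊤b̄ (≡.subst InS (≡.sym (opposite-involutive b)) sb)
            where
            ⊤b̄ : Top n (opposite b)
            ⊤b̄ = L-complete _ , λ c∈ → ≤-trans (proj₂ ⊤a₀ c∈) (by≤ (neg≤0 h)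
              (trans (+-congʳ (z-opposite n b))
                (solve 2 (λ a b → (:- b) :- a := :- (a :+ b)) refl (n ∙ z a₀) (n ∙ z b))))

          module Line (u : Point d) where

            α β : W → W → K
            α a b = u ∙ z a + u ∙ z b
            β a b = n ∙ z a + n ∙ z b

            -- For the functional `u + t n`, `Positive` says that the maximum over `S` exceeds the
            -- maximum over `- S`, and `Negative` the reverse: `α a b + t * β a b` is the sum of its
            -- values at `z a` and `z b`. As affine conditions in `t` they are visibly open.
            Positive Negative Neutral : K → Set
            Positive t = ∃[ a ] a ∈ S × (∀ {b} → b ∈ S → 0# < α a b + t * β a b)
            Negative t = ∃[ a ] a ∈ S × (∀ {b} → b ∈ S → 0# < - α a b + t * - β a b)
            Neutral t  = ¬ Positive t × ¬ Negative t

            pair : ∀ t a b → α a b + t * β a b ≈ line u t n ∙ z a + line u t n ∙ z b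
            pair t a b = trans (solve 5 (λ a b c e t → (a :+ b) :+ t :* (c :+ e) := (a :+ t :* c) :+ (b :+ t :* e)) refl
              (u ∙ z a) (u ∙ z b) (n ∙ z a) (n ∙ z b) t)
              (sym (+-cong (line-∙ u t n (z a)) (line-∙ u t n (z b))))

            open-Positive : Open Positive
            open-Positive = open-any λ {a} _ → open-all S λ {b} _ → open-positive (α a b) (β a b)

            open-Negative : Open Negative
            open-Negative = open-any λ {a} _ → open-all S λ {b} _ → open-positive (- α a b) (- β a b)

            disjoint : ∀ {t} → Negative t → Positive t → ⊥
            disjoint {t} (a , a∈ , neg) (b , b∈ , pos) = <-irrefl (sym (solve 5 (λ t ua ub na nb →
              ((:- (ua :+ ub)) :+ t :* (:- (na :+ nb))) :+ ((ub :+ ua) :+ t :* (nb :+ na)) := :0) refl t (u ∙ z a)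
                (u ∙ z b) (n ∙ z a) (n ∙ z b)))
              (0<+0< (neg b∈) (pos a∈))

            eventually-positive : Far Positive
            eventually-positive =
              let T , 0<T , h = far-all {P = λ b t → 0# < α a₀ b + t * β a₀ b} S
                    (λ {b} b∈ → far-positive (α a₀ b) (dominant (∈S⇒ b∈)))
              in T , 0<T , λ T≤t → a₀ , ∈S sa₀ , h T≤t

            some-negative : ∃[ T ] 0# < T × Negative (- T)
            some-negative =
              let T , 0<T , h = far-all {P = λ b t → 0# < - α a₀ b + t * β a₀ b} S
                    (λ {b} b∈ → far-positive (- α a₀ b) (dominant (∈S⇒ b∈)))
              in T , 0<T , a₀ , ∈S sa₀ , λ {b} b∈ →
                   <-resp refl (solve 3 (λ α β t → (:- α) :+ t :* β := (:- α) :+ (:- t) :* (:- β)) refl (α a₀ b)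
                     (β a₀ b) T) (h ≤-refl b∈)

            neutral-between : ∀ {t T} → Negative t → Positive T → t ≤ T → ∃[ s ] t ≤ s × Neutral s
            neutral-between {t} {T} neg pos t≤T =
              let s , t≤s , ¬n , ¬p = between {P = Negative} {Q = Positive} open-Negative open-Positive
                    (λ {t} → disjoint {t}) {t} {T} t≤T neg pos
              in s , t≤s , ¬p , ¬n

            neutral-after : ∀ {t} → ¬ Positive t → ∃[ s ] t ≤ s × Neutral s
            neutral-after {t} ¬pos = case em {P = Negative t} of λ where
                (no ¬neg) → t , ≤-refl , ¬pos , ¬neg
                (yes neg) → neutral-between neg (positive-from ≤-refl) t≤T
              where
              T = proj₁ eventually-positive
              positive-from : ∀ {t} → T ≤ t → Positive t
              positive-from = proj₂ (proj₂ eventually-positive)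
              t≤T : t ≤ T
              t≤T = case total t T of λ where
                (inj₁ t≤T) → t≤T
                (inj₂ T≤t) → ⊥-elim (¬pos (positive-from T≤t))

            neutral : ∃[ t ] Neutral t
            neutral =
              let T , 0<T , neg = some-negative
                  t , _ , h = neutral-after λ pos → disjoint neg pos
              in t , h

            -- At a neutral `t` the maxima over `S` and `- S` agree, so a functional maximal on one
            -- of them would be maximal on both, against `conflict`.
            neutral-top : ∀ {t} → Neutral t → ¬ (line u t n ≋ 0ᵥ) → ∀ {a} → Top (line u t n) a → proj₁ a ∈ R
            neutral-top {t} (¬pos , ¬neg) u≉0 {a} ⊤a = case trichotomy a of λ where
                (inj₁ sa)        → ⊥-elim (¬pos (a , ∈S sa , λ {b} b∈ h → low sa b∈ (≤-resp (pair t a b) refl h)))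
                (inj₂ (inj₁ sā)) → ⊥-elim (¬neg (opposite a , ∈S sā , λ {b} b∈ h → high sā b∈ (≤-resp (flip b) refl h)))
                (inj₂ (inj₂ i∈)) → i∈
              where
              u′ = line u t n
              low : ∀ {b} → InS a → b ∈ S → u′ ∙ z a + u′ ∙ z b ≤ 0# → ⊥
              low {b} sa b∈ h = conflict {b = opposite b} u≉0 ⊤a sa
                (L-complete _ , λ c∈ → ≤-trans (proj₂ ⊤a c∈) (by≤ (neg≤0 h)
                  (trans (+-congʳ (z-opposite u′ b))
                    (solve 2 (λ a b → (:- b) :- a := :- (a :+ b)) refl (u′ ∙ z a) (u′ ∙ z b)))))
                (≡.subst InS (≡.sym (opposite-involutive b)) (∈S⇒ b∈))
              flip : ∀ b → - α (opposite a) b + t * - β (opposite a) b ≈ u′ ∙ z a - u′ ∙ z b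
              flip b = begin
                - α (opposite a) b + t * - β (opposite a) b
                  ≈⟨ solve 3 (λ a b t → (:- a) :+ t :* (:- b) := :- (a :+ t :* b)) refl (α (opposite a) b)
                    (β (opposite a) b) t ⟩
                - (α (opposite a) b + t * β (opposite a) b)                ≈⟨ -‿cong (pair t (opposite a) b) ⟩
                - (u′ ∙ z (opposite a) + u′ ∙ z b)                         ≈⟨ -‿cong (+-congʳ (z-opposite u′ a)) ⟩
                - (- (u′ ∙ z a) + u′ ∙ z b)
                  ≈⟨ solve 2 (λ a b → :- ((:- a) :+ b) := a :- b) refl (u′ ∙ z a) (u′ ∙ z b) ⟩
                u′ ∙ z a - u′ ∙ z b                                        ∎
                where open ≈-Reasoning
              high : ∀ {b} → InS (opposite a) → b ∈ S → u′ ∙ z a - u′ ∙ z b ≤ 0# → ⊥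
              high {b} sā b∈ h = conflict {a = b} u≉0 (L-complete _ , λ c∈ → ≤-trans (proj₂ ⊤a c∈) (-≤0⇒≤ h))
                (∈S⇒ b∈) ⊤a sā

          OnlyR : Point d → Set
          OnlyR u = ∀ a → Top u a → proj₁ a ∈ R

          -- The values on `ys` stay zero along `u + t n`, so a neutral point of this line is as
          -- required. Choosing `u` orthogonal to `z a₀`, where `n` is positive, prevents `u + t n`
          -- from vanishing.
          only-R : (ys : List (Point d)) → (∀ {y} → y ∈ ys → n ∙ y ≈ 0#) → suc (length ys) ℕ.< d →
            ∃[ u ] ¬ (u ≋ 0ᵥ) × OnlyR u × (∀ y → y ∈ ys → u ∙ y ≈ 0#)
          only-R ys n⊥ys short =
            let u , u≉0 , zeros = common-zero (z a₀ ∷ ys) short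
                t , h = Line.neutral u
                u′≉0 = shifted u t u≉0 (zeros (here ≡.refl))
            in line u t n , u′≉0 , (λ a → Line.neutral-top u h u′≉0) , λ y y∈ →
                 trans (line-∙ u t n y) (trans (+-cong (zeros (there y∈)) (*-congˡ (n⊥ys y∈)))
                   (solve 1 (λ t → :0 :+ t :* :0 := :0) refl t))
            where
            shifted : ∀ u t → ¬ (u ≋ 0ᵥ) → u ∙ z a₀ ≈ 0# → ¬ (line u t n ≋ 0ᵥ)
            shifted u t u≉0 ua₀≈0 h = u≉0 λ k → trans
              (sym (trans (+-congˡ (trans (*-congʳ t≈0) (zeroˡ (n k)))) (+-identityʳ (u k)))) (h k)
              where
              t≈0 : t ≈ 0#
              t≈0 = *-zero-divisor (trans (*-comm _ t) (trans (sym (trans (+-congʳ ua₀≈0) (+-identityˡ _)))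
                (trans (sym (line-∙ u t n (z a₀))) (0ᵥ-∙ h)))) (0<⇒≉0 0<na₀)

          -- The maximum is positive and attained on `R`, where only the values 0 and `± u ∙ z a`
          -- occur; so it is attained at `a` by `u` or by `- u`.
          only-R-oriented : (ys : List (Point d)) → (∀ {y} → y ∈ ys → n ∙ y ≈ 0#) → suc (length ys) ℕ.< d → ∀ a →
            (∀ u → (∀ y → y ∈ ys → u ∙ y ≈ 0#) → ∀ b → proj₁ b ∈ R → (u ∙ z b ≈ 0#) ⊎ (u ∙ z b ≈ u ∙ z a) ⊎
              (u ∙ z b ≈ - (u ∙ z a))) →
            ∃[ u ] ¬ (u ≋ 0ᵥ) × OnlyR u × (∀ y → y ∈ ys → u ∙ y ≈ 0#) × Top u a
          only-R-oriented ys n⊥ys short a values =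
            let u , u≉0 , onlyR , zeros = only-R ys n⊥ys short
                b , ⊤b = top u (L-complete a)
            in orient u b u≉0 onlyR zeros ⊤b (values u zeros b (onlyR b ⊤b))
            where
            transfer : ∀ {u a b} → Top u b → u ∙ z b ≈ u ∙ z a → Top u a
            transfer ⊤b eq = L-complete _ , λ c∈ → ≤-trans (proj₂ ⊤b c∈) (≤-reflexive eq)
            top-negneg : ∀ {u c} → Top (negᵥ u) c → Top u (opposite c)
            top-negneg {u} {c} ⊤c = L-complete _ , λ {b} _ → ≤-resp (back b) (back (opposite c))
              (proj₂ (top-negᵥ ⊤c) (L-complete b))
              where
              back : ∀ b → negᵥ (negᵥ u) ∙ z b ≈ u ∙ z b
              back b = trans (negᵥ-∙ (negᵥ u) (z b)) (trans (-‿cong (negᵥ-∙ u (z b))) (-‿involutive _))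
            orient : ∀ u b → ¬ (u ≋ 0ᵥ) → OnlyR u → (∀ y → y ∈ ys → u ∙ y ≈ 0#) → Top u b →
              (u ∙ z b ≈ 0#) ⊎ (u ∙ z b ≈ u ∙ z a) ⊎ (u ∙ z b ≈ - (u ∙ z a)) →
              ∃[ u ] ¬ (u ≋ 0ᵥ) × OnlyR u × (∀ y → y ∈ ys → u ∙ y ≈ 0#) × Top u a
            orient u b u≉0 onlyR zeros ⊤b (inj₁ eq)        = ⊥-elim (0<⇒≉0 (top-positive u≉0 ⊤b) eq)
            orient u b u≉0 onlyR zeros ⊤b (inj₂ (inj₁ eq)) = u , u≉0 , onlyR , zeros , transfer ⊤b eq
            orient u b u≉0 onlyR zeros ⊤b (inj₂ (inj₂ eq)) = negᵥ u , negᵥ-nonzero u≉0 ,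
              (λ c ⊤c → onlyR (opposite c) (top-negneg ⊤c)) ,
              (λ y y∈ → trans (negᵥ-∙ u y) (trans (-‿cong (zeros y y∈)) -0#≈0#)) ,
              ≡.subst (Top (negᵥ u)) (opposite-involutive a) (top-negᵥ (transfer ⊤b (trans eq (sym (z-opposite u a)))))

          -- If `R` were smaller, some `u` would vanish on `R` and yet attain its positive maximum
          -- only there.
          d≤1+R : d ℕ.≤ suc (length R)
          d≤1+R = ℕ.≮⇒≥ λ short →
            let u , u≉0 , onlyR , zeros = only-R (map v R)
                  (λ y∈ → let i , i∈ , eq = ∈-map⁻ v y∈ in ≡.subst (λ y → n ∙ y ≈ 0#) (≡.sym eq) (n⊥R i i∈))
                  (≡.subst (λ k → suc k ℕ.< d) (≡.sym (length-map v R)) short)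
                (i , σ) , ⊤a = top u (L-complete a₀)
            in 0<⇒≉0 (top-positive u≉0 ⊤a) (vanish u i σ (zeros (v i) (∈-map⁺ v (onlyR (i , σ) ⊤a))))
            where
            vanish : ∀ u i σ → u ∙ v i ≈ 0# → u ∙ z (i , σ) ≈ 0#
            vanish u i true  h = h
            vanish u i false h = trans (∙-negᵥ u (v i)) (trans (-‿cong h) -0#≈0#)

          S≤d : length S ℕ.≤ d
          S≤d = ℕ.+-cancelʳ-≤ (length R) _ _ (ℕ.≤-pred (begin
            suc (length S ℕ.+ length R)      ≤⟨ s≤s S+R≤m ⟩
            suc m                            ≤⟨ m<2d ⟩
            2 ℕ.* d                          ≡⟨ ≡.cong (d ℕ.+_) (ℕ.+-identityʳ d) ⟩
            d ℕ.+ d                          ≤⟨ ℕ.+-monoʳ-≤ d d≤1+R ⟩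
            d ℕ.+ suc (length R)             ≡⟨ ℕ.+-suc d (length R) ⟩
            suc (d ℕ.+ length R)             ∎))
            where open ℕ.≤-Reasoning

          strict : ∀ {u a b} → Top u a → ¬ Top u b → u ∙ z b < u ∙ z a
          strict {b = b} ⊤a ¬⊤b = ≤∧≉⇒< (proj₂ ⊤a (L-complete b)) λ tie →
            ¬⊤b (L-complete b , λ c∈ → ≤-trans (proj₂ ⊤a c∈) (≤-reflexive (sym tie)))

          isolated-pair : ∀ {u a b} → ¬ (u ≋ 0ᵥ) → OnlyR u → Top u a → proj₁ a ≢ proj₁ b → u ∙ z a ≈ u ∙ z b →
            (∀ c → proj₁ c ∈ R → proj₁ c ≢ proj₁ a → proj₁ c ≢ proj₁ b → u ∙ z c ≈ 0#) → Adjacent a b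
          isolated-pair {u} {a} {b} u≉0 onlyR ⊤a a≢b tie zero′ =
            L-complete a , L-complete b , (λ a≡b → a≢b (≡.cong proj₁ a≡b)) , u , tie , λ {c} _ c≢a c≢b →
              strict {u} {a} {c} ⊤a λ ⊤c →
              case em {P = proj₁ c ≡ proj₁ a} of λ where
                (yes c≡a) → not-both-top u≉0 ⊤a (≡.subst (Top u) (same-index (≡.sym c≡a) (c≢a ∘ ≡.sym)) ⊤c)
                (no c≢a)  → case em {P = proj₁ c ≡ proj₁ b} of λ where
                  (yes c≡b) → not-both-top u≉0 ⊤b (≡.subst (Top u) (same-index (≡.sym c≡b) (c≢b ∘ ≡.sym)) ⊤c)
                  (no c≢b)  → 0<⇒≉0 (top-positive u≉0 ⊤c) (zero′ c (onlyR c ⊤c) c≢a c≢b)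
            where
            ⊤b : Top u b
            ⊤b = L-complete b , λ c∈ → ≤-trans (proj₂ ⊤a c∈) (≤-reflexive tie)

          signed-zero : ∀ {u} c → u ∙ v (proj₁ c) ≈ 0# → u ∙ z c ≈ 0#
          signed-zero (i , true)  h = h
          signed-zero {u} (i , false) h = trans (∙-negᵥ u (v i)) (trans (-‿cong h) -0#≈0#)

          signed-value : ∀ {u} a b → proj₁ b ≡ proj₁ a → (u ∙ z b ≈ u ∙ z a) ⊎ (u ∙ z b ≈ - (u ∙ z a))
          signed-value {u} a b eq = case em {P = a ≡ b} of λ where
            (yes ≡.refl) → inj₁ refl
            (no a≢b)     → inj₂ (trans (reflexive (≡.cong (λ c → u ∙ z c) (same-index (≡.sym eq) a≢b)))
              (z-opposite u a))

          -- As `R` has fewer than `d` members, a functional maximal on `R` only can be made equal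
          -- at `a` and `b` and zero on the other pairs of `R`. So `± R` has all the edges of a
          -- cross-polytope.
          R-adjacent : ∀ {a b} → proj₁ a ∈ R → proj₁ b ∈ R → proj₁ a ≢ proj₁ b →
            ∃[ u ] 0# < u ∙ z a × u ∙ z a ≈ u ∙ z b × Adjacent a b
          R-adjacent {a} {b} a∈ b∈ a≢b =
            let u , u≉0 , onlyR , zeros , ⊤a = only-R-oriented ys n⊥ys short a values in
            u , top-positive u≉0 ⊤a , tie u zeros , isolated-pair u≉0 onlyR ⊤a a≢b (tie u zeros)
              λ c c∈ c≢a c≢b → signed-zero {u} c (zeros _ (v∈ c∈ c≢a c≢b))
            where
            Other : Fin m → Set
            Other i = i ≢ proj₁ a × i ≢ proj₁ b
            ys : List (Point d)
            ys = z a -ᵥ z b ∷ map v (select Other R)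
            v∈ : ∀ {i} → i ∈ R → i ≢ proj₁ a → i ≢ proj₁ b → v i ∈ ys
            v∈ i∈ i≢a i≢b = there (∈-map⁺ v (∈-select⁺ {P = Other} i∈ (i≢a , i≢b)))
            n⊥ys : ∀ {y} → y ∈ ys → n ∙ y ≈ 0#
            n⊥ys (here ≡.refl) = trans (∙--ᵥ n (z a) (z b))
              (trans (+-cong (n⊥ {a} a∈) (-‿cong (n⊥ {b} b∈))) (-‿inverseʳ 0#))
            n⊥ys (there y∈) = let i , i∈ , eq = ∈-map⁻ v y∈ in
              ≡.subst (λ y → n ∙ y ≈ 0#) (≡.sym eq) (n⊥R i (proj₁ (∈-select⁻ R i∈)))
            short : suc (length ys) ℕ.< d
            short = ℕ.≤-<-trans (ℕ.≤-trans (ℕ.≤-reflexive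
              (≡.cong (λ k → ℕ.suc (ℕ.suc k)) (length-map v (select Other R))))
              (length-⊆ {xs = proj₁ a ∷ proj₁ b ∷ select Other R}
                ((a≢b ∷ All.tabulate (λ i∈ a≡ → proj₁ (proj₂ (∈-select⁻ R i∈)) (≡.sym a≡)))
                  ∷ All.tabulate (λ i∈ b≡ → proj₂ (proj₂ (∈-select⁻ R i∈)) (≡.sym b≡)) ∷ select-unique
                    (select-unique (Unique.allFin⁺ m)))
                λ { (here ≡.refl) → a∈ ; (there (here ≡.refl)) → b∈ ; (there (there i∈)) → proj₁ (∈-select⁻ R i∈) }))
                  R-small
            tie : ∀ u → (∀ y → y ∈ ys → u ∙ y ≈ 0#) → u ∙ z a ≈ u ∙ z b
            tie u zeros = -≈0⇒≈ (trans (sym (∙--ᵥ u (z a) (z b))) (zeros _ (here ≡.refl)))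
            values : ∀ u → (∀ y → y ∈ ys → u ∙ y ≈ 0#) → ∀ c → proj₁ c ∈ R →
              (u ∙ z c ≈ 0#) ⊎ (u ∙ z c ≈ u ∙ z a) ⊎ (u ∙ z c ≈ - (u ∙ z a))
            values u zeros c c∈ = case em {P = proj₁ c ≡ proj₁ a} of λ where
              (yes c≡a) → inj₂ (signed-value {u} a c c≡a)
              (no c≢a)  → case em {P = proj₁ c ≡ proj₁ b} of λ where
                (yes c≡b) → inj₂ (case signed-value {u} b c c≡b of λ where
                  (inj₁ eq) → inj₁ (trans eq (sym (tie u zeros)))
                  (inj₂ eq) → inj₂ (trans eq (-‿cong (sym (tie u zeros)))))
                (no c≢b)  → inj₁ (signed-zero {u} c (zeros _ (v∈ c∈ c≢a c≢b)))

          -- The vertex `v i` is joined to both `v j` and `- v j`, so `φ j - φ i` is a multiple of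
          -- `v j - v i` and of `- v j - v i`. The functional `u` vanishes on the former vector and
          -- not on the latter, which makes the slope `μ′` zero.
          R-constant : ∀ {i j} → i ∈ R → j ∈ R → ∀ w → w ∙ φ j ≈ w ∙ φ i
          R-constant {i} {j} i∈ j∈ w = case i Fin.≟ j of λ where
              (yes ≡.refl) → refl
              (no i≢j)     → equal (R-adjacent {i , true} {j , true} i∈ j∈ i≢j)
                (R-adjacent {i , true} {j , false} i∈ j∈ i≢j)
            where
            equal : (∃[ u ] 0# < u ∙ v i × u ∙ v i ≈ u ∙ v j × Adjacent (i , true) (j , true)) →
              (∃[ u ] 0# < u ∙ v i × u ∙ v i ≈ u ∙ negᵥ (v j) × Adjacent (i , true) (j , false)) → w ∙ φ j ≈ w ∙ φ i
            equal (u , 0<u , tie , adj) (_ , _ , _ , adj′) =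
              let μ , eq = slope exposed flex adj
                  μ′ , eq′ = slope exposed flex adj′
                  μ′≈0 : μ′ ≈ 0#
                  μ′≈0 = *-zero-divisor (begin
                    (u ∙ v i + u ∙ v i) * μ′
                      ≈⟨ solve 2 (λ x y → (x :+ x) :* y := :- (y :* (:- x :- x))) refl (u ∙ v i) μ′ ⟩
                    - (μ′ * (- (u ∙ v i) - u ∙ v i))
                      ≈⟨ -‿cong (*-congˡ (+-congʳ (trans (-‿cong tie) (sym (∙-negᵥ u (v j)))))) ⟩
                    - (μ′ * (u ∙ negᵥ (v j) - u ∙ v i))        ≈⟨ -‿cong (sym (eq′ u)) ⟩
                    - (u ∙ φ j - u ∙ φ i)                      ≈⟨ -‿cong (eq u) ⟩
                    - (μ * (u ∙ v j - u ∙ v i))                ≈⟨ -‿cong (*-congˡ (≈⇒-≈0 (sym tie))) ⟩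
                    - (μ * 0#)                                 ≈⟨ solve 1 (λ x → :- (x :* :0) := :0) refl μ ⟩
                    0#                                         ∎) (0<⇒≉0 (0<+0< 0<u 0<u))
              in -≈0⇒≈ (trans (eq′ w) (trans (*-congʳ μ′≈0) (zeroˡ _)))
              where open ≈-Reasoning

          R-isolated : ∀ {r} → proj₁ r ∈ R → ∃[ u ] ¬ (u ≋ 0ᵥ) × OnlyR u × Top u r ×
            (∀ c → proj₁ c ∈ R → c ≢ r → u ∙ z c < u ∙ z r)
          R-isolated {r} r∈ =
            let u , u≉0 , onlyR , zeros , ⊤r = only-R-oriented ys n⊥ys short r values in
            u , u≉0 , onlyR , ⊤r , λ c c∈ c≢r → strict {u} {r} {c} ⊤r λ ⊤c → case em {P = proj₁ c ≡ proj₁ r} of λ where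
              (yes c≡r) → not-both-top u≉0 ⊤r (≡.subst (Top u) (same-index (≡.sym c≡r) (c≢r ∘ ≡.sym)) ⊤c)
              (no c≢r)  → 0<⇒≉0 (top-positive u≉0 ⊤c) (signed-zero {u} c (zeros _ (v∈ c∈ c≢r)))
            where
            Other : Fin m → Set
            Other i = i ≢ proj₁ r
            ys : List (Point d)
            ys = map v (select Other R)
            v∈ : ∀ {i} → i ∈ R → i ≢ proj₁ r → v i ∈ ys
            v∈ i∈ i≢r = ∈-map⁺ v (∈-select⁺ {P = Other} i∈ i≢r)
            n⊥ys : ∀ {y} → y ∈ ys → n ∙ y ≈ 0#
            n⊥ys y∈ = let i , i∈ , eq = ∈-map⁻ v y∈ in
              ≡.subst (λ y → n ∙ y ≈ 0#) (≡.sym eq) (n⊥R i (proj₁ (∈-select⁻ R i∈)))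
            short : suc (length ys) ℕ.< d
            short = ℕ.≤-<-trans (ℕ.≤-trans (ℕ.≤-reflexive (≡.cong ℕ.suc (length-map v (select Other R))))
              (length-remove (select-unique (Unique.allFin⁺ m)) r∈)) R-small
            values : ∀ u → (∀ y → y ∈ ys → u ∙ y ≈ 0#) → ∀ c → proj₁ c ∈ R →
              (u ∙ z c ≈ 0#) ⊎ (u ∙ z c ≈ u ∙ z r) ⊎ (u ∙ z c ≈ - (u ∙ z r))
            values u zeros c c∈ = case em {P = proj₁ c ≡ proj₁ r} of λ where
              (yes c≡r) → inj₂ (signed-value {u} r c c≡r)
              (no c≢r)  → inj₁ (signed-zero {u} c (zeros _ (v∈ c∈ c≢r)))

          module Climb {r} (r∈ : proj₁ r ∈ R) (u : Point d) (u≉0 : ¬ (u ≋ 0ᵥ)) (onlyR : OnlyR u) (⊤r : Top u r)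
            (others : ∀ c → proj₁ c ∈ R → c ≢ r → u ∙ z c < u ∙ z r)
            (t : K) (below : ∀ b → b ∈ S → (u ∙ z b - u ∙ z r) + t * (n ∙ z b) ≤ 0#)
            {b₁ : W} (sb₁ : InS b₁) (0<nb₁ : 0# < n ∙ z b₁) (b₁-tie : (u ∙ z b₁ - u ∙ z r) + t * (n ∙ z b₁) ≈ 0#) where

            open Line u

            u⁺ : Point d
            u⁺ = line u t n

            value-R : ∀ s c → proj₁ c ∈ R → line u s n ∙ z c ≈ u ∙ z c
            value-R s c c∈ = trans (line-∙ u s n (z c))
              (trans (+-congˡ (trans (*-congˡ (n⊥ {c} c∈)) (zeroʳ s))) (+-identityʳ _))

            value-r : ∀ s → line u s n ∙ z r ≈ u ∙ z r
            value-r s = value-R s r r∈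

            difference : ∀ s b → (u ∙ z b - u ∙ z r) + s * (n ∙ z b) ≈ line u s n ∙ z b - line u s n ∙ z r
            difference s b = trans (solve 4 (λ x y s w → (x :- y) :+ s :* w := (x :+ s :* w) :- y) refl (u ∙ z b)
              (u ∙ z r) s (n ∙ z b))
              (+-cong (sym (line-∙ u s n (z b))) (-‿cong (sym (value-r s))))

            S-below : ∀ {b} → InS b → u⁺ ∙ z b ≤ u⁺ ∙ z r
            S-below {b} sb = -≤0⇒≤ (≤-resp (difference t b) refl (below b (∈S sb)))

            tie₁ : u⁺ ∙ z b₁ ≈ u⁺ ∙ z r
            tie₁ = -≈0⇒≈ (trans (sym (difference t b₁)) b₁-tie)

            μ>0 : 0# < u ∙ z r
            μ>0 = top-positive u≉0 ⊤r

            beyond : ∀ {s} → t ≤ s → line u s n ∙ z r ≤ line u s n ∙ z b₁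
            beyond {s} t≤s = 0≤⇒≤ (≤-resp refl (difference s b₁) (by≤ (0≤*0≤ (≤⇒0≤ t≤s) (<⇒≤ 0<nb₁))
              (trans (+-congˡ (-‿cong (sym b₁-tie)))
                (solve 4 (λ x s t w → (x :+ s :* w) :- (x :+ t :* w) := (s :- t) :* w) refl (u ∙ z b₁ - u ∙ z r) s t
                (n ∙ z b₁)))))

            -- At a neutral time the maximum lies on `R`, where moving along `n` changes no values.
            -- So it does not exceed the value at `r`, which `b₁` in `S` has reached by then.
            not-neutral : ∀ {s} → t ≤ s → ¬ Neutral s
            not-neutral {s} t≤s neut = ∈R⇒ (neutral-top {s} neut us≉0 ⊤b₁) sb₁
              where
              us : Point d
              us = line u s n
              us≉0 : ¬ (us ≋ 0ᵥ)
              us≉0 h = 0<⇒≉0 μ>0 (trans (sym (value-r s)) (0ᵥ-∙ h))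
              e = top us (L-complete r)
              e∈ : proj₁ (proj₁ e) ∈ R
              e∈ = neutral-top {s} neut us≉0 (proj₂ e)
              ⊤b₁ : Top us b₁
              ⊤b₁ = L-complete b₁ , λ c∈ → ≤-trans (proj₂ (proj₂ e) c∈) (≤-trans (≤-reflexive (value-R s (proj₁ e) e∈))
                (≤-trans (proj₂ ⊤r (L-complete (proj₁ e))) (≤-trans (≤-reflexive (sym (value-r s))) (beyond t≤s))))

            -- If a member of `- S` had caught up with `r`, time `t` would not be positive, and a
            -- neutral time would follow, which `not-neutral` excludes.
            opposite-below : ∀ {c} → InS (opposite c) → u⁺ ∙ z c < u⁺ ∙ z r
            opposite-below {c} sc h =
              let s , t≤s , neut = neutral-after {t} not-positive in not-neutral t≤s neut
              where
              not-positive : ¬ Positive t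
              not-positive (a , a∈ , pos) = pos (∈S sc) (≤-resp (sym (pair t a (opposite c))) refl
                (by≤ (0≤+0≤ (≤⇒0≤ (S-below (∈S⇒ a∈))) (≤⇒0≤ h))
                  (trans (+-congˡ (-‿cong (+-congˡ (z-opposite u⁺ c))))
                    (solve 3 (λ a c r → :0 :- (a :+ :- c) := (r :- a) :+ (c :- r)) refl (u⁺ ∙ z a) (u⁺ ∙ z c)
                      (u⁺ ∙ z r)))))

            ⊤r⁺ : Top u⁺ r
            ⊤r⁺ = L-complete r , λ {c} _ → case trichotomy c of λ where
              (inj₁ sc)        → S-below sc
              (inj₂ (inj₁ sc)) → <⇒≤ (opposite-below {c} sc)
              (inj₂ (inj₂ c∈)) → ≤-resp (sym (value-R t c c∈)) (sym (value-r t)) (proj₂ ⊤r (L-complete c))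

            neighbour : ∃[ s ] InS s × Adjacent r s
            neighbour =
              let k , adj , tie = adjacent-on-face exposed {u⁺} {r} {b₁} ⊤r⁺ (L-complete b₁) (λ { ≡.refl → ∈R⇒ r∈ sb₁ })
                    tie₁
              in k , in-S k (proj₁ (proj₂ (proj₂ adj))) tie , adj
              where
              in-S : ∀ k → r ≢ k → u⁺ ∙ z k ≈ u⁺ ∙ z r → InS k
              in-S k r≢k tie = case trichotomy k of λ where
                (inj₁ sk)        → sk
                (inj₂ (inj₁ sk)) → ⊥-elim (<⇒≉ (opposite-below {k} sk) tie)
                (inj₂ (inj₂ k∈)) → ⊥-elim (<⇒≉ (others k k∈ (r≢k ∘ ≡.sym))
                  (trans (sym (value-R t k k∈)) (trans tie (value-r t))))

          -- Moving up from r along n, the first vertices to catch up lie in S only.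
          S-neighbour : ∀ {r} → proj₁ r ∈ R → ∃[ s ] InS s × Adjacent r s
          S-neighbour {r} r∈ = let u , u≉0 , onlyR , ⊤r , others = R-isolated {r} r∈ in start u u≉0 onlyR ⊤r others
            where
            start : ∀ u → ¬ (u ≋ 0ᵥ) → OnlyR u → Top u r → (∀ c → proj₁ c ∈ R → c ≢ r → u ∙ z c < u ∙ z r) →
              ∃[ s ] InS s × Adjacent r s
            start u u≉0 onlyR ⊤r others =
              let t , _ , below , b₁ , b₁∈ , 0<nb₁ , tie = first-exit (λ b → u ∙ z b - u ∙ z r) (λ b → n ∙ z b) S
                    (λ {b} b∈ → <0⇒-<0 (strict {u} {r} {b} ⊤r λ ⊤b → ∈R⇒ (onlyR b ⊤b) (∈S⇒ b∈))) (a₀ , ∈S sa₀ , 0<na₀)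
              in Climb.neighbour {r} r∈ u u≉0 onlyR ⊤r others t below (∈S⇒ b₁∈) 0<nb₁ tie

          open RigidFamily z φ̂ L exposed flex

          -- Call a vertex `fixed` if `φ` has there the value it has on `R`. As `λ′` is nonzero, at
          -- most one member of `S` is fixed. A member that is not fixed has at least `d`
          -- neighbours; at most one is fixed and the rest lie in `κ`, since `- S` is excluded by
          -- `conflict`. Hence `κ` exhausts `S`, and `S-neighbour` sends the vertices `± R` to
          -- different members of `S`, too many for `d ≥ 3`.
          absurd : ⊥
          absurd = at-R (proj₁ some-r) (proj₂ some-r)
            where
            some-r : ∃[ r ] r ∈ R
            some-r = nonempty R (ℕ.≤-pred (ℕ.≤-trans (ℕ.≤-trans (ℕ.n≤1+n 2) 3≤d) d≤1+R))
              where
              nonempty : (xs : List (Fin m)) → 1 ℕ.≤ length xs → ∃[ x ] x ∈ xs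
              nonempty (x ∷ _) _ = x , here ≡.refl
            at-R : ∀ r₀ → r₀ ∈ R → ⊥
            at-R r₀ r₀∈ = ℕ.<-irrefl ≡.refl (ℕ.<-≤-trans (excess d 3≤d)
              (ℕ.≤-trans (ℕ.+-mono-≤ (ℕ.pred-mono-≤ d≤1+R) (ℕ.pred-mono-≤ d≤1+R)) 2R≤d))
              where
              excess : ∀ d → 3 ℕ.≤ d → d ℕ.< ℕ.pred d ℕ.+ ℕ.pred d
              excess (suc D) (s≤s 2≤D) = ℕ.+-monoˡ-≤ D 2≤D
              fixed : W → Set
              fixed = Rigid 0# (φ r₀)
              fixed-R : ∀ {a} → proj₁ a ∈ R → fixed a
              fixed-R {a} a∈ = rigid λ w → trans (R-constant r₀∈ a∈ w)
                (solve 2 (λ x y → x := :0 :* y :+ x) refl (w ∙ φ r₀) (w ∙ z a))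
              κ : List W
              κ = select (¬_ ∘ fixed) S
              κ⇒ : ∀ {k} → k ∈ κ → InS k × ¬ fixed k
              κ⇒ k∈ = let s∈ , h = ∈-select⁻ S k∈ in ∈S⇒ s∈ , h
              same-value : ∀ {a b} → InS a → InS b → fixed a → fixed b → a ≡ b
              same-value {a} {b} sa sb fa fb = by-contradiction λ a≢b →
                let u , below = exposed (L-complete a)
                    ub<ua = below (L-complete b) (a≢b ∘ ≡.sym)
                in <⇒≉ ub<ua (-≈0⇒≈ (*-zero-divisor (begin
                  λ′ * (u ∙ z b - u ∙ z a)
                    ≈⟨ solve 3 (λ l x y → l :* (x :- y) := l :* x :- l :* y) refl λ′ (u ∙ z b) (u ∙ z a) ⟩
                  λ′ * (u ∙ z b) - λ′ * (u ∙ z a)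
                    ≈⟨ +-cong (sym (scaled sb u)) (-‿cong (sym (scaled sa u))) ⟩
                  u ∙ φ̂ b - u ∙ φ̂ a                                    ≈⟨ +-cong (value fb u) (-‿cong (value fa u)) ⟩
                  (0# * (u ∙ z b) + u ∙ φ r₀) - (0# * (u ∙ z a) + u ∙ φ r₀)
                    ≈⟨ solve 3 (λ x y p → (:0 :* x :+ p) :- (:0 :* y :+ p) := :0) refl (u ∙ z b) (u ∙ z a) (u ∙ φ r₀) ⟩
                  0#                                                   ∎) λ′≉0))
                where open ≈-Reasoning
              moving : ∃[ k ] k ∈ κ
              moving = by-contradiction λ none →
                let a , b , a∈ , b∈ , a≢b = two-distinct {xs = S} (select-unique L!)
                      (ℕ.≤-trans (ℕ.≤-trans (ℕ.n≤1+n 2) 3≤d) S-large)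
                    is-fixed : ∀ {c} → c ∈ S → fixed c
                    is-fixed {c} c∈ = by-contradiction λ h → none (c , ∈-select⁺ {P = ¬_ ∘ fixed} c∈ h)
                in a≢b (same-value (∈S⇒ a∈) (∈S⇒ b∈) (is-fixed a∈) (is-fixed b∈))
              κ-neighbour : ∀ {k j} → k ∈ κ → Adjacent k j → ¬ fixed j → j ∈ select (_≢ k) κ
              κ-neighbour {k} {j} k∈ adj@(_ , _ , k≢j , u , tie , below) h = case trichotomy j of λ where
                  (inj₁ sj)        → ∈-select⁺ {P = _≢ k} (∈-select⁺ {P = ¬_ ∘ fixed} (∈S sj) h) (k≢j ∘ ≡.sym)
                  (inj₂ (inj₁ sj)) → ⊥-elim (conflict {u} u≉0 ⊤k (proj₁ (κ⇒ k∈)) ⊤j sj)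
                  (inj₂ (inj₂ j∈)) → ⊥-elim (h (fixed-R {j} j∈))
                where
                ⊤k : Top u k
                ⊤k = L-complete k , λ {c} c∈ → case em {P = c ≡ k} of λ where
                  (yes ≡.refl) → ≤-refl
                  (no c≢k)     → case em {P = c ≡ j} of λ where
                    (yes ≡.refl) → ≤-reflexive (sym tie)
                    (no c≢j)     → <⇒≤ (below c∈ c≢k c≢j)
                ⊤j : Top u j
                ⊤j = L-complete j , λ c∈ → ≤-trans (proj₂ ⊤k c∈) (≤-reflexive tie)
                u≉0 : ¬ (u ≋ 0ᵥ)
                u≉0 u≋0 = <-irrefl (trans (0ᵥ-∙ u≋0) (sym (0ᵥ-∙ u≋0))) (below (L-complete (r₀ , true))
                  (λ { ≡.refl → ∈R⇒ r₀∈ (proj₁ (κ⇒ k∈)) }) λ { ≡.refl → h (fixed-R {r₀ , true} r₀∈) })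
              d≤κ : d ℕ.≤ length κ
              d≤κ = let k , k∈ = moving in case em {P = ∃[ o ] fixed o × Adjacent k o} of λ where
                  (yes (o , fo , adj)) → count k∈ o λ adj′ fn → unique-rigid-neighbour (proj₂ (κ⇒ k∈)) fn fo adj′ adj
                  (no none)            → count k∈ k λ adj′ fn → ⊥-elim (none (_ , fn , adj′))
                where
                count : ∀ {k} → k ∈ κ → ∀ o → (∀ {j} → Adjacent k j → fixed j → j ≡ o) → d ℕ.≤ length κ
                count {k} k∈ o partner = ℕ.≤-trans
                  (all-neighbours k (o ∷ select (_≢ k) κ) λ {j} adj → case em {P = fixed j} of λ where
                    (yes fj) → here (partner adj fj)
                    (no ¬fj) → there (κ-neighbour k∈ adj ¬fj))
                  (length-remove (select-unique (select-unique L!)) k∈)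
              S-moves : ∀ {a} → InS a → ¬ fixed a
              S-moves {a} sa fa = ℕ.<-irrefl ≡.refl (ℕ.<-≤-trans (s≤s d≤κ) (ℕ.≤-trans
                (length-⊆ {xs = a ∷ κ} (All.tabulate (λ k∈ a≡k → proj₂ (κ⇒ k∈) (≡.subst fixed a≡k fa)) ∷ select-unique
                  (select-unique L!))
                  λ { (here ≡.refl) → ∈S sa ; (there k∈) → proj₁ (∈-select⁻ S k∈) }) S≤d))
              R± : List W
              R± = map (_, true) R ++ map (_, false) R
              ∈R± : ∀ {r} → r ∈ R± → proj₁ r ∈ R
              ∈R± r∈ = case ∈-++⁻ (map (_, true) R) r∈ of λ where
                (inj₁ p) → let i , i∈ , eq = ∈-map⁻ (_, true) p in ≡.subst (_∈ R) (≡.sym (≡.cong proj₁ eq)) i∈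
                (inj₂ p) → let i , i∈ , eq = ∈-map⁻ (_, false) p in ≡.subst (_∈ R) (≡.sym (≡.cong proj₁ eq)) i∈
              R±! : Unique R±
              R±! = Unique.++⁺ (Unique.map⁺ (≡.cong proj₁) (select-unique (Unique.allFin⁺ m)))
                (Unique.map⁺ (≡.cong proj₁) (select-unique (Unique.allFin⁺ m)))
                λ { (p , q) → case ≡.trans (≡.sym (≡.cong proj₂ (proj₂ (proj₂ (∈-map⁻ (_, true) p)))))
                  (≡.cong proj₂ (proj₂ (proj₂ (∈-map⁻ (_, false) q)))) of λ () }
              2R≤d : length R ℕ.+ length R ℕ.≤ d
              2R≤d = begin
                length R ℕ.+ length R
                  ≡⟨ ≡.cong₂ ℕ._+_ (length-map (_, true) R) (length-map (_, false) R) ⟨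
                length (map (_, true) R) ℕ.+ length (map (_, false) R)         ≡⟨ length-++ (map (_, true) R) ⟨
                length R±
                  ≤⟨ length-injection (λ r s → InS s × Adjacent r s) S R±!
                    (λ {r} r∈ → let s , ss , adj = S-neighbour {r} (∈R± r∈) in s , ∈S ss , ss , adj)
                    (λ {r} {r′} r∈ r′∈ (ss , adj) (_ , adj′) → unique-rigid-neighbour (S-moves ss)
                      (fixed-R {r} (∈R± r∈)) (fixed-R {r′} (∈R± r′∈))
                      (Adjacent-sym adj) (Adjacent-sym adj′)) ⟩
                length S                                                       ≤⟨ S≤d ⟩
                d                                                              ∎
                where open ℕ.≤-Reasoning

-- Flexes with fewer than 2 d pairs are constant

module FlexTheorem (em : ExcludedMiddle 0ℓ) (ℝ : RealField) where

  open RigidVertex em ℝ public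

  module _ {d m : ℕ} (v φ : Fin m → Point d) (conf : Signed.IsConfiguration v φ)
    (3≤d : 3 ℕ.≤ d) (m<2d : m ℕ.< 2 ℕ.* d) where

    open Vertices v φ conf

    private
      module _ {q} (vertex : Vertex q) where

        exposed-on-face : ∀ {a} → a ∈ tops q → Family.Exposed z (tops q) a
        exposed-on-face {a} a∈ = let u , below = exposed (L-complete a) in u , λ {b} _ b≢a → below (L-complete b) b≢a

        -- For small `t`, `q + t u` is maximal over all vertices where `u` is maximal over the facet
        -- of `q`. Subtracting the instance of `flex` for `q` leaves `t` times the claim.
        flex-on-face : Family.Flexible z (tops q) φ̂
        flex-on-face {u} {a} {b} (a∈ , a-top) (b∈ , b-top) = extend (near-witness (near-all L near))
          where
          ⊤a : Top q a
          ⊤a = tops⇒ a∈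
          near : ∀ {c} → c ∈ L → Near (λ t → line q t u ∙ z c ≤ line q t u ∙ z a)
          near {c} c∈ = case em {P = Top q c} of λ where
            (yes ⊤c) → near-always λ {t} 0<t → ≤-resp (sym (line-∙ q t u (z c))) (sym (line-∙ q t u (z a)))
              (by≤ (0≤*0≤ (<⇒≤ 0<t) (≤⇒0≤ (a-top (∈-tops ⊤c)))) (trans (+-congˡ (-‿cong (+-congʳ (tops-≈ ⊤c ⊤a))))
                (solve 4 (λ x t y w → (x :+ t :* y) :- (x :+ t :* w) := t :* (y :- w)) refl (q ∙ z a) t (u ∙ z a)
                  (u ∙ z c))))
            (no ¬⊤c) → near-map <⇒≤ (near-line-< q u (z c) (z a) (≤∧≉⇒< (proj₂ ⊤a c∈) λ tie →
              ¬⊤c (L-complete c , λ e∈ → ≤-trans (proj₂ ⊤a e∈) (≤-reflexive (sym tie)))))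
          extend : (∃[ t ] 0# < t × (∀ {c} → c ∈ L → line q t u ∙ z c ≤ line q t u ∙ z a)) → u ∙ φ̂ a ≈ u ∙ φ̂ b
          extend (t , 0<t , a-top′) = -≈0⇒≈ (*-zero-divisor (begin
              t * (u ∙ φ̂ a - u ∙ φ̂ b)                              ≈⟨ +-identityˡ _ ⟨
              0# + t * (u ∙ φ̂ a - u ∙ φ̂ b)                         ≈⟨ +-congʳ (≈⇒-≈0 (flex ⊤a (tops⇒ b∈))) ⟨
              (q ∙ φ̂ a - q ∙ φ̂ b) + t * (u ∙ φ̂ a - u ∙ φ̂ b)        ≈⟨ line-difference q t u (φ̂ a) (φ̂ b) ⟨
              line q t u ∙ φ̂ a - line q t u ∙ φ̂ b
                ≈⟨ ≈⇒-≈0 (flex (L-complete a , a-top′)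
                  (L-complete b , λ c∈ → ≤-trans (a-top′ c∈) (≤-reflexive (sym tie)))) ⟩
              0#                                                   ∎) (0<⇒≉0 0<t))
            where
            open ≈-Reasoning
            tie : line q t u ∙ z b ≈ line q t u ∙ z a
            tie = trans (line-∙ q t u (z b)) (trans
              (+-cong (tops-≈ (tops⇒ b∈) ⊤a) (*-congˡ (antisym (a-top b∈) (b-top a∈)))) (sym (line-∙ q t u (z a))))

        Homothetic : Set
        Homothetic = ∃[ λ′ ] ∃[ c ] (∀ b → Top q b → ∀ w → w ∙ φ̂ b ≈ λ′ * (w ∙ z b) + w ∙ c)

        homothetic-or-large : Homothetic ⊎ 2 ℕ.* ℕ.pred d ℕ.≤ length (tops q)
        homothetic-or-large = case nonempty (tops q) (ℕ.≤-trans (ℕ.≤-trans (s≤s z≤n) 3≤d) (many-tops vertex)) of λ where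
            (a , a∈) → case F.rigid-or-large (λ w zeros → determined vertex w λ ⊤a → zeros (∈-tops ⊤a))
                         (ℕ.≤-trans (ℕ.n≤1+n 2) 3≤d) (select-unique L!) a∈ of λ where
              (inj₁ (λ′ , c , h)) → inj₁ (λ′ , c , λ b ⊤b → F.value (h b (∈-tops ⊤b)))
              (inj₂ large)        → inj₂ large
          where
          module F = RigidFamily z φ̂ (tops q) exposed-on-face flex-on-face
          nonempty : (xs : List W) → 1 ℕ.≤ length xs → ∃[ x ] x ∈ xs
          nonempty (x ∷ _) _ = x , here ≡.refl

    private
      translate : ∀ c → Signed.IsConfiguration v (λ i → φ i -ᵥ c)
      translate c = record
        { exposed  = exposed
        ; flex     = λ {u} {a} {b} ⊤a ⊤b → trans (∙--ᵥ u (φ̂ a) c)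
          (trans (+-congʳ (flex ⊤a ⊤b)) (sym (∙--ᵥ u (φ̂ b) c)))
        ; spanning = spanning }

      +-cancel : ∀ {x y c} → x - c ≈ y - c → x ≈ y
      +-cancel {x} {y} {c} eq = trans (solve 2 (λ x c → x := (x :- c) :+ c) refl x c)
        (trans (+-congʳ eq) (solve 2 (λ x c → (x :- c) :+ c := x) refl y c))

      -- Subtracting `c` from `φ` reduces the homothety of the facet to multiplication by `λ′`, the
      -- form in which the class `S` is defined; the conclusion concerns only differences of `φ`.
      homothetic⇒constant : ∀ {q} (vertex : Vertex q) → Homothetic vertex → ∀ i j w → w ∙ φ i ≈ w ∙ φ j
      homothetic⇒constant {q} vertex (λ′ , c , h) i j w = +-cancel
        (trans (sym (∙--ᵥ w (φ i) c)) (trans (case em {P = λ′ ≈ 0#} of λ where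
          (yes λ′≈0) → trans (zero-slope⇒constant v φ′ conf′ 3≤d m<2d vertex′ λ′ homothety λ′≈0 i w)
                         (sym (zero-slope⇒constant v φ′ conf′ 3≤d m<2d vertex′ λ′ homothety λ′≈0 j w))
          (no λ′≉0)  → let n , a , n≉0 , n⊥ , ⊤a , sa = axis v φ′ conf′ 3≤d m<2d vertex′ λ′ homothety λ′≉0 in
                         ⊥-elim (Axis.absurd v φ′ conf′ 3≤d m<2d vertex′ λ′ homothety λ′≉0 n a n≉0 n⊥ ⊤a sa))
          (∙--ᵥ w (φ j) c)))
        where
        φ′ : Fin m → Point d
        φ′ i = φ i -ᵥ c
        conf′ : Signed.IsConfiguration v φ′
        conf′ = translate c
        vertex′ : Vertices.Vertex v φ′ conf′ q
        vertex′ = record { nonzero = nonzero vertex ; determined = determined vertex }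
        homothety : ∀ b → Top q b → ∀ w → w ∙ φ′ (proj₁ b) ≈ λ′ * (w ∙ z b)
        homothety b ⊤b w = trans (∙--ᵥ w (φ̂ b) c)
          (trans (+-congʳ (h b ⊤b w)) (solve 2 (λ x c → (x :+ c) :- c := x) refl (λ′ * (w ∙ z b)) (w ∙ c)))

    -- A centrally symmetric polytope with fewer than 2 d pairs of vertices has no
    -- centrally symmetric flex other than translation.
    flex-constant : ∀ i j w → w ∙ φ i ≈ w ∙ φ j
    flex-constant = case em {P = ∃[ q ] ∃[ vertex ] Homothetic {q} vertex} of λ where
      (yes (q , vertex , h)) → homothetic⇒constant vertex h
      (no none)              → all-large⇒constant v φ conf 3≤d m<2d λ {q} vertex → case homothetic-or-large
        vertex of λ where
        (inj₁ h)     → ⊥-elim (none (q , vertex , h))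
        (inj₂ large) → large

-- Convex hulls, vertices and strict antipodality in terms of functionals

module ConvexGeometry (em : ExcludedMiddle 0ℓ) (ℝ : RealField) where

  open FlexTheorem em ℝ public
  open StrictlyConvexConfiguration public

  ≋-refl : ∀ {d} {p : Point d} → p ≋ p
  ≋-refl _ = refl

  ≋-sym : ∀ {d} {p q : Point d} → p ≋ q → q ≋ p
  ≋-sym h k = sym (h k)

  ≋-trans : ∀ {d} {p q r : Point d} → p ≋ q → q ≋ r → p ≋ r
  ≋-trans h h′ k = trans (h k) (h′ k)

  sum-nonnegative : ∀ {n} {f : Fin n → K} → (∀ i → 0# ≤ f i) → 0# ≤ sum f
  sum-nonnegative {zero}  h = ≤-refl
  sum-nonnegative {suc n} h = 0≤+0≤ (h zero) (sum-nonnegative (h ∘ suc))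

  sum-nonnegative-zero : ∀ {n} {f : Fin n → K} → (∀ i → 0# ≤ f i) → sum f ≈ 0# → ∀ i → f i ≈ 0#
  sum-nonnegative-zero {suc n} {f} h eq zero = antisym
    (by≤ (sum-nonnegative (h ∘ suc)) (trans (+-congʳ (sym eq))
      (solve 2 (λ x s → (x :+ s) :- x := s) refl (f zero) (sum (f ∘ suc))))) (h zero)
  sum-nonnegative-zero {suc n} {f} h eq (suc i) = sum-nonnegative-zero (h ∘ suc) (antisym
    (by≤ (h zero) (trans (+-congʳ (sym eq)) (solve 2 (λ x s → (x :+ s) :- s := x) refl (f zero) (sum (f ∘ suc)))))
      (sum-nonnegative (h ∘ suc))) i

  -- The slack `o - u ∙ p` is affine in `p`. With nonnegative weights this yields both bounds on a
  -- hull and, where the total slack is zero, the vanishing of weights.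
  affine-∙ : ∀ {d n} (w : Fin n → K) (x : Fin n → Point d) {p} → sum w ≈ 1# → combination w x ≋ p → ∀ u o →
    sum (λ i → w i * (o - u ∙ x i)) ≈ o - u ∙ p
  affine-∙ w x {p} w≈1 comb u o = begin
    sum (λ i → w i * (o - u ∙ x i))
      ≈⟨ sum-cong-≋ (λ i → solve 3 (λ w o y → w :* (o :- y) := w :* o :+ (:- :1) :* (w :* y)) refl (w i) o (u ∙ x i)) ⟩
    sum (λ i → w i * o + (- 1#) * (w i * (u ∙ x i)))
      ≈⟨ ∑-distrib-+ (λ i → w i * o) (λ i → (- 1#) * (w i * (u ∙ x i))) ⟩
    sum (λ i → w i * o) + sum (λ i → (- 1#) * (w i * (u ∙ x i)))
      ≈⟨ +-cong (sym (*-distribʳ-sum o w)) (sym (*-distribˡ-sum (- 1#) (λ i → w i * (u ∙ x i)))) ⟩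
    sum w * o + (- 1#) * sum (λ i → w i * (u ∙ x i))
      ≈⟨ +-cong (*-congʳ w≈1) (*-congˡ (sum-cong-≋ λ i → *-congˡ (∙-comm u (x i)))) ⟩
    1# * o + (- 1#) * sum (λ i → w i * (x i ∙ u))                ≈⟨ +-congˡ (*-congˡ (combination-∙ w x u)) ⟨
    1# * o + (- 1#) * (combination w x ∙ u)
      ≈⟨ +-congˡ (*-congˡ (trans (∙-cong comb ≋-refl) (∙-comm p u))) ⟩
    1# * o + (- 1#) * (u ∙ p)
      ≈⟨ solve 2 (λ o y → :1 :* o :+ (:- :1) :* y := o :- y) refl o (u ∙ p) ⟩
    o - u ∙ p                                                    ∎
    where open ≈-Reasoning

  generator∈conv : ∀ {d n} (x : Fin n → Point d) i → conv x (x i)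
  generator∈conv x i = unit i , nonneg , sum-unit i , λ k → begin
      sum (λ j → unit i j * x j k)     ≈⟨ unit-∙ i (λ j → x j k) ⟩
      x i k                            ∎
    where
    open ≈-Reasoning
    nonneg : ∀ j → 0# ≤ unit i j
    nonneg j = case j Fin.≟ i of λ where
      (yes ≡.refl) → ≤-resp refl (sym (unit-diagonal i)) (<⇒≤ 0<1)
      (no j≢i)     → ≤-reflexive (sym (unit-off-diagonal j≢i))
    sum-unit : ∀ {n} (i : Fin n) → sum (unit i) ≈ 1#
    sum-unit i = trans (sum-single i λ j → unit-off-diagonal) (unit-diagonal i)

  conv-≤ : ∀ {d n} {x : Fin n → Point d} u o → (∀ i → u ∙ x i ≤ o) → ∀ {p} → conv x p → u ∙ p ≤ o
  conv-≤ {x = x} u o bound (w , w≥0 , w≈1 , comb) = 0≤⇒≤ (≤-resp refl (affine-∙ w x w≈1 comb u o)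
    (sum-nonnegative λ i → 0≤*0≤ (w≥0 i) (≤⇒0≤ (bound i))))

  -- The weighted slacks are nonnegative with sum zero, so every weight off `i` vanishes.
  conv-face : ∀ {d n} {x : Fin n → Point d} u i → (∀ k → k ≢ i → u ∙ x k < u ∙ x i) →
    ∀ {p} → conv x p → u ∙ x i ≤ u ∙ p → x i ≋ p
  conv-face {n = n} {x} u i strict {p} (w , w≥0 , w≈1 , comb) p≥ k = begin
      x i k                                    ≈⟨ *-identityˡ _ ⟨
      1# * x i k                               ≈⟨ *-congʳ (trans (sym w≈1) (sum-single i w-zero)) ⟩
      w i * x i k                              ≈⟨ sum-single i (λ j j≢i → trans (*-congʳ (w-zero j j≢i)) (zeroˡ _)) ⟨
      combination w x k                        ≈⟨ comb k ⟩
      p k                                      ∎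
    where
    open ≈-Reasoning
    bound : ∀ j → u ∙ x j ≤ u ∙ x i
    bound j = case j Fin.≟ i of λ where
      (yes ≡.refl) → ≤-refl
      (no j≢i)     → <⇒≤ (strict j j≢i)
    terms : ∀ j → w j * (u ∙ x i - u ∙ x j) ≈ 0#
    terms = sum-nonnegative-zero (λ j → 0≤*0≤ (w≥0 j) (≤⇒0≤ (bound j)))
      (trans (affine-∙ w x w≈1 comb u (u ∙ x i))
        (≈⇒-≈0 (antisym p≥ (conv-≤ {x = x} u (u ∙ x i) bound (w , w≥0 , w≈1 , comb)))))
    w-zero : ∀ j → j ≢ i → w j ≈ 0#
    w-zero j j≢i = *-zero-divisor (trans (*-comm _ (w j)) (terms j)) (0<⇒≉0 (<⇒0< (strict j j≢i)))

  module _ {d n : ℕ} (x : Fin n → Point d) where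

    Max Min : Point d → Fin n → Set
    Max u i = ∀ k → k ≢ i → u ∙ x k < u ∙ x i
    Min u i = ∀ k → k ≢ i → u ∙ x i < u ∙ x k

    max-≤ : ∀ {u i} → Max u i → ∀ k → u ∙ x k ≤ u ∙ x i
    max-≤ {u} {i} max k = case k Fin.≟ i of λ where
      (yes ≡.refl) → ≤-refl
      (no k≢i)     → <⇒≤ (max k k≢i)

    min-≤ : ∀ {u i} → Min u i → ∀ k → u ∙ x i ≤ u ∙ x k
    min-≤ {u} {i} min k = case k Fin.≟ i of λ where
      (yes ≡.refl) → ≤-refl
      (no k≢i)     → <⇒≤ (min k k≢i)

    neg-max : ∀ {u i} → Max u i → Min (negᵥ u) i
    neg-max {u} {i} max k k≢i = by< (<⇒0< (max k k≢i)) (trans (+-cong (negᵥ-∙ u (x k)) (-‿cong (negᵥ-∙ u (x i))))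
      (solve 2 (λ a b → (:- a) :- (:- b) := b :- a) refl (u ∙ x k) (u ∙ x i)))

    neg-min : ∀ {u i} → Min u i → Max (negᵥ u) i
    neg-min {u} {i} min k k≢i = by< (<⇒0< (min k k≢i)) (trans (+-cong (negᵥ-∙ u (x i)) (-‿cong (negᵥ-∙ u (x k))))
      (solve 2 (λ a b → (:- a) :- (:- b) := b :- a) refl (u ∙ x i) (u ∙ x k)))

    scale-extreme : ∀ {h h′ : Point d} t → t ≉ 0# → h′ ≋ t *ᵥ h → ∀ {j} → Max h′ j ⊎ Min h′ j → Max h j ⊎ Min h j
    scale-extreme {h} {h′} t t≉0 h′≋ {j} extreme = case <-cmp t 0# of λ where
        (inj₁ t<0)        → case extreme of λ where
          (inj₁ max) → inj₂ λ k k≢j → flip (neg<0 t<0)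
            (trans (difference j k) (solve 3 (λ t a b → t :* (a :- b) := (:- t) :* (b :- a)) refl t _ _)) (max k k≢j)
          (inj₂ min) → inj₁ λ k k≢j → flip (neg<0 t<0)
            (trans (difference k j) (solve 3 (λ t a b → t :* (a :- b) := (:- t) :* (b :- a)) refl t _ _)) (min k k≢j)
        (inj₂ (inj₁ t≈0)) → ⊥-elim (t≉0 t≈0)
        (inj₂ (inj₂ 0<t)) → case extreme of λ where
          (inj₁ max) → inj₁ λ k k≢j → flip 0<t (difference j k) (max k k≢j)
          (inj₂ min) → inj₂ λ k k≢j → flip 0<t (difference k j) (min k k≢j)
      where
      difference : ∀ k l → h′ ∙ x k - h′ ∙ x l ≈ t * (h ∙ x k - h ∙ x l)
      difference k l = trans (+-cong (trans (∙-cong h′≋ ≋-refl) (*ᵥ-∙ t h (x k)))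
        (-‿cong (trans (∙-cong h′≋ ≋-refl) (*ᵥ-∙ t h (x l)))))
        (solve 3 (λ t a b → t :* a :- t :* b := t :* (a :- b)) refl t (h ∙ x k) (h ∙ x l))
      flip : ∀ {s a b c e} → 0# < s → b - a ≈ s * (e - c) → a < b → c < e
      flip {s} 0<s eq a<b = 0<⇒< (0<*⇒0< (<-resp refl (trans eq (*-comm s _)) (<⇒0< a<b)) 0<s)

    private
      hyperplane : ∀ {u i j} → i ≢ j → Min u j → K → Hyperplane d
      hyperplane {u} {i} i≢j min o = record
        { normal = u ; offset = o ; normal≉0 = λ h → <-irrefl (trans (0ᵥ-∙ h) (sym (0ᵥ-∙ h))) (min i i≢j) }

      conv-≥ : ∀ {u j} → Min u j → ∀ {p} → conv x p → u ∙ x j ≤ u ∙ p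
      conv-≥ {u} {j} min {p} p∈ = by≤ (≤⇒0≤ (conv-≤ {x = x} (negᵥ u) (negᵥ u ∙ x j) (max-≤ {negᵥ u} (neg-min {u} min))
        p∈))
        (trans (solve 2 (λ a b → b :- a := (:- a) :- (:- b)) refl (u ∙ x j) (u ∙ p))
          (sym (+-cong (negᵥ-∙ u (x j)) (-‿cong (negᵥ-∙ u p)))))

      only : ∀ {i} {P : Point d → Set} → (∀ k → k ≢ i → ¬ P (x k)) → (∀ {p q} → p ≋ q → P p → P q) → P (x i) →
        (range x ∩ P) ≐ ⟦ x i ⟧
      only {i} {P} others resp Pi = (λ { ((k , xk≋p) , Pp) → case k Fin.≟ i of λ where
          (yes ≡.refl) → xk≋p
          (no k≢i)     → ⊥-elim (others k k≢i (resp (≋-sym xk≋p) Pp)) }) ,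
        λ xi≋p → (i , xi≋p) , resp xi≋p Pi

    antipodal : ∀ {i j u} → i ≢ j → Max u i → Min u j → StrictlyAntipodal x i j
    antipodal {i} {j} {u} i≢j max min =
      i≢j , hyperplane i≢j min (u ∙ x i) , hyperplane i≢j min (u ∙ x j) , (1# , λ k → sym (*-identityˡ (u k))) ,
      (λ (⊆ , _) → <-irrefl (sym (⊆ {x i} refl)) (min i i≢j)) ,
      ((x i , generator∈conv x i , refl) , inj₁ λ p p∈ → conv-≤ {x = x} u (u ∙ x i) (max-≤ {u} max) p∈) ,
      ((x j , generator∈conv x j , refl) , inj₂ λ p p∈ → conv-≥ min p∈) ,
      only (λ k k≢i → <⇒≉ (max k k≢i)) (λ p≋q eq → trans (∙-cong ≋-refl (≋-sym p≋q)) eq) refl ,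
      only (λ k k≢j eq → <⇒≉ (min k k≢j) (sym eq)) (λ p≋q eq → trans (∙-cong ≋-refl (≋-sym p≋q)) eq) refl

    module _ (distinct : ∀ {i j} → x i ≋ x j → i ≡ j) where

      private
        extreme : ∀ (H : Hyperplane d) {i} {P : Point d → Set} → Supports H (conv x) → (∀ k → P (x k)) →
          (P ∩ points H) ≐ ⟦ x i ⟧ → Max (normal H) i ⊎ Min (normal H) i
        extreme H {i} {P} (_ , side) Pk (⊆ , ⊇) = case side of λ where
            (inj₁ below) → inj₁ λ k k≢i → <-resp refl (sym xi∈) (≤∧≉⇒< (below (x k) (generator∈conv x k)) (off k k≢i))
            (inj₂ above) → inj₂ λ k k≢i → <-resp (sym xi∈) refl
              (≤∧≉⇒< (above (x k) (generator∈conv x k)) (λ eq → off k k≢i (sym eq)))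
          where
          xi∈ : normal H ∙ x i ≈ offset H
          xi∈ = proj₂ (⊇ ≋-refl)
          off : ∀ k → k ≢ i → normal H ∙ x k ≉ offset H
          off k k≢i eq = k≢i (≡.sym (distinct (⊆ (Pk k , eq))))

      -- Each hyperplane supports from an unknown side, and the normals may point in opposite
      -- directions. Two maxima or two minima at different points are impossible; the remaining
      -- reversal is undone by a sign.
      strict-functional : ∀ {i j} → StrictlyAntipodal x i j → ∃[ u ] Max u i × Min u j
      strict-functional {i} {j} (i≢j , H , H′ , (t , H′≋) , _ , supH , supH′ , eqH , eqH′) =
        combine (extreme H supH (λ k → k , ≋-refl) eqH)
          (scale-extreme t t≉0 H′≋ (extreme H′ supH′ (λ k → k , ≋-refl) eqH′))
        where
        h = normal H
        t≉0 : t ≉ 0#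
        t≉0 t≈0 = normal≉0 H′ λ k → trans (H′≋ k) (trans (*-congʳ t≈0) (zeroˡ _))
        combine : Max h i ⊎ Min h i → Max h j ⊎ Min h j → ∃[ u ] Max u i × Min u j
        combine (inj₁ max) (inj₁ max′) = ⊥-elim (<-irrefl refl (<-trans (max j (i≢j ∘ ≡.sym)) (max′ i i≢j)))
        combine (inj₁ max) (inj₂ min′) = h , max , min′
        combine (inj₂ min) (inj₁ max′) = negᵥ h , neg-min min , neg-max max′
        combine (inj₂ min) (inj₂ min′) = ⊥-elim (<-irrefl refl (<-trans (min j (i≢j ∘ ≡.sym)) (min′ i i≢j)))

      vertex-functional : ∀ {i} → vert (conv x) (x i) → ∃[ u ] Max u i
      vertex-functional {i} (H , sup , eq) = case extreme H sup (generator∈conv x) eq of λ where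
        (inj₁ max) → normal H , max
        (inj₂ min) → negᵥ (normal H) , neg-min min

    strictly-convex : (∀ i → ∃[ u ] ¬ (u ≋ 0ᵥ) × Max u i) → range x ≐ vert (conv x)
    strictly-convex exposing = (λ { {p} (i , xi≋p) → let u , u≉0 , max = exposing i in
          record { normal = u ; offset = u ∙ x i ; normal≉0 = u≉0 } ,
          ((x i , generator∈conv x i , refl) , inj₁ λ q q∈ → conv-≤ {x = x} u (u ∙ x i) (max-≤ {u} max) q∈) ,
          (λ { {q} (q∈ , eq) → ≋-trans (≋-sym xi≋p) (conv-face {x = x} u i max q∈ (≤-reflexive (sym eq))) }) ,
          λ { {q} p≋q → conv-resp (≋-trans xi≋p p≋q) (generator∈conv x i) , ∙-cong ≋-refl (≋-sym (≋-trans xi≋p p≋q)) }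
            }) ,
        λ { {p} (H , ((q , q∈ , eq) , inj₁ below) , ⊆ , _) → attained H (normal H) (offset H) (λ y y∈ → below y y∈) q∈
          eq (λ e → e) ⊆
          ; {p} (H , ((q , q∈ , eq) , inj₂ above) , ⊆ , _) → attained H (negᵥ (normal H)) (- offset H)
              (λ y y∈ → by≤ (≤⇒0≤ (above y y∈))
                (trans (+-congˡ (-‿cong (negᵥ-∙ (normal H) y)))
                (solve 2 (λ o a → (:- o) :- (:- a) := a :- o) refl (offset H) (normal H ∙ y))))
              q∈ (trans (negᵥ-∙ (normal H) q) (-‿cong eq))
              (λ {y} e → trans (sym (-‿involutive _))
                (trans (-‿cong (trans (sym (negᵥ-∙ (normal H) y)) e)) (-‿involutive _))) ⊆ }
      where
      conv-resp : ∀ {p q} → p ≋ q → conv x p → conv x q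
      conv-resp p≋q (w , w≥0 , w≈1 , comb) = w , w≥0 , w≈1 , ≋-trans comb p≋q
      -- A supporting hyperplane passes through a generator: otherwise all slacks are positive,
      -- their weighted sum at the contact point is zero, and the weights could not add up to 1.
      attained : ∀ {p q} (H : Hyperplane d) u o → (∀ y → conv x y → u ∙ y ≤ o) → conv x q → u ∙ q ≈ o →
        (∀ {y} → u ∙ y ≈ o → points H y) → (∀ {y} → (conv x ∩ points H) y → p ≋ y) → range x p
      attained {p} {q} H u o below q∈@(w , w≥0 , w≈1 , comb) eq on ⊆ = case em {P = ∃[ k ] u ∙ x k ≈ o} of λ where
          (yes (k , uk≈o)) → k , ≋-sym (⊆ (generator∈conv x k , on uk≈o))
          (no none)        → ⊥-elim (0≉1 (trans (sym (sum-zero λ k → *-zero-divisor (trans (*-comm _ (w k)) (terms k))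
                               (0<⇒≉0 (<⇒0< (≤∧≉⇒< (below (x k) (generator∈conv x k)) λ e → none (k , e)))))) w≈1))
        where
        terms : ∀ k → w k * (o - u ∙ x k) ≈ 0#
        terms = sum-nonnegative-zero (λ k → 0≤*0≤ (w≥0 k) (≤⇒0≤ (below (x k) (generator∈conv x k))))
          (trans (affine-∙ w x w≈1 comb u o) (≈⇒-≈0 (sym eq)))

-- The symmetric polytope of the strictly antipodal pairs

lookup-unique : {A : Set} {xs : List A} → Unique xs → ∀ {i j} → lookup xs i ≡ lookup xs j → i ≡ j
lookup-unique {xs = _ ∷ _}  (x∉ ∷ xs!) {zero}  {zero}  eq = ≡.refl
lookup-unique {xs = x ∷ xs} (x∉ ∷ xs!) {zero}  {suc j} eq = ⊥-elim (All.lookup x∉ (∈-lookup j) eq)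
lookup-unique {xs = x ∷ xs} (x∉ ∷ xs!) {suc i} {zero}  eq = ⊥-elim (All.lookup x∉ (∈-lookup i) (≡.sym eq))
lookup-unique {xs = _ ∷ _}  (x∉ ∷ xs!) {suc i} {suc j} eq = ≡.cong suc (lookup-unique xs! eq)

∈⇒lookup : {A : Set} {xs : List A} {x : A} → x ∈ xs → ∃[ i ] lookup xs i ≡ x
∈⇒lookup (here ≡.refl) = zero , ≡.refl
∈⇒lookup (there x∈)    = let i , eq = ∈⇒lookup x∈ in suc i , eq

length-cartesianProduct : {A B : Set} (xs : List A) (ys : List B) → length (cartesianProduct xs ys) ≡ length xs ℕ.*
  length ys
length-cartesianProduct []       ys = ≡.refl
length-cartesianProduct (x ∷ xs) ys = ≡.trans (length-++ (map (x ,_) ys))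
  (≡.cong₂ ℕ._+_ (length-map (x ,_) ys) (length-cartesianProduct xs ys))

module Antipodality (em : ExcludedMiddle 0ℓ) (ℝ : RealField) where

  open ConvexGeometry em ℝ public

  module AntipodalPairs {d n : ℕ} (x : Fin n → Point d) where

    increasing : List (Fin n × Fin n)
    increasing = filter (λ (i , j) → i <ᶠ? j) (cartesianProduct (allFin n) (allFin n))

    -- Built by the same filters as in `sa`, so that `m` is `sa x` definitionally.
    pairs : List (Fin n × Fin n)
    pairs = filter (λ (i , j) → em {P = StrictlyAntipodal x i j}) increasing

    pairs! : Unique pairs
    pairs! = Unique.filter⁺ (λ (i , j) → em {P = StrictlyAntipodal x i j})
      (Unique.filter⁺ (λ (i , j) → i <ᶠ? j) (Unique.cartesianProduct⁺ (Unique.allFin⁺ n) (Unique.allFin⁺ n)))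

    ∈-pairs : ∀ {i j} → i Fin.< j → StrictlyAntipodal x i j → (i , j) ∈ pairs
    ∈-pairs {i} {j} i<j anti = ∈-filter⁺ (λ (i , j) → em {P = StrictlyAntipodal x i j})
      (∈-filter⁺ (λ (i , j) → i <ᶠ? j) (∈-cartesianProduct⁺ (∈-allFin i) (∈-allFin j)) i<j) anti

    pairs⇒ : ∀ {p} → p ∈ pairs → proj₁ p Fin.< proj₂ p × StrictlyAntipodal x (proj₁ p) (proj₂ p)
    pairs⇒ p∈ =
      let p∈′ , anti = ∈-filter⁻ (λ (i , j) → em {P = StrictlyAntipodal x i j}) {xs = increasing} p∈
      in proj₂ (∈-filter⁻ (λ (i , j) → i <ᶠ? j) {xs = cartesianProduct (allFin n) (allFin n)} p∈′) , anti

    m : ℕ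
    m = length pairs

    v φ : Fin m → Point d
    v k = x (proj₁ (lookup pairs k)) -ᵥ x (proj₂ (lookup pairs k))
    φ k = x (proj₁ (lookup pairs k)) +ᵥ x (proj₂ (lookup pairs k))

    open Signed v public

    -- The sign of a signed pair exchanges its ends, which negates their difference and keeps their
    -- sum.
    first second : W → Fin n
    first  (k , true)  = proj₁ (lookup pairs k)
    first  (k , false) = proj₂ (lookup pairs k)
    second (k , true)  = proj₂ (lookup pairs k)
    second (k , false) = proj₁ (lookup pairs k)

    z-∙ : ∀ u a → u ∙ z a ≈ u ∙ x (first a) - u ∙ x (second a)
    z-∙ u (k , true)  = ∙--ᵥ u _ _
    z-∙ u (k , false) = trans (∙-negᵥ u (v k)) (trans (-‿cong (∙--ᵥ u _ _))
      (solve 2 (λ a b → :- (a :- b) := b :- a) refl (u ∙ x (proj₁ (lookup pairs k))) (u ∙ x (proj₂ (lookup pairs k)))))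

    φ-∙ : ∀ u a → u ∙ φ (proj₁ a) ≈ u ∙ x (first a) + u ∙ x (second a)
    φ-∙ u (k , true)  = ∙-+ᵥ u _ _
    φ-∙ u (k , false) = trans (∙-+ᵥ u _ _) (+-comm _ _)

    ends-injective : ∀ {a b} → first a ≡ first b → second a ≡ second b → a ≡ b
    ends-injective {k , true}  {l , true}  p q = ≡.cong (_, true) (lookup-unique pairs! (≡.cong₂ _,_ p q))
    ends-injective {k , false} {l , false} p q = ≡.cong (_, false) (lookup-unique pairs! (≡.cong₂ _,_ q p))
    ends-injective {k , true}  {l , false} p q = ⊥-elim (Fin.<-asym (proj₁ (pairs⇒ (∈-lookup {xs = pairs} k)))
      (≡.subst₂ Fin._<_ (≡.sym q) (≡.sym p) (proj₁ (pairs⇒ (∈-lookup {xs = pairs} l)))))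
    ends-injective {k , false} {l , true}  p q = ⊥-elim (Fin.<-asym (proj₁ (pairs⇒ (∈-lookup {xs = pairs} k)))
      (≡.subst₂ Fin._<_ (≡.sym p) (≡.sym q) (proj₁ (pairs⇒ (∈-lookup {xs = pairs} l)))))

  module AntipodalConfiguration {d n : ℕ} (x : Fin n → Point d) (conf : StrictlyConvexConfiguration x) (2≤n : 2 ℕ.≤ n) where

    open AntipodalPairs x public

    ends-functional : ∀ a → ∃[ u ] Max x u (first a) × Min x u (second a)
    ends-functional (k , σ) = orient σ (strict-functional x (distinct conf) {first (k , true)} {second (k , true)}
      (proj₂ (pairs⇒ (∈-lookup {xs = pairs} k))))
      where
      orient : ∀ σ → (∃[ u ] Max x u (first (k , true)) × Min x u (second (k , true))) →
        ∃[ u ] Max x u (first (k , σ)) × Min x u (second (k , σ))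
      orient true  h               = h
      orient false (u , max , min) = negᵥ u , neg-min x {u} {second (k , true)} min , neg-max x {u} {first (k , true)}
        max

    ends : ∀ {i j u} → i ≢ j → Max x u i → Min x u j → ∃[ a ] first a ≡ i × second a ≡ j
    ends {i} {j} {u} i≢j max min = case Fin.<-cmp i j of λ where
        (tri< i<j _ _) → forward (∈⇒lookup (∈-pairs {i} {j} i<j anti))
        (tri≈ _ i≡j _) → ⊥-elim (i≢j i≡j)
        (tri> _ _ j<i) → backward (∈⇒lookup (∈-pairs {j} {i} j<i anti′))
      where
      anti : StrictlyAntipodal x i j
      anti = antipodal x {i} {j} {u} i≢j max min
      anti′ : StrictlyAntipodal x j i
      anti′ = antipodal x {j} {i} {negᵥ u} (i≢j ∘ ≡.sym) (neg-min x {u} {j} min) (neg-max x {u} {i} max)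
      forward : ∃[ k ] lookup pairs k ≡ (i , j) → ∃[ a ] first a ≡ i × second a ≡ j
      forward (k , eq) = (k , true) , ≡.cong proj₁ eq , ≡.cong proj₂ eq
      backward : ∃[ k ] lookup pairs k ≡ (j , i) → ∃[ a ] first a ≡ i × second a ≡ j
      backward (k , eq) = (k , false) , ≡.cong proj₂ eq , ≡.cong proj₁ eq

    private
      D : Fin n × Fin n → Point d
      D (i , j) = x i -ᵥ x j

      D-∙ : ∀ u p → u ∙ D p ≈ u ∙ x (proj₁ p) - u ∙ x (proj₂ p)
      D-∙ u (i , j) = ∙--ᵥ u (x i) (x j)

      all-pairs : List (Fin n × Fin n)
      all-pairs = cartesianProduct (allFin n) (allFin n)

      ∈all : ∀ p → p ∈ all-pairs
      ∈all (i , j) = ∈-cartesianProduct⁺ (∈-allFin i) (∈-allFin j)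

      Distinct : Fin n × Fin n → Set
      Distinct (i , j) = i ≢ j

      D-nonzero : ∀ {y} → y ∈ map D (select Distinct all-pairs) → ∃[ w ] w ∙ y ≉ 0#
      D-nonzero y∈ = let p , p∈ , eq = ∈-map⁻ D y∈ in
        ≡.subst (λ y → ∃[ w ] w ∙ y ≉ 0#) (≡.sym eq) (nonzero p (proj₂ (∈-select⁻ all-pairs p∈)))
        where
        nonzero : ∀ p → Distinct p → ∃[ w ] w ∙ D p ≉ 0#
        nonzero (i , j) i≢j = by-contradiction λ none → i≢j (distinct conf (∙-≋ λ u →
          -≈0⇒≈ (trans (sym (D-∙ u (i , j))) (by-contradiction λ h → none (u , h)))))

      generic : ∀ u → ∃[ u′ ] (∀ i j → u ∙ x j < u ∙ x i → u′ ∙ x j < u′ ∙ x i) × (∀ i j → i ≢ j → u′ ∙ x i ≉ u′ ∙ x j)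
      generic u =
        let u′ , pos , nz = perturb (map D (select Rising all-pairs)) (map D (select Distinct all-pairs)) u rising
              D-nonzero in
        u′ , (λ i j h → 0<⇒< (<-resp refl (D-∙ u′ (i , j))
          (pos _ (∈-map⁺ D (∈-select⁺ {P = Rising} (∈all (i , j)) h))))) ,
        λ i j i≢j eq → nz _ (∈-map⁺ D (∈-select⁺ {P = Distinct} (∈all (i , j)) i≢j)) (trans (D-∙ u′ (i , j)) (≈⇒-≈0 eq))
        where
        Rising : Fin n × Fin n → Set
        Rising (i , j) = u ∙ x j < u ∙ x i
        rising : ∀ {p} → p ∈ map D (select Rising all-pairs) → 0# < u ∙ p
        rising p∈ = let p , p∈′ , eq = ∈-map⁻ D p∈ in
          ≡.subst (λ y → 0# < u ∙ y) (≡.sym eq) (<-resp refl (sym (D-∙ u p)) (<⇒0< (proj₂ (∈-select⁻ all-pairs p∈′))))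

    -- A generic functional that keeps all strict inequalities of `u` has unique extreme points.
    -- They form a strictly antipodal pair and are extreme for `u` too.
    width : ∀ u → ∃[ a ] (∀ k → u ∙ x k ≤ u ∙ x (first a)) × (∀ k → u ∙ x (second a) ≤ u ∙ x k)
    width u = attained (proj₁ (generic u)) (proj₁ (proj₂ (generic u))) (proj₂ (proj₂ (generic u)))
      where
      two : ∃[ i ] ∃[ j ] i ∈ allFin n × j ∈ allFin n × i ≢ j
      two = two-distinct (Unique.allFin⁺ n) (ℕ.≤-trans 2≤n (ℕ.≤-reflexive (≡.sym (length-allFin n))))
      attained : ∀ u′ → (∀ i j → u ∙ x j < u ∙ x i → u′ ∙ x j < u′ ∙ x i) → (∀ i j → i ≢ j → u′ ∙ x i ≉ u′ ∙ x j) →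
        ∃[ a ] (∀ k → u ∙ x k ≤ u ∙ x (first a)) × (∀ k → u ∙ x (second a) ≤ u ∙ x k)
      attained u′ keep separate = locate (argmax (λ k → u′ ∙ x k) (allFin n) (∈-allFin (proj₁ two)))
        (argmin (λ k → u′ ∙ x k) (allFin n) (∈-allFin (proj₁ two)))
        where
        locate : (∃[ i ] i ∈ allFin n × (∀ {k} → k ∈ allFin n → u′ ∙ x k ≤ u′ ∙ x i)) →
          (∃[ j ] j ∈ allFin n × (∀ {k} → k ∈ allFin n → u′ ∙ x j ≤ u′ ∙ x k)) →
          ∃[ a ] (∀ k → u ∙ x k ≤ u ∙ x (first a)) × (∀ k → u ∙ x (second a) ≤ u ∙ x k)
        locate (i , _ , top-i) (j , _ , bot-j) =
          let a , fa≡i , sa≡j = ends {i} {j} {u′} i≢j (λ k k≢i → ≤∧≉⇒< (top-i (∈-allFin k)) (separate k i k≢i))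
                                  (λ k k≢j → ≤∧≉⇒< (bot-j (∈-allFin k)) (separate j k (k≢j ∘ ≡.sym)))
          in a , (λ k → ≡.subst (λ i → u ∙ x k ≤ u ∙ x i) (≡.sym fa≡i)
            (by-contradiction λ h → keep k i h (top-i (∈-allFin k)))) ,
                 λ k → ≡.subst (λ j → u ∙ x j ≤ u ∙ x k) (≡.sym sa≡j)
                   (by-contradiction λ h → keep j k h (bot-j (∈-allFin k)))
          where
          i≢j : i ≢ j
          i≢j ≡.refl = let k , l , _ , _ , k≢l = two in separate k l k≢l
            (antisym (≤-trans (top-i (∈-allFin k)) (bot-j (∈-allFin l)))
              (≤-trans (top-i (∈-allFin l)) (bot-j (∈-allFin k))))

    -- By `width` the largest difference of values of `u` on the points occurs among the `u ∙ z b`,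
    -- so a maximal `a` realises it.
    top-ends : ∀ {u a} → Top u a → (∀ k → u ∙ x k ≤ u ∙ x (first a)) × (∀ k → u ∙ x (second a) ≤ u ∙ x k)
    top-ends {u} {a} (_ , a-top) = squeeze (width u)
      where
      squeeze : (∃[ b ] (∀ k → u ∙ x k ≤ u ∙ x (first b)) × (∀ k → u ∙ x (second b) ≤ u ∙ x k)) →
        (∀ k → u ∙ x k ≤ u ∙ x (first a)) × (∀ k → u ∙ x (second a) ≤ u ∙ x k)
      squeeze (b , max , min) = (λ k → ≤-trans (max k) (by≤ (0≤+0≤ (≤⇒0≤ wider) (≤⇒0≤ (min (second a))))
            (solve 4 (λ fa sa fb sb → fa :- fb := ((fa :- sa) :- (fb :- sb)) :+ (sa :- sb)) refl (u ∙ x (first a))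
              (u ∙ x (second a)) (u ∙ x (first b)) (u ∙ x (second b))))) ,
          λ k → ≤-trans (by≤ (0≤+0≤ (≤⇒0≤ wider) (≤⇒0≤ (max (first a))))
            (solve 4 (λ fa sa fb sb → sb :- sa := ((fa :- sa) :- (fb :- sb)) :+ (fb :- fa)) refl (u ∙ x (first a))
              (u ∙ x (second a)) (u ∙ x (first b)) (u ∙ x (second b)))) (min k)
        where
        wider : u ∙ x (first b) - u ∙ x (second b) ≤ u ∙ x (first a) - u ∙ x (second a)
        wider = ≤-resp (z-∙ u b) (z-∙ u a) (a-top (L-complete b))

    exposed : ∀ {a} → a ∈ L → Exposed a
    exposed {a} _ = strict (ends-functional a)
      where
      strict : (∃[ u ] Max x u (first a) × Min x u (second a)) → Exposed a
      strict (u , max , min) = u , λ {b} _ b≢a → <-resp (sym (z-∙ u b)) (sym (z-∙ u a))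
        (case first b Fin.≟ first a of λ where
        (no f≢)  → by< (0<+0≤ (<⇒0< (max (first b) f≢)) (≤⇒0≤ (min-≤ x {u} min (second b)))) (rearrange b)
        (yes f≡) → by< (0≤+0< (≤⇒0≤ (max-≤ x {u} max (first b)))
          (<⇒0< (min (second b) λ s≡ → b≢a (ends-injective f≡ s≡)))) (rearrange b))
        where
        rearrange : ∀ b → (u ∙ x (first a) - u ∙ x (second a)) - (u ∙ x (first b) - u ∙ x (second b)) ≈
          (u ∙ x (first a) - u ∙ x (first b)) + (u ∙ x (second b) - u ∙ x (second a))
        rearrange b = solve 4 (λ fa sa fb sb → (fa :- sa) :- (fb :- sb) := (fa :- fb) :+ (sb :- sa)) refl
          (u ∙ x (first a)) (u ∙ x (second a)) (u ∙ x (first b)) (u ∙ x (second b))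

    flex : Flexible (φ ∘ proj₁)
    flex {u} {a} {b} ⊤a ⊤b =
      let max , min = top-ends ⊤a
          max′ , min′ = top-ends ⊤b
      in trans (φ-∙ u a) (trans (+-cong (antisym (max′ (first a)) (max (first b)))
        (antisym (min (second b)) (min′ (second a)))) (sym (φ-∙ u b)))

    -- A functional vanishing on all `z a` has width zero by `width`; it is constant on the points,
    -- hence on their affine hull, which is the whole space.
    spanning : ∀ u → (∀ a → u ∙ z a ≈ 0#) → u ≋ 0ᵥ
    spanning u zeros k = trans (sym (trans (∙-comm u (unit k)) (unit-∙ k u)))
      (trans (value (unit k)) (trans (sym (value 0ᵥ)) (trans (∙-comm u 0ᵥ) (0ᵥ-∙ {u = 0ᵥ} {u} (λ _ → refl)))))
      where
      c : K
      c = u ∙ x (first (proj₁ (width u)))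
      const : ∀ k → u ∙ x k ≈ c
      const k = let a , max , min = width u in antisym (max k)
        (≤-trans (≤-reflexive (-≈0⇒≈ (trans (sym (z-∙ u a)) (zeros a)))) (min k))
      value : ∀ p → u ∙ p ≈ c
      value p = let w , w≈1 , comb = affinelySpanning conf p in
        sym (-≈0⇒≈ (trans (sym (affine-∙ w x w≈1 comb u c))
          (sum-zero λ k → trans (*-congˡ (≈⇒-≈0 (sym (const k)))) (zeroʳ (w k)))))

    isConfiguration : IsConfiguration φ
    isConfiguration = record { exposed = exposed ; flex = flex ; spanning = spanning }

    Centred : Set
    Centred = ∀ a b w → w ∙ x (first a) + w ∙ x (second a) ≈ w ∙ x (first b) + w ∙ x (second b)

    few⇒centred : 3 ℕ.≤ d → sa x ℕ.< 2 ℕ.* d → Centred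
    few⇒centred 3≤d sa<2d a b w = trans (sym (φ-∙ w a))
      (trans (flex-constant v φ isConfiguration 3≤d sa<2d (proj₁ a) (proj₁ b) w) (φ-∙ w b))

    length-L : length L ≡ sa x ℕ.* 2
    length-L = ≡.trans (length-cartesianProduct (allFin m) _) (≡.cong (ℕ._* 2) (length-allFin m))

    first-injective : Centred → ∀ {a b} → first a ≡ first b → a ≡ b
    first-injective centred {a} {b} eq = ends-injective eq (distinct conf (∙-≋ λ w → begin
        w ∙ x (second a)
          ≈⟨ solve 2 (λ f s → s := (f :+ s) :- f) refl (w ∙ x (first a)) (w ∙ x (second a)) ⟩
        (w ∙ x (first a) + w ∙ x (second a)) - w ∙ x (first a)
          ≈⟨ +-cong (centred a b w) (-‿cong (reflexive (≡.cong (λ i → w ∙ x i) eq))) ⟩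
        (w ∙ x (first b) + w ∙ x (second b)) - w ∙ x (first b)
          ≈⟨ solve 2 (λ f s → (f :+ s) :- f := s) refl (w ∙ x (first b)) (w ∙ x (second b)) ⟩
        w ∙ x (second b)                                                ∎))
      where open ≈-Reasoning

    -- For a functional that exposes the vertex, `width` can only return a pair beginning there.
    first-surjective : ∀ i → ∃[ a ] first a ≡ i
    first-surjective i = locate (vertex-functional x (distinct conf) {i} (proj₁ (strictlyConvex conf) (i , λ _ → refl)))
      where
      locate : (∃[ u ] Max x u i) → ∃[ a ] first a ≡ i
      locate (u , max) = let a , top-a , _ = width u in a , by-contradiction λ f≢i → max (first a) f≢i (top-a i)

    n≤2sa : n ℕ.≤ sa x ℕ.* 2
    n≤2sa = begin
      n                      ≡⟨ length-allFin n ⟨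
      length (allFin n)      ≤⟨ length-injection (λ i a → first a ≡ i) L (Unique.allFin⁺ n)
          (λ {i} _ → let a , eq = first-surjective i in a , L-complete a , eq) (λ _ _ p q → ≡.trans (≡.sym p) q) ⟩
      length L               ≡⟨ length-L ⟩
      sa x ℕ.* 2             ∎
      where open ℕ.≤-Reasoning

    2sa≤n : Centred → sa x ℕ.* 2 ℕ.≤ n
    2sa≤n centred = begin
      sa x ℕ.* 2             ≡⟨ length-L ⟨
      length L
        ≤⟨ length-injection (λ a i → first a ≡ i) (allFin n) L! (λ {a} _ → first a , ∈-allFin _ , ≡.refl)
          (λ _ _ p q → first-injective centred (≡.trans p (≡.sym q))) ⟩
      length (allFin n)      ≡⟨ length-allFin n ⟩
      n                      ∎
      where open ℕ.≤-Reasoning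

    d≤sa : d ℕ.≤ sa x
    d≤sa = ℕ.≮⇒≥ λ m<d →
      let u , u≉0 , zeros = common-zero (tabulate v) (≡.subst (ℕ._< d) (≡.sym (length-tabulate v)) m<d)
      in u≉0 (spanning u (all-zero u λ k → zeros (∈-tabulate⁺ k)))
      where
      all-zero : ∀ u → (∀ k → u ∙ v k ≈ 0#) → ∀ a → u ∙ z a ≈ 0#
      all-zero u h (k , true)  = h k
      all-zero u h (k , false) = trans (∙-negᵥ u (v k)) (trans (-‿cong (h k)) -0#≈0#)

-- Cross-polytopes and point sets with a centre

module CrossPolytopes (em : ExcludedMiddle 0ℓ) (ℝ : RealField) where

  open Antipodality em ℝ public

  conv-mono : ∀ {d n n′} {x : Fin n → Point d} {y : Fin n′ → Point d} → (∀ i → conv y (x i)) → ∀ {p} → conv x p →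
    conv y p
  conv-mono {n = n} {n′} {x} {y} x∈ {p} (w , w≥0 , w≈1 , comb) = W ,
      (λ j → sum-nonnegative λ i → 0≤*0≤ (w≥0 i) (proj₁ (proj₂ (x∈ i)) j)) ,
      (begin
        sum (λ j → sum (λ i → w i * ω i j))     ≈⟨ ∑-comm (λ j i → w i * ω i j) ⟩
        sum (λ i → sum (λ j → w i * ω i j))
          ≈⟨ sum-cong-≋ (λ i → trans (sym (*-distribˡ-sum (w i) (ω i)))
            (trans (*-congˡ (proj₁ (proj₂ (proj₂ (x∈ i))))) (*-identityʳ (w i)))) ⟩
        sum w                                   ≈⟨ w≈1 ⟩
        1#                                      ∎) ,
      λ k → begin
        sum (λ j → sum (λ i → w i * ω i j) * y j k)
          ≈⟨ sum-cong-≋ (λ j → *-distribʳ-sum (y j k) (λ i → w i * ω i j)) ⟩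
        sum (λ j → sum (λ i → w i * ω i j * y j k))        ≈⟨ ∑-comm (λ j i → w i * ω i j * y j k) ⟩
        sum (λ i → sum (λ j → w i * ω i j * y j k))
          ≈⟨ sum-cong-≋ (λ i → trans (sum-cong-≋ λ j → *-assoc (w i) (ω i j) (y j k))
            (sym (*-distribˡ-sum (w i) (λ j → ω i j * y j k)))) ⟩
        sum (λ i → w i * combination (ω i) y k)
          ≈⟨ sum-cong-≋ (λ i → *-congˡ (proj₂ (proj₂ (proj₂ (x∈ i))) k)) ⟩
        combination w x k                                  ≈⟨ comb k ⟩
        p k                                                ∎
    where
    open ≈-Reasoning
    ω : Fin n → Fin n′ → K
    ω i = proj₁ (x∈ i)
    W : Fin n′ → K
    W j = sum (λ i → w i * ω i j)

  conv-resp : ∀ {d n} {x : Fin n → Point d} {p q} → p ≋ q → conv x p → conv x q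
  conv-resp p≋q (w , w≥0 , w≈1 , comb) = w , w≥0 , w≈1 , ≋-trans comb p≋q

  module CrossGenerators {d : ℕ} (p : Point d) {m : ℕ} (v : Fin m → Point d) where

    generators : Fin (m ℕ.+ m) → Point d
    generators = (λ i → p +ᵥ v i) Vector.++ (λ i → p -ᵥ v i)

    generators-+ : ∀ i → ∃[ j ] generators j ≡ p +ᵥ v i
    generators-+ i = i ↑ˡ m , helper
      where
      helper : generators (i ↑ˡ m) ≡ p +ᵥ v i
      helper rewrite Fin.splitAt-↑ˡ m i m = ≡.refl

    generators-- : ∀ i → ∃[ j ] generators j ≡ p -ᵥ v i
    generators-- i = m ↑ʳ i , helper
      where
      helper : generators (m ↑ʳ i) ≡ p -ᵥ v i
      helper rewrite Fin.splitAt-↑ʳ m m i = ≡.refl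

    generators-cases : ∀ j → (∃[ i ] generators j ≡ p +ᵥ v i) ⊎ (∃[ i ] generators j ≡ p -ᵥ v i)
    generators-cases j with splitAt m j
    ... | inj₁ i = inj₁ (i , ≡.refl)
    ... | inj₂ i = inj₂ (i , ≡.refl)

    generator-+∈ : ∀ i → conv generators (p +ᵥ v i)
    generator-+∈ i = let j , eq = generators-+ i in ≡.subst (conv generators) eq (generator∈conv generators j)

    generator--∈ : ∀ i → conv generators (p -ᵥ v i)
    generator--∈ i = let j , eq = generators-- i in ≡.subst (conv generators) eq (generator∈conv generators j)

    reflect : Point d → Point d
    reflect q = (p +ᵥ p) -ᵥ q

    conv-symmetric : ∀ {q} → conv generators q → conv generators (reflect q)
    conv-symmetric {q} (w , w≥0 , w≈1 , comb) = conv-mono {x = reflect ∘ generators} reflected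
      (w , w≥0 , w≈1 , λ k → begin
        sum (λ j → w j * ((p k + p k) - generators j k))
          ≈⟨ sum-cong-≋ (λ j → solve 3 (λ w a g → w :* (a :- g) := w :* a :+ (:- :1) :* (w :* g)) refl (w j) (p k + p k)
            (generators j k)) ⟩
        sum (λ j → w j * (p k + p k) + (- 1#) * (w j * generators j k))
          ≈⟨ ∑-distrib-+ (λ j → w j * (p k + p k)) (λ j → (- 1#) * (w j * generators j k)) ⟩
        sum (λ j → w j * (p k + p k)) + sum (λ j → (- 1#) * (w j * generators j k))
          ≈⟨ +-cong (sym (*-distribʳ-sum (p k + p k) w)) (sym (*-distribˡ-sum (- 1#) (λ j → w j * generators j k))) ⟩
        sum w * (p k + p k) + (- 1#) * combination w generators k
          ≈⟨ +-cong (*-congʳ w≈1) (*-congˡ (comb k)) ⟩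
        1# * (p k + p k) + (- 1#) * q k
          ≈⟨ solve 2 (λ a q → :1 :* a :+ (:- :1) :* q := a :- q) refl (p k + p k) (q k) ⟩
        reflect q k                                                                     ∎)
      where
      open ≈-Reasoning
      reflected : ∀ j → conv generators (reflect (generators j))
      reflected j = case generators-cases j of λ where
        (inj₁ (i , eq)) → ≡.subst (λ g → conv generators (reflect g)) (≡.sym eq)
          (conv-resp (λ k → solve 2 (λ p v → p :- v := (p :+ p) :- (p :+ v)) refl (p k) (v i k)) (generator--∈ i))
        (inj₂ (i , eq)) → ≡.subst (λ g → conv generators (reflect g)) (≡.sym eq)
          (conv-resp (λ k → solve 2 (λ p v → p :+ v := (p :+ p) :- (p :- v)) refl (p k) (v i k)) (generator-+∈ i))

  module _ {d n : ℕ} (x : Fin n → Point d) (conf : StrictlyConvexConfiguration x) (2≤n : 2 ℕ.≤ n) where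

    open AntipodalConfiguration x conf 2≤n

    -- The reflection in the centre preserves the polytope and exchanges the two
    -- supporting hyperplanes of an antipodal pair.
    crossPolytope⇒centred : IsCrossPolytope (conv x) → Centred
    crossPolytope⇒centred (p , v′ , _ , ⊆ , ⊇) a b w = trans (centre a) (sym (centre b))
      where
      open CrossGenerators p v′
      symmetric : ∀ {q} → conv x q → conv x (reflect q)
      symmetric q∈ = ⊇ (conv-symmetric (⊆ q∈))
      reflect-∙ : ∀ u q → u ∙ reflect q ≈ u ∙ (p +ᵥ p) - u ∙ q
      reflect-∙ u q = ∙--ᵥ u (p +ᵥ p) q
      centre : ∀ a → w ∙ x (first a) + w ∙ x (second a) ≈ w ∙ (p +ᵥ p)
      centre a = swap (ends-functional a)
        where
        swap : (∃[ u ] Max x u (first a) × Min x u (second a)) → w ∙ x (first a) + w ∙ x (second a) ≈ w ∙ (p +ᵥ p)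
        swap (u , max , min) = trans (+-congˡ (trans (∙-cong ≋-refl opposite-end) (reflect-∙ w (x (first a)))))
            (solve 2 (λ f c → f :+ (c :- f) := c) refl (w ∙ x (first a)) (w ∙ (p +ᵥ p)))
          where
          low : u ∙ reflect (x (second a)) ≤ u ∙ x (first a)
          low = conv-≤ {x = x} u (u ∙ x (first a)) (max-≤ x {u} {first a} max) (symmetric (generator∈conv x (second a)))
          opposite-end : x (second a) ≋ reflect (x (first a))
          opposite-end = conv-face {x = x} (negᵥ u) (second a) (neg-min x {u} {second a} min)
            (symmetric (generator∈conv x (first a)))
            (by≤ (≤⇒0≤ low) (trans (+-cong (trans (negᵥ-∙ u _) (-‿cong (reflect-∙ u (x (first a)))))
              (-‿cong (negᵥ-∙ u (x (second a)))))
              (trans (solve 3 (λ c f s → (:- (c :- f)) :- (:- s) := f :- (c :- s)) refl (u ∙ (p +ᵥ p)) (u ∙ x (first a))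
                (u ∙ x (second a)))
                (+-congˡ (-‿cong (sym (reflect-∙ u (x (second a)))))))))

    -- The centre is the common midpoint, the axes are the half differences. In a linear dependence,
    -- a functional that vanishes on all axes but a redundant one would vanish on all, against
    -- `spanning`. `subst-dimension` passes from the index type `Fin (sa x)` to `Fin d`.
    centred⇒crossPolytope : Centred → sa x ≡ d → W → IsCrossPolytope (conv x)
    centred⇒crossPolytope centred sa≡d a₀ = subst-dimension sa≡d v½ independent′ (conv⊆ , ⊆conv)
      where
      h : K
      h = proj₁ half
      2h≈1 : h + h ≈ 1#
      2h≈1 = proj₂ (proj₂ half)
      p : Point d
      p = h *ᵥ (x (first a₀) +ᵥ x (second a₀))
      v½ : Fin m → Point d
      v½ k = h *ᵥ v k
      open CrossGenerators p v½
      p≋ : ∀ a → p ≋ h *ᵥ (x (first a) +ᵥ x (second a))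
      p≋ a k = *-congˡ (∙-≋ {y = x (first a₀) +ᵥ x (second a₀)} {x (first a) +ᵥ x (second a)} (λ w →
        trans (∙-+ᵥ w _ _) (trans (centred a₀ a w) (sym (∙-+ᵥ w _ _)))) k)
      first≋ : ∀ k → x (first (k , true)) ≋ p +ᵥ v½ k
      first≋ k c = sym (trans (+-congʳ (p≋ (k , true) c))
        (trans (solve 3 (λ h f s → h :* (f :+ s) :+ h :* (f :- s) := (h :+ h) :* f) refl h (x (first (k , true)) c)
        (x (second (k , true)) c))
        (trans (*-congʳ 2h≈1) (*-identityˡ _))))
      second≋ : ∀ k → x (second (k , true)) ≋ p -ᵥ v½ k
      second≋ k c = sym (trans (+-congʳ (p≋ (k , true) c))
        (trans (solve 3 (λ h f s → h :* (f :+ s) :- h :* (f :- s) := (h :+ h) :* s) refl h (x (first (k , true)) c)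
        (x (second (k , true)) c))
        (trans (*-congʳ 2h≈1) (*-identityˡ _))))
      x∈ : ∀ i → conv generators (x i)
      x∈ i = member (first-surjective i)
        where
        member : ∃[ a ] first a ≡ i → conv generators (x i)
        member ((k , true)  , ≡.refl) = conv-resp (≋-sym (first≋ k)) (generator-+∈ k)
        member ((k , false) , ≡.refl) = conv-resp (≋-sym (second≋ k)) (generator--∈ k)
      generators∈ : ∀ j → conv x (generators j)
      generators∈ j = case generators-cases j of λ where
        (inj₁ (k , eq)) → ≡.subst (conv x) (≡.sym eq) (conv-resp (first≋ k) (generator∈conv x _))
        (inj₂ (k , eq)) → ≡.subst (conv x) (≡.sym eq) (conv-resp (second≋ k) (generator∈conv x _))
      conv⊆ : ∀ {q} → conv x q → conv generators q
      conv⊆ = conv-mono x∈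
      ⊆conv : ∀ {q} → conv generators q → conv x q
      ⊆conv = conv-mono generators∈
      independent′ : LinearlyIndependent v½
      independent′ w comb i = by-contradiction λ wi≉0 → dependent wi≉0
        (common-zero (map v½ (select (_≢ i) (allFin m)))
          (≡.subst (ℕ._< d) (≡.sym (length-map v½ (select (_≢ i) (allFin m))))
          (ℕ.≤-trans (length-remove {xs = allFin m} {i} (Unique.allFin⁺ m) (∈-allFin i))
            (ℕ.≤-reflexive (≡.trans (length-allFin m) sa≡d)))))
        where
        dependent : w i ≉ 0# → (∃[ u ] ¬ (u ≋ 0ᵥ) × (∀ {y} → y ∈ map v½ (select (_≢ i) (allFin m)) → u ∙ y ≈ 0#)) → ⊥
        dependent wi≉0 (u , u≉0 , zeros) = u≉0 (spanning u signed)
          where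
          off : ∀ k → k ≢ i → v½ k ∙ u ≈ 0#
          off k k≢i = trans (∙-comm (v½ k) u) (zeros (∈-map⁺ v½ (∈-select⁺ {P = _≢ i} (∈-allFin k) k≢i)))
          on : v½ i ∙ u ≈ 0#
          on = *-zero-divisor (trans (sym (sum-single i λ k k≢i → trans (*-congˡ (off k k≢i)) (zeroʳ (w k))))
            (trans (sym (combination-∙ w v½ u)) (0ᵥ-∙ comb))) wi≉0
          all : ∀ k → v½ k ∙ u ≈ 0#
          all k = case k Fin.≟ i of λ where
            (yes ≡.refl) → on
            (no k≢i)     → off k k≢i
          unscaled : ∀ k → u ∙ v k ≈ 0#
          unscaled k = *-zero-divisor (trans (sym (∙-*ᵥ h u (v k))) (trans (∙-comm u (v½ k)) (all k)))
            (0<⇒≉0 (proj₁ (proj₂ half)))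
          signed : ∀ a → u ∙ z a ≈ 0#
          signed (k , true)  = unscaled k
          signed (k , false) = trans (∙-negᵥ u (v k)) (trans (-‿cong (unscaled k)) -0#≈0#)
      subst-dimension : ∀ {m} → m ≡ d → (v : Fin m → Point d) → LinearlyIndependent v →
        conv x ≐ conv (CrossGenerators.generators p v) → IsCrossPolytope (conv x)
      subst-dimension ≡.refl v independent eq = p , v , independent , eq

    -- A cross-polytope is centred, and centred sets satisfy `sa x * 2 ≤ n`; hence the size of
    -- `sa x` decides between the alternatives.
    crossPolytope-dichotomy : n ≡ 2 ℕ.* d → 3 ℕ.≤ d →
      (IsCrossPolytope (conv x) × sa x ≡ d) ⊎ (¬ IsCrossPolytope (conv x) × 2 ℕ.* d ℕ.≤ sa x)
    crossPolytope-dichotomy n≡2d 3≤d = case ℕ.≤-<-connex (2 ℕ.* d) (sa x) of λ where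
        (inj₁ 2d≤sa) → inj₂ ((λ cross → ℕ.<-irrefl ≡.refl
          (ℕ.<-≤-trans d<2d (ℕ.≤-trans 2d≤sa (small (crossPolytope⇒centred cross))))) , 2d≤sa)
        (inj₂ sa<2d) → let centred = few⇒centred 3≤d sa<2d
                           sa≡d = ℕ.≤-antisym (small centred) d≤sa
                       in inj₁ (centred⇒crossPolytope centred sa≡d (some-index sa≡d 3≤d , true) , sa≡d)
      where
      small : Centred → sa x ℕ.≤ d
      small centred = ℕ.*-cancelʳ-≤ (sa x) d 2 (ℕ.≤-trans (2sa≤n centred) (ℕ.≤-reflexive (≡.trans n≡2d (ℕ.*-comm 2 d))))
      d<2d : d ℕ.< 2 ℕ.* d
      d<2d = ℕ.m<m+n d (ℕ.≤-trans (ℕ.≤-trans (s≤s z≤n) 3≤d) (ℕ.≤-reflexive (≡.sym (ℕ.+-identityʳ d))))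
      some-index : ∀ {m} → m ≡ d → 3 ℕ.≤ d → Fin m
      some-index ≡.refl (s≤s _) = zero

-- Configurations with at most 2 d points

module Constructions (em : ExcludedMiddle 0ℓ) (ℝ : RealField) where

  open CrossPolytopes em ℝ public

  configuration : ∀ {d n} (x : Fin n → Point d) → 2 ℕ.≤ n → (∀ i → ∃[ u ] Max x u i) → (∀ p → aff x p) →
    StrictlyConvexConfiguration x
  configuration {d} {n} x 2≤n exposing spanning = record
    { distinct         = λ {i} {j} xi≋xj → by-contradiction λ i≢j → let u , max = exposing i in
        <-irrefl (∙-cong ≋-refl (≋-sym xi≋xj)) (max j (i≢j ∘ ≡.sym))
    ; affinelySpanning = spanning
    ; strictlyConvex   = strictly-convex x λ i → let u , max = exposing i ; k , k≢i = other i in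
        u , (λ u≋0 → <-irrefl (trans (0ᵥ-∙ u≋0) (sym (0ᵥ-∙ u≋0))) (max k k≢i)) , max
    }
    where
    two : ∃[ k ] ∃[ l ] k ∈ allFin n × l ∈ allFin n × k ≢ l
    two = two-distinct (Unique.allFin⁺ n) (ℕ.≤-trans 2≤n (ℕ.≤-reflexive (≡.sym (length-allFin n))))
    other : ∀ i → ∃[ k ] k ≢ i
    other i = let k , l , _ , _ , k≢l = two in case k Fin.≟ i of λ where
      (yes ≡.refl) → l , k≢l ∘ ≡.sym
      (no k≢i)     → k , k≢i

  module _ {d n : ℕ} (x : Fin n → Point d) where

    private
      Span : K → Point d → Set
      Span s p = ∃[ w ] sum w ≈ s × combination w x ≋ p

      span-resp : ∀ {s s′ p p′} → s ≈ s′ → p ≋ p′ → Span s p → Span s′ p′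
      span-resp s≈ p≋ (w , ws , wp) = w , trans ws s≈ , ≋-trans wp p≋

      span-point : ∀ k → Span 1# (x k)
      span-point k = let w , _ , w≈1 , comb = generator∈conv x k in w , w≈1 , comb

      span-+ : ∀ {s t p q} → Span s p → Span t q → Span (s + t) (p +ᵥ q)
      span-+ (w , ws , wp) (w′ , ws′ , wp′) = (λ i → w i + w′ i) , trans (∑-distrib-+ w w′) (+-cong ws ws′) , λ k →
        trans (sum-cong-≋ λ i → distribʳ (x i k) (w i) (w′ i))
          (trans (∑-distrib-+ (λ i → w i * x i k) (λ i → w′ i * x i k)) (+-cong (wp k) (wp′ k)))

      span-* : ∀ t {s p} → Span s p → Span (t * s) (t *ᵥ p)
      span-* t (w , ws , wp) = (λ i → t * w i) , trans (sym (*-distribˡ-sum t w)) (*-congˡ ws) , λ k →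
        trans (sum-cong-≋ λ i → *-assoc t (w i) (x i k))
          (trans (sym (*-distribˡ-sum t (λ i → w i * x i k))) (*-congˡ (wp k)))

      span-0 : Span 0# 0ᵥ
      span-0 = (λ _ → 0#) , sum-zero {n} {λ _ → 0#} (λ _ → refl) , λ k → sum-zero λ i → zeroˡ (x i k)

      span-sum : ∀ {m} (s : Fin m → K) (y : Fin m → Point d) → (∀ i → Span (s i) (y i)) → Span (sum s)
        (λ k → sum (λ i → y i k))
      span-sum {zero}  s y h = span-0
      span-sum {suc m} s y h = span-+ (h zero) (span-sum (s ∘ suc) (y ∘ suc) (h ∘ suc))

    -- The multiples of unit vectors express any `p` linearly. Equal multiples of a point and its
    -- negative then bring the sum of the weights to 1 without moving the result.
    affinely-spanning : ∀ {c} → c ≉ 0# → (α : Fin d → Fin n) → (∀ i → x (α i) ≋ c *ᵥ unit i) →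
      ∀ i₀ β → x β ≋ negᵥ (c *ᵥ unit i₀) → ∀ p → aff x p
    affinely-spanning {c} c≉0 α xα i₀ β xβ p = span-resp weight point (span-+ coordinates filler)
      where
      h = proj₁ half
      q : Fin d → K
      q i = p i * c ⁻¹
      r : K
      r = (1# - sum (λ i → q i * 1#)) * h
      coordinates : Span (sum (λ i → q i * 1#)) (λ k → sum (λ i → q i * x (α i) k))
      coordinates = span-sum (λ i → q i * 1#) (λ i → q i *ᵥ x (α i)) λ i → span-* (q i) (span-point (α i))
      filler : Span (r * (1# + 1#)) (r *ᵥ (x (α i₀) +ᵥ x β))
      filler = span-* r (span-+ (span-point (α i₀)) (span-point β))
      weight : sum (λ i → q i * 1#) + r * (1# + 1#) ≈ 1#
      weight = trans (solve 2 (λ s h → s :+ (:1 :- s) :* h :* (:1 :+ :1) := s :+ (:1 :- s) :* (h :+ h)) refl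
        (sum (λ i → q i * 1#)) h)
        (trans (+-congˡ (*-congˡ (proj₂ (proj₂ half))))
          (solve 1 (λ s → s :+ (:1 :- s) :* :1 := :1) refl (sum (λ i → q i * 1#))))
      point : ∀ k → sum (λ i → q i * x (α i) k) + r * (x (α i₀) k + x β k) ≈ p k
      point k = trans (+-cong
          (trans (sum-cong-≋ λ i → trans (*-congˡ (xα i k))
            (trans (solve 4 (λ p j c e → p :* j :* (c :* e) := (c :* j) :* p :* e) refl (p i) (c ⁻¹) c (unit i k))
             (*-congʳ (trans (*-congʳ (⁻¹-inverse c≉0)) (*-identityˡ (p i)))))) 
            (trans (sum-single k λ i i≢k → trans (*-congˡ (unit-off-diagonal (i≢k ∘ ≡.sym))) (zeroʳ (p i)))
              (trans (*-congˡ (unit-diagonal k)) (*-identityʳ (p k)))))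
          (trans (*-congˡ (+-cong (xα i₀ k) (xβ k)))
            (solve 2 (λ r y → r :* (y :+ (:- :1) :* y) := :0) refl r (c * unit i₀ k))))
        (+-identityʳ (p k))

  unit-∙-unit : ∀ {d} {i j : Fin d} → j ≢ i → unit i ∙ unit j ≈ 0#
  unit-∙-unit {i = i} {j} j≢i = trans (unit-∙ i (unit j)) (unit-off-diagonal {i = j} {i} (j≢i ∘ ≡.sym))

  unit-∙-self : ∀ {d} (i : Fin d) → unit i ∙ unit i ≈ 1#
  unit-∙-self i = trans (unit-∙ i (unit i)) (unit-diagonal i)

  -- All vertices of a cross-polytope on one side and some on the other.
  module PartialCross {d : ℕ} (J : List (Fin d)) (J! : Unique J) {j₀ : Fin d} (j₀∈ : j₀ ∈ J) where

    codes : List (Fin d × Bool)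
    codes = map (_, true) (allFin d) ++ map (_, false) J

    codes! : Unique codes
    codes! = Unique.++⁺ (Unique.map⁺ (≡.cong proj₁) (Unique.allFin⁺ d)) (Unique.map⁺ (≡.cong proj₁) J!)
      λ { (p , q) → case ≡.trans (≡.sym (≡.cong proj₂ (proj₂ (proj₂ (∈-map⁻ (_, true) p)))))
        (≡.cong proj₂ (proj₂ (proj₂ (∈-map⁻ (_, false) q)))) of λ () }

    length-codes : length codes ≡ d ℕ.+ length J
    length-codes = ≡.trans (length-++ (map (_, true) (allFin d)))
      (≡.cong₂ ℕ._+_ (≡.trans (length-map (_, true) (allFin d)) (length-allFin d)) (length-map (_, false) J))

    point : Fin d × Bool → Point d
    point (i , true)  = unit i
    point (i , false) = negᵥ (unit i)

    x : Fin (length codes) → Point d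
    x k = point (lookup codes k)

    point-self : ∀ a → point a ∙ point a ≈ 1#
    point-self (i , true)  = unit-∙-self i
    point-self (i , false) = trans (negᵥ-∙ (unit i) (negᵥ (unit i)))
      (trans (-‿cong (trans (∙-negᵥ (unit i) (unit i)) (-‿cong (unit-∙-self i)))) (-‿involutive 1#))

    point-other : ∀ a b → b ≢ a → point a ∙ point b ≤ 0#
    point-other (i , σ) (j , τ) b≢a = case j Fin.≟ i of λ where
        (no j≢i)     → ≤-reflexive (orthogonal σ τ (unit-∙-unit j≢i))
        (yes ≡.refl) → same σ τ b≢a
      where
      -0≈0 : ∀ {y} → y ≈ 0# → - y ≈ 0#
      -0≈0 h = trans (-‿cong h) -0#≈0#
      orthogonal : ∀ σ τ → unit i ∙ unit j ≈ 0# → point (i , σ) ∙ point (j , τ) ≈ 0#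
      orthogonal true  true  h = h
      orthogonal true  false h = trans (∙-negᵥ (unit i) (unit j)) (-0≈0 h)
      orthogonal false true  h = trans (negᵥ-∙ (unit i) (unit j)) (-0≈0 h)
      orthogonal false false h = trans (negᵥ-∙ (unit i) (negᵥ (unit j)))
        (-0≈0 (trans (∙-negᵥ (unit i) (unit j)) (-0≈0 h)))
      -1≤0 : - 1# ≤ 0#
      -1≤0 = by≤ (<⇒≤ 0<1) (solve 1 (λ x → :0 :- :- x := x) refl 1#)
      same : ∀ σ τ → (i , τ) ≢ (i , σ) → point (i , σ) ∙ point (i , τ) ≤ 0#
      same true  true  h = ⊥-elim (h ≡.refl)
      same false false h = ⊥-elim (h ≡.refl)
      same true  false h = ≤-resp (sym (trans (∙-negᵥ (unit i) (unit i)) (-‿cong (unit-∙-self i)))) refl -1≤0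
      same false true  h = ≤-resp (sym (trans (negᵥ-∙ (unit i) (unit i)) (-‿cong (unit-∙-self i)))) refl -1≤0

    exposing : ∀ k → ∃[ u ] Max x u k
    -- Up to sign the points are orthonormal, so each of them exposes itself.
    exposing k = x k , λ l l≢k → ≤-<-trans (point-other (lookup codes k) (lookup codes l) λ eq → l≢k
      (lookup-unique codes! eq))
      (<-resp refl (sym (point-self (lookup codes k))) 0<1)

    positive : ∀ i → ∃[ k ] x k ≋ 1# *ᵥ unit i
    positive i = let k , eq = ∈⇒lookup (∈-++⁺ˡ {ys = map (_, false) J} (∈-map⁺ (_, true) (∈-allFin i))) in
      k , λ c → trans (reflexive (≡.cong (λ a → point a c) eq)) (sym (*-identityˡ _))

    negative : ∃[ k ] x k ≋ negᵥ (1# *ᵥ unit j₀)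
    negative = let k , eq = ∈⇒lookup (∈-++⁺ʳ (map (_, true) (allFin d)) (∈-map⁺ (_, false) j₀∈)) in
      k , λ c → trans (reflexive (≡.cong (λ a → point a c) eq)) (*-congˡ (sym (*-identityˡ _)))

    isConfiguration : 2 ℕ.≤ length codes → StrictlyConvexConfiguration x
    isConfiguration 2≤n = configuration x 2≤n exposing
      (affinely-spanning x (λ h → 0≉1 (sym h)) (λ i → proj₁ (positive i)) (λ i → proj₂ (positive i)) j₀ (proj₁ negative)
        (proj₂ negative))

  initial : ∀ {d} e → e ℕ.≤ d → ∃[ J ] Unique {A = Fin d} J × length J ≡ e
  initial {d} e e≤d = map (λ i → Fin.inject≤ i e≤d) (allFin e) , Unique.map⁺ (Fin.inject≤-injective e≤d e≤d _ _)
    (Unique.allFin⁺ e) ,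
    ≡.trans (length-map _ (allFin e)) (length-allFin e)

  -- The minimum in (b) exists only if there is a configuration with `n` points: a cross-polytope
  -- without `2 d - n` of its negative vertices.
  saValues-nonempty : ∀ d n → 3 ℕ.≤ d → suc d ℕ.≤ n → n ℕ.≤ 2 ℕ.* d → ∃[ m ] saValues d n m
  saValues-nonempty d n 3≤d d<n n≤2d =
    let J , J! , len = initial {d} (n ℕ.∸ d) (ℕ.≤-trans (ℕ.∸-monoˡ-≤ d n≤2d)
          (ℕ.≤-reflexive (≡.trans (ℕ.m+n∸m≡n d (d ℕ.+ 0)) (ℕ.+-identityʳ d))))
    in build J J! (≡.trans (≡.cong (d ℕ.+_) len) (ℕ.m+[n∸m]≡n (ℕ.≤-trans (ℕ.n≤1+n d) d<n)))
         (nonempty J (≡.subst (1 ℕ.≤_) (≡.sym len) (ℕ.m<n⇒0<n∸m d<n)))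
    where
    nonempty : (xs : List (Fin d)) → 1 ℕ.≤ length xs → ∃[ j ] j ∈ xs
    nonempty (j ∷ _) _ = j , here ≡.refl
    build : ∀ J → Unique J → d ℕ.+ length J ≡ n → ∃[ j ] j ∈ J → ∃[ m ] saValues d n m
    build J J! len (j₀ , j₀∈) = ≡.subst (λ n → ∃[ m ] saValues d n m) (≡.trans length-codes len)
        (sa x , x , isConfiguration (ℕ.≤-trans (ℕ.≤-trans (ℕ.≤-trans (ℕ.n≤1+n 2) 3≤d) (ℕ.m≤m+n d (length J)))
          (ℕ.≤-reflexive (≡.sym length-codes))) , ≡.refl)
      where open PartialCross J J! j₀∈

-- Capped cross-polytopes with 2 d strictly antipodal pairs

module TruncatedCross (em : ExcludedMiddle 0ℓ) (ℝ : RealField) where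

  open Constructions em ℝ public

  two four : K
  two  = 1# + 1#
  four = 1# + (1# + (1# + 1#))

  module Coordinates (d : ℕ) (3≤d : 3 ℕ.≤ d) where

    dim N : K
    dim = sum {d} (λ _ → 1#)
    N   = dim - 1#

    2≤N : two ≤ N
    2≤N = bound d 3≤d
      where
      bound : ∀ d → 3 ℕ.≤ d → two ≤ sum {d} (λ _ → 1#) - 1#
      bound (suc (suc (suc d))) _ = by≤ (sum-nonnegative {d} {λ _ → 1#} (λ _ → <⇒≤ 0<1))
        (solve 1 (λ s → ((:1 :+ (:1 :+ (:1 :+ s))) :- :1) :- (:1 :+ :1) := s) refl (sum {d} (λ _ → 1#)))
      bound (suc zero) (s≤s ())
      bound (suc (suc zero)) (s≤s (s≤s ()))

    0<N : 0# < N
    0<N = <-≤-trans (0<+0< 0<1 0<1) 2≤N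

    1<N : 1# < N
    1<N = <-≤-trans (by< 0<1 (solve 0 ((:1 :+ :1) :- :1 := :1) refl)) 2≤N

    -- Here `N` is d - 1: `pt four i` is the unit vector times 4 (d - 1), and `pt 0# i` is the apex
    -- 4 (1, ..., 1). The apex has coordinate sum 4 d > 4 (d - 1), while with one or more signs
    -- changed the sum is at most 4 (d - 2); so it lies beyond a single facet.
    pt : K → Fin d → Point d
    pt β i = (four - β) *ᵥ (λ _ → 1#) +ᵥ (β * N) *ᵥ unit i

    -- The slope of `u ∙ pt β i` as a function of `β`. The signs of these slopes decide which points
    -- are extreme.
    ξ : Point d → Fin d → K
    ξ u i = N * u i - sum u

    pt-∙ : ∀ u β i → u ∙ pt β i ≈ four * sum u + β * ξ u i
    pt-∙ u β i = begin
      u ∙ pt β i                                                             ≈⟨ ∙-+ᵥ u _ _ ⟩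
      u ∙ ((four - β) *ᵥ (λ _ → 1#)) + u ∙ ((β * N) *ᵥ unit i)
        ≈⟨ +-cong (∙-*ᵥ (four - β) u (λ _ → 1#)) (∙-*ᵥ (β * N) u (unit i)) ⟩
      (four - β) * (u ∙ (λ _ → 1#)) + (β * N) * (u ∙ unit i)
        ≈⟨ +-cong (*-congˡ (sum-cong-≋ λ k → *-identityʳ (u k))) (*-congˡ (trans (∙-comm u (unit i)) (unit-∙ i u))) ⟩
      (four - β) * sum u + (β * N) * u i
        ≈⟨ solve 4 (λ b s n y → (con (+ 4) :- b) :* s :+ (b :* n) :* y := con (+ 4) :* s :+ b :* (n :* y :- s)) refl β
          (sum u) N (u i) ⟩
      four * sum u + β * ξ u i                                               ∎
      where open ≈-Reasoning

    sum-ξ : ∀ u → sum (ξ u) ≈ - sum u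
    sum-ξ u = begin
      sum (λ i → N * u i - sum u)
        ≈⟨ sum-cong-≋ (λ i → solve 3 (λ n y s → n :* y :- s := n :* y :+ :1 :* (:- s)) refl N (u i) (sum u)) ⟩
      sum (λ i → N * u i + 1# * - sum u)                           ≈⟨ ∑-distrib-+ (λ i → N * u i) (λ _ → 1# * - sum u) ⟩
      sum (λ i → N * u i) + sum {d} (λ _ → 1# * - sum u)
        ≈⟨ +-cong (sym (*-distribˡ-sum N u)) (sym (*-distribʳ-sum {d} (- sum u) (λ _ → 1#))) ⟩
      (dim - 1#) * sum u + dim * - sum u
        ≈⟨ solve 2 (λ n s → (n :- :1) :* s :+ n :* (:- s) := :- s) refl dim (sum u) ⟩
      - sum u                                                      ∎
      where open ≈-Reasoning

    term≤sum : ∀ {m} {f : Fin m → K} → (∀ i → 0# ≤ f i) → ∀ i → f i ≤ sum f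
    term≤sum {suc m} {f} h zero    = by≤ (sum-nonnegative (h ∘ suc))
      (solve 2 (λ x s → (x :+ s) :- x := s) refl (f zero) (sum (f ∘ suc)))
    term≤sum {suc m} {f} h (suc i) = ≤-trans (term≤sum (h ∘ suc) i)
      (by≤ (h zero) (solve 2 (λ x s → (x :+ s) :- s := x) refl (f zero) (sum (f ∘ suc))))

    -- The slopes add up to `- sum u`, so if all are negative none exceeds `sum u` in size.
    -ξ≤sum : ∀ {u} → (∀ i → ξ u i < 0#) → ∀ i → 0# ≤ sum u + ξ u i
    -ξ≤sum {u} neg i = ≤-resp refl (trans (+-congʳ sum-) (solve 2 (λ s x → s :- (:- x) := s :+ x) refl (sum u) (ξ u i)))
      (≤⇒0≤ (term≤sum {f = λ j → - ξ u j} (λ j → <⇒≤ (neg<0 (neg j))) i))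
      where
      sum- : sum (λ j → - ξ u j) ≈ sum u
      sum- = trans (sum-cong-≋ λ j → solve 1 (λ x → :- x := (:- :1) :* x) refl (ξ u j))
        (trans (sym (*-distribˡ-sum (- 1#) (ξ u)))
          (trans (*-congˡ (sum-ξ u)) (solve 1 (λ s → (:- :1) :* (:- s) := s) refl (sum u))))

    sum-linear : ∀ a b (u w : Point d) → sum (λ k → a * u k + b * w k) ≈ a * sum u + b * sum w
    sum-linear a b u w = trans (∑-distrib-+ (λ k → a * u k) (λ k → b * w k))
      (+-cong (sym (*-distribˡ-sum a u)) (sym (*-distribˡ-sum b w)))

    sum-unit : ∀ i → sum {d} (unit i) ≈ 1#
    sum-unit i = trans (sum-single i λ j → unit-off-diagonal) (unit-diagonal i)

    -- The points pt 4 i are the vertices of a cross-polytope.  The point (1,…,1),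
    -- scaled, lies beyond the facet pt 4 1, …, pt 4 d only, and pt β i moves from it
    -- to pt 4 i as β grows.  So one facet of the cross-polytope carries the cap
    -- spanned by the points r i and the opposite facet the one spanned by the p i,
    -- where the coefficients β on the two sides are proportional.
    module Caps {n : ℕ} (x : Fin n → Point d) (e⁺ e⁻ r p : Fin d → Fin n) (s : Fin d → K) (κ : K)
      (x-e⁺ : ∀ i → x (e⁺ i) ≋ pt four i) (x-e⁻ : ∀ i → x (e⁻ i) ≋ negᵥ (pt four i))
      (x-r : ∀ i → x (r i) ≋ pt (κ * s i) i) (x-p : ∀ i → x (p i) ≋ negᵥ (pt (s i) i))
      (cover : ∀ {P : Fin n → Set} → (∀ i → P (e⁺ i)) → (∀ i → P (e⁻ i)) → (∀ i → P (r i)) → (∀ i → P (p i)) → ∀ k →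
        P k)
      (2≤s : ∀ i → two ≤ s i) (s≤4 : ∀ i → s i ≤ four) (0≤κ : 0# ≤ κ) (κ<1 : κ < 1#)
      (p-e⁻ : ∀ i → p i ≡ e⁻ i ⊎ s i < four) (r-merged : ∀ i j → r i ≡ r j ⊎ 0# < κ) where

      V : Point d → K → Fin d → K
      V u β i = four * sum u + β * ξ u i

      e⁺-∙ : ∀ u i → u ∙ x (e⁺ i) ≈ V u four i
      e⁺-∙ u i = trans (∙-cong ≋-refl (x-e⁺ i)) (pt-∙ u four i)

      e⁻-∙ : ∀ u i → u ∙ x (e⁻ i) ≈ - V u four i
      e⁻-∙ u i = trans (∙-cong ≋-refl (x-e⁻ i)) (trans (∙-negᵥ u _) (-‿cong (pt-∙ u four i)))

      r-∙ : ∀ u i → u ∙ x (r i) ≈ V u (κ * s i) i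
      r-∙ u i = trans (∙-cong ≋-refl (x-r i)) (pt-∙ u (κ * s i) i)

      p-∙ : ∀ u i → u ∙ x (p i) ≈ - V u (s i) i
      p-∙ u i = trans (∙-cong ≋-refl (x-p i)) (trans (∙-negᵥ u _) (-‿cong (pt-∙ u (s i) i)))

      0≤s : ∀ i → 0# ≤ s i
      0≤s i = ≤-trans (<⇒≤ (0<+0< 0<1 0<1)) (2≤s i)

      0≤4 : 0# ≤ four
      0≤4 = <⇒≤ (0<+0< 0<1 (0<+0< 0<1 (0<+0< 0<1 0<1)))

      0<4 : 0# < four
      0<4 = 0<+0< 0<1 (0<+0< 0<1 (0<+0< 0<1 0<1))

      0≤κs : ∀ i → 0# ≤ κ * s i
      0≤κs i = 0≤*0≤ 0≤κ (0≤s i)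

      κs<4 : ∀ i → κ * s i < four
      κs<4 i = by< (0<+0≤ (0<*0< (<⇒0< κ<1) (<-≤-trans (0<+0< 0<1 0<1) (2≤s i))) (≤⇒0≤ (s≤4 i)))
        (solve 3 (λ f k s → f :- k :* s := (:1 :- k) :* s :+ (f :- s)) refl four κ (s i))

      record Coefficient (β : K) : Set where
        field
          0≤β : 0# ≤ β
          β≤4 : β ≤ four

      coefficient-4 : Coefficient four
      coefficient-4 = record { 0≤β = 0≤4 ; β≤4 = ≤-refl }

      coefficient-s : ∀ i → Coefficient (s i)
      coefficient-s i = record { 0≤β = 0≤s i ; β≤4 = s≤4 i }

      coefficient-κs : ∀ i → Coefficient (κ * s i)
      coefficient-κs i = record { 0≤β = 0≤κs i ; β≤4 = <⇒≤ (κs<4 i) }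

      all-≤ : ∀ {u b} → (∀ i → V u four i ≤ b) → (∀ i → V u (κ * s i) i ≤ b) →
        (∀ i {β} → Coefficient β → - V u β i ≤ b) →
        ∀ k → u ∙ x k ≤ b
      all-≤ {u} {b} h⁺ hr h⁻ = cover (λ i → ≤-resp (sym (e⁺-∙ u i)) refl (h⁺ i))
        (λ i → ≤-resp (sym (e⁻-∙ u i)) refl (h⁻ i coefficient-4))
        (λ i → ≤-resp (sym (r-∙ u i)) refl (hr i)) (λ i → ≤-resp (sym (p-∙ u i)) refl (h⁻ i (coefficient-s i)))

      all-≥ : ∀ {u b} → (∀ i {β} → Coefficient β → b ≤ V u β i) → (∀ i → b ≤ - V u four i) → (∀ i → b ≤ - V u (s i) i) →
        ∀ k → b ≤ u ∙ x k
      all-≥ {u} {b} h⁺ h⁻ hp = cover (λ i → ≤-resp refl (sym (e⁺-∙ u i)) (h⁺ i coefficient-4))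
        (λ i → ≤-resp refl (sym (e⁻-∙ u i)) (h⁻ i))
        (λ i → ≤-resp refl (sym (r-∙ u i)) (h⁺ i (coefficient-κs i))) (λ i → ≤-resp refl (sym (p-∙ u i)) (hp i))

      max-unique : ∀ {u a t} → Max x u a → (∀ k → u ∙ x k ≤ u ∙ x t) → a ≡ t
      max-unique {a = a} {t} max top-t = by-contradiction λ a≢t → max t (a≢t ∘ ≡.sym) (top-t a)

      min-unique : ∀ {u a t} → Min x u a → (∀ k → u ∙ x t ≤ u ∙ x k) → a ≡ t
      min-unique {a = a} {t} min bot-t = by-contradiction λ a≢t → min t (a≢t ∘ ≡.sym) (bot-t a)

      attains-max : ∀ {u a t} b → Max x u a → u ∙ x t ≈ b → (∀ k → u ∙ x k ≤ b) → a ≡ t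
      attains-max {u} {a} {t} b max eq below = max-unique {u} {a} {t} max λ k → ≤-trans (below k) (≤-reflexive (sym eq))

      attains-min : ∀ {u a t} b → Min x u a → u ∙ x t ≈ b → (∀ k → b ≤ u ∙ x k) → a ≡ t
      attains-min {u} {a} {t} b min eq above = min-unique {u} {a} {t} min λ k → ≤-trans (≤-reflexive eq) (above k)

      Listed : Fin n → Fin n → Set
      Listed a b = ∃[ i ] ((a ≡ e⁺ i × b ≡ e⁻ i) ⊎ (a ≡ e⁻ i × b ≡ e⁺ i) ⊎ (a ≡ r i × b ≡ p i) ⊎ (a ≡ p i × b ≡ r i))

      some : Fin d
      some = first-index d 3≤d
        where
        first-index : ∀ d → 3 ℕ.≤ d → Fin d
        first-index (suc d) _ = zero

      -- The values are `4 sum u + κ s i ξ i` at `r i` and `- (4 sum u + s i ξ i)` at `p i`. Because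
      -- the coefficients are proportional, the index with the largest `s i * ξ u i` gives the
      -- maximum on one cap and the minimum on the other, so that `r i` is paired with `p i` only.
      negative-case : ∀ {u a b} → (∀ i → ξ u i < 0#) → Max x u a → Min x u b → ∃[ i ] a ≡ r i × b ≡ p i
      negative-case {u} {a} {b} neg max min = at (argmax (λ i → s i * ξ u i) (allFin d) (∈-allFin some))
        where
        at : (∃[ i ] i ∈ allFin d × (∀ {j} → j ∈ allFin d → s j * ξ u j ≤ s i * ξ u i)) → ∃[ i ] a ≡ r i × b ≡ p i
        at (i , _ , best) = i ,
            attains-max {u} {a} (V u (κ * s i) i) max (r-∙ u i)
              (all-≤ {u} {V u (κ * s i) i} upper-e upper-r (λ j {β} c → opposite-sides j {β} c (coefficient-κs i))) ,
            attains-min {u} {b} (- V u (s i) i) min (p-∙ u i)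
              (all-≥ {u} { - V u (s i) i} (λ j {β} c → opposite-sides i (coefficient-s i) c) lower-e lower-p)
          where
          0≤-ξ : ∀ j → 0# ≤ - ξ u j
          0≤-ξ j = <⇒≤ (neg<0 (neg j))
          best′ : ∀ j → 0# ≤ s i * ξ u i - s j * ξ u j
          best′ j = ≤⇒0≤ (best (∈-allFin j))
          upper-e : ∀ j → V u four j ≤ V u (κ * s i) i
          upper-e j = by≤ (0≤+0≤ (0≤*0≤ 0≤κ (best′ j)) (0≤*0≤ (≤⇒0≤ (<⇒≤ (κs<4 j))) (0≤-ξ j)))
            (solve 7 (λ S f k si xi sj xj → (f :* S :+ (k :* si) :* xi) :- (f :* S :+ f :* xj) := k :*
              (si :* xi :- sj :* xj) :+ (f :- k :* sj) :* (:- xj))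
              refl (sum u) four κ (s i) (ξ u i) (s j) (ξ u j))
          upper-r : ∀ j → V u (κ * s j) j ≤ V u (κ * s i) i
          upper-r j = by≤ (0≤*0≤ 0≤κ (best′ j))
            (solve 7 (λ S f k si xi sj xj → (f :* S :+ (k :* si) :* xi) :- (f :* S :+ (k :* sj) :* xj) := k :*
              (si :* xi :- sj :* xj))
              refl (sum u) four κ (s i) (ξ u i) (s j) (ξ u j))
          opposite-sides : ∀ j {β} → Coefficient β → ∀ {γ l} → Coefficient γ → - V u β j ≤ V u γ l
          opposite-sides j {β} cβ {γ} {l} cγ = by≤
            (0≤+0≤ (0≤+0≤ (0≤*0≤ 0≤4 (-ξ≤sum {u} neg j)) (0≤*0≤ 0≤4 (-ξ≤sum {u} neg l)))
              (0≤+0≤ (0≤*0≤ (≤⇒0≤ (Coefficient.β≤4 cβ)) (0≤-ξ j)) (0≤*0≤ (≤⇒0≤ (Coefficient.β≤4 cγ)) (0≤-ξ l))))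
            (solve 6 (λ S f b xj g xl → (f :* S :+ g :* xl) :- (:- (f :* S :+ b :* xj)) :=
              (f :* (S :+ xj) :+ f :* (S :+ xl)) :+ ((f :- b) :* (:- xj) :+ (f :- g) :* (:- xl)))
              refl (sum u) four β (ξ u j) γ (ξ u l))
          lower-e : ∀ j → - V u (s i) i ≤ - V u four j
          lower-e j = by≤ (0≤+0≤ (best′ j) (0≤*0≤ (≤⇒0≤ (s≤4 j)) (0≤-ξ j)))
            (solve 6 (λ S f si xi sj xj → (:- (f :* S :+ f :* xj)) :- (:- (f :* S :+ si :* xi)) :=
              (si :* xi :- sj :* xj) :+ (f :- sj) :* (:- xj))
              refl (sum u) four (s i) (ξ u i) (s j) (ξ u j))
          lower-p : ∀ j → - V u (s i) i ≤ - V u (s j) j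
          lower-p j = by≤ (best′ j)
            (solve 6 (λ S f si xi sj xj → (:- (f :* S :+ sj :* xj)) :- (:- (f :* S :+ si :* xi)) := si :* xi :- sj
              :* xj)
              refl (sum u) four (s i) (ξ u i) (s j) (ξ u j))

      -- If the largest slope is nonnegative and the smallest nonpositive, the extremes of
      -- `4 sum u + β ξ` over all indices occur at `β = 4`, that is, at vertices of the
      -- cross-polytope.
      mixed-case : ∀ {u a b} i j → (∀ k → ξ u k ≤ ξ u i) → (∀ k → ξ u j ≤ ξ u k) → 0# ≤ ξ u i → ξ u j ≤ 0# →
        Max x u a → Min x u b → (a ≡ e⁺ i × b ≡ e⁻ i) ⊎ (a ≡ e⁻ j × b ≡ e⁺ j)
      mixed-case {u} {a} {b} i j high low 0≤M μ≤0 max min = case total (- V u four j) (V u four i) of λ where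
          (inj₁ h) → inj₁ (
            attains-max {u} {a} {e⁺ i} (V u four i) max (e⁺-∙ u i)
              (all-≤ {u} {V u four i} upper-4 upper-κs (below-high h)) ,
            attains-min {u} {b} {e⁻ i} (- V u four i) min (e⁻-∙ u i)
              (all-≥ {u} { - V u four i} (above-low h) flip-4 flip-s))
          (inj₂ h) → inj₂ (
            attains-max {u} {a} {e⁻ j} (- V u four j) max (e⁻-∙ u j) (all-≤ {u} { - V u four j}
              (λ k → ≤-trans (upper-4 k) h) (λ k → ≤-trans (upper-κs k) h) flip-lower) ,
            attains-min {u} {b} {e⁺ j} (V u four j) min (e⁺-∙ u j) (all-≥ {u} {V u four j} lower
              (λ k → ≤-trans (flip″ {V u four i} {V u four j} h) (flip-4 k))
                (λ k → ≤-trans (flip″ {V u four i} {V u four j} h) (flip-s k))))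
        where
        flip : ∀ {y z} → y ≤ z → - z ≤ - y
        flip {y} {z} h = by≤ (≤⇒0≤ h) (solve 2 (λ y z → (:- y) :- (:- z) := z :- y) refl y z)
        flip′ : ∀ {y z} → - y ≤ z → - z ≤ y
        flip′ {y} {z} h = by≤ (≤⇒0≤ h) (solve 2 (λ y z → y :- (:- z) := z :- (:- y)) refl y z)
        flip″ : ∀ {y z} → y ≤ - z → z ≤ - y
        flip″ {y} {z} h = by≤ (≤⇒0≤ h) (solve 2 (λ y z → (:- y) :- z := (:- z) :- y) refl y z)
        upper : ∀ k {β} → Coefficient β → V u β k ≤ V u four i
        upper k {β} c = by≤ (0≤+0≤ (0≤*0≤ (Coefficient.0≤β c) (≤⇒0≤ (high k))) (0≤*0≤ (≤⇒0≤ (Coefficient.β≤4 c)) 0≤M))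
          (solve 5 (λ S f b xk xi → (f :* S :+ f :* xi) :- (f :* S :+ b :* xk) := b :* (xi :- xk) :+ (f :- b) :* xi)
            refl (sum u) four β (ξ u k) (ξ u i))
        lower : ∀ k {β} → Coefficient β → V u four j ≤ V u β k
        lower k {β} c = by≤ (0≤+0≤ (0≤*0≤ (Coefficient.0≤β c) (≤⇒0≤ (low k)))
          (0≤*0≤ (≤⇒0≤ (Coefficient.β≤4 c)) (neg≤0 μ≤0)))
          (solve 5 (λ S f b xk xj → (f :* S :+ b :* xk) :- (f :* S :+ f :* xj) := b :* (xk :- xj) :+ (f :- b) :*
            (:- xj)) refl (sum u) four β (ξ u k) (ξ u j))
        upper-4 : ∀ k → V u four k ≤ V u four i
        upper-4 k = upper k {four} coefficient-4
        upper-κs : ∀ k → V u (κ * s k) k ≤ V u four i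
        upper-κs k = upper k {κ * s k} (coefficient-κs k)
        flip-4 : ∀ k → - V u four i ≤ - V u four k
        flip-4 k = flip {V u four k} {V u four i} (upper-4 k)
        flip-s : ∀ k → - V u four i ≤ - V u (s k) k
        flip-s k = flip {V u (s k) k} {V u four i} (upper k {s k} (coefficient-s k))
        flip-lower : ∀ k {β} → Coefficient β → - V u β k ≤ - V u four j
        flip-lower k {β} c = flip {V u four j} {V u β k} (lower k {β} c)
        below-high : - V u four j ≤ V u four i → ∀ k {β} → Coefficient β → - V u β k ≤ V u four i
        below-high h k {β} c = ≤-trans { - V u β k} { - V u four j} {V u four i} (flip-lower k {β} c) h
        above-low : - V u four j ≤ V u four i → ∀ k {β} → Coefficient β → - V u four i ≤ V u β k
        above-low h k {β} c = ≤-trans { - V u four i} {V u four j} {V u β k} (flip′ {V u four j} {V u four i} h)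
          (lower k {β} c)

      ξ-negᵥ : ∀ u i → ξ (negᵥ u) i ≈ - ξ u i
      ξ-negᵥ u i = trans (+-congˡ (-‿cong (sym (*-distribˡ-sum (- 1#) u))))
        (solve 3 (λ n y s → n :* ((:- :1) :* y) :- (:- :1) :* s := :- (n :* y :- s)) refl N (u i) (sum u))

      listed : ∀ {u a b} → Max x u a → Min x u b → Listed a b
      listed {u} {a} {b} max min = split (argmax (ξ u) (allFin d) (∈-allFin some))
        (argmin (ξ u) (allFin d) (∈-allFin some))
        where
        downward : (∃[ i ] a ≡ r i × b ≡ p i) → Listed a b
        downward (i , h) = i , inj₂ (inj₂ (inj₁ h))
        upward : (∃[ i ] b ≡ r i × a ≡ p i) → Listed a b
        upward (i , b≡ , a≡) = i , inj₂ (inj₂ (inj₂ (a≡ , b≡)))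
        sideways : ∀ {i j} → (a ≡ e⁺ i × b ≡ e⁻ i) ⊎ (a ≡ e⁻ j × b ≡ e⁺ j) → Listed a b
        sideways {i} (inj₁ h) = i , inj₁ h
        sideways {j = j} (inj₂ h) = j , inj₂ (inj₁ h)
        negated : (∀ k → 0# < ξ u k) → ∀ k → ξ (negᵥ u) k < 0#
        negated pos k = <-resp (sym (ξ-negᵥ u k)) refl (by< (pos k) (solve 1 (λ x → :0 :- (:- x) := x) refl (ξ u k)))
        split : (∃[ i ] i ∈ allFin d × (∀ {k} → k ∈ allFin d → ξ u k ≤ ξ u i)) →
          (∃[ j ] j ∈ allFin d × (∀ {k} → k ∈ allFin d → ξ u j ≤ ξ u k)) → Listed a b
        split (i , _ , high) (j , _ , low) = case ≤-<-connex 0# (ξ u i) of λ where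
          (inj₂ M<0) → downward (negative-case {u} {a} {b} (λ k → ≤-<-trans (high (∈-allFin k)) M<0) max min)
          (inj₁ 0≤M) → case ≤-<-connex (ξ u j) 0# of λ where
            (inj₁ μ≤0) → sideways (mixed-case {u} {a} {b} i j (λ k → high (∈-allFin k)) (λ k → low (∈-allFin k)) 0≤M μ≤0
              max min)
            (inj₂ 0<μ) → upward (negative-case {negᵥ u} {b} {a} (negated λ k → <-≤-trans 0<μ (low (∈-allFin k)))
                           (neg-min x {u} {b} min) (neg-max x {u} {a} max))

      sa≤2d : (∀ {i j} → x i ≋ x j → i ≡ j) → sa x ℕ.≤ d ℕ.* 2
      sa≤2d distinct = begin
          length pairs
            ≤⟨ length-injection Key keys pairs!
              (λ {ab} ab∈ → key (strict-functional x distinct {proj₁ ab} {proj₂ ab} (proj₂ (pairs⇒ ab∈))))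
              (λ {ab} {ab′} {c} ab∈ ab∈′ → same c (proj₁ (pairs⇒ ab∈)) (proj₁ (pairs⇒ ab∈′))) ⟩
          length keys        ≡⟨ length-cartesianProduct (allFin d) _ ⟩
          length (allFin d) ℕ.* 2 ≡⟨ ≡.cong (ℕ._* 2) (length-allFin d) ⟩
          d ℕ.* 2            ∎
        where
        open ℕ.≤-Reasoning
        open AntipodalPairs x
        keys : List (Fin d × Bool)
        keys = cartesianProduct (allFin d) (true ∷ false ∷ [])
        left right : Fin d × Bool → Fin n
        left  (i , true)  = e⁺ i
        left  (i , false) = r i
        right (i , true)  = e⁻ i
        right (i , false) = p i
        Key : Fin n × Fin n → Fin d × Bool → Set
        Key (a , b) c = (a ≡ left c × b ≡ right c) ⊎ (a ≡ right c × b ≡ left c)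
        ∈keys : ∀ c → c ∈ keys
        ∈keys (i , true)  = ∈-cartesianProduct⁺ (∈-allFin i) (here ≡.refl)
        ∈keys (i , false) = ∈-cartesianProduct⁺ (∈-allFin i) (there (here ≡.refl))
        key : ∀ {ab} → (∃[ u ] Max x u (proj₁ ab) × Min x u (proj₂ ab)) → ∃[ c ] c ∈ keys × Key ab c
        key {a , b} (u , max , min) = locate (listed {u} {a} {b} max min)
          where
          locate : Listed a b → ∃[ c ] c ∈ keys × Key (a , b) c
          locate (i , inj₁ h)               = (i , true) , ∈keys _ , inj₁ h
          locate (i , inj₂ (inj₁ h))        = (i , true) , ∈keys _ , inj₂ h
          locate (i , inj₂ (inj₂ (inj₁ h))) = (i , false) , ∈keys _ , inj₁ h
          locate (i , inj₂ (inj₂ (inj₂ h))) = (i , false) , ∈keys _ , inj₂ h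
        same : ∀ c {ab ab′} → proj₁ ab Fin.< proj₂ ab → proj₁ ab′ Fin.< proj₂ ab′ → Key ab c → Key ab′ c → ab ≡ ab′
        same c _   _   (inj₁ (≡.refl , ≡.refl)) (inj₁ (≡.refl , ≡.refl)) = ≡.refl
        same c _   _   (inj₂ (≡.refl , ≡.refl)) (inj₂ (≡.refl , ≡.refl)) = ≡.refl
        same c a<b b<a (inj₁ (≡.refl , ≡.refl)) (inj₂ (≡.refl , ≡.refl)) = ⊥-elim (Fin.<-asym a<b b<a)
        same c a<b b<a (inj₂ (≡.refl , ≡.refl)) (inj₁ (≡.refl , ≡.refl)) = ⊥-elim (Fin.<-asym a<b b<a)

      private
        0<N-1 : 0# < N - 1#
        0<N-1 = <⇒0< 1<N

        V-unit-on : ∀ i β → V (unit i) β i ≈ four + β * (N - 1#)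
        V-unit-on i β = trans (+-cong (*-congˡ (sum-unit i))
          (*-congˡ (+-cong (*-congˡ (unit-diagonal i)) (-‿cong (sum-unit i)))))
          (solve 2 (λ b n → con (+ 4) :* :1 :+ b :* (n :* :1 :- :1) := con (+ 4) :+ b :* (n :- :1)) refl β N)

        V-unit-off : ∀ {i j} β → j ≢ i → V (unit i) β j ≈ four - β
        V-unit-off {i} {j} β j≢i = trans (+-cong (*-congˡ (sum-unit i))
          (*-congˡ (+-cong (*-congˡ (unit-off-diagonal j≢i)) (-‿cong (sum-unit i)))))
          (solve 2 (λ b n → con (+ 4) :* :1 :+ b :* (n :* :0 :- :1) := con (+ 4) :- b) refl β N)

        unit-below : ∀ {i j β} → Coefficient β → (j ≢ i ⊎ β < four) → V (unit i) β j < four * N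
        unit-below {i} {j} {β} c h = case j Fin.≟ i of λ where
            (no j≢i)     → by< (0<+0≤ (0<*0< 0<4 0<N-1) (Coefficient.0≤β c))
              (trans (+-congˡ (-‿cong (V-unit-off β j≢i)))
              (solve 2 (λ b n → con (+ 4) :* n :- (con (+ 4) :- b) := con (+ 4) :* (n :- :1) :+ b) refl β N))
            (yes ≡.refl) → by< (0<*0< (<⇒0< (strict h)) 0<N-1) (trans (+-congˡ (-‿cong (V-unit-on i β)))
              (solve 2 (λ b n → con (+ 4) :* n :- (con (+ 4) :+ b :* (n :- :1)) := (con (+ 4) :- b) :* (n :- :1)) refl β
                N))
          where
          strict : ∀ {i} → (i ≢ i ⊎ β < four) → β < four
          strict (inj₁ i≢i) = ⊥-elim (i≢i ≡.refl)
          strict (inj₂ h)   = h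

        unit-above : ∀ {i j β} → Coefficient β → - V (unit i) β j < four * N
        unit-above {i} {j} {β} c = case j Fin.≟ i of λ where
          (no j≢i)     → by< (0<+0≤ (0<*0< 0<4 0<N) (≤⇒0≤ (Coefficient.β≤4 c)))
            (trans (+-congˡ (-‿cong (-‿cong (V-unit-off β j≢i))))
            (solve 2 (λ b n → con (+ 4) :* n :- (:- (con (+ 4) :- b)) := con (+ 4) :* n :+ (con (+ 4) :- b)) refl β N))
          (yes ≡.refl) → by< (0<+0≤ (0<+0< (0<*0< 0<4 0<N) 0<4) (0≤*0≤ (Coefficient.0≤β c) (<⇒≤ 0<N-1)))
            (trans (+-congˡ (-‿cong (-‿cong (V-unit-on i β))))
            (solve 2 (λ b n → con (+ 4) :* n :- (:- (con (+ 4) :+ b :* (n :- :1))) := (con (+ 4) :* n :+ con (+ 4)) :+ b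
              :* (n :- :1)) refl β N))

        max-by : ∀ {u t} b → u ∙ x t ≈ b → (∀ k → k ≢ t → u ∙ x k < b) → Max x u t
        max-by b eq below k k≢t = <-resp refl (sym eq) (below k k≢t)

        V-4N : ∀ i → V (unit i) four i ≈ four * N
        V-4N i = trans (V-unit-on i four) (solve 1 (λ n → con (+ 4) :+ con (+ 4) :* (n :- :1) := con (+ 4) :* n) refl N)

        neg-e⁺ : ∀ u i → negᵥ u ∙ x (e⁺ i) ≈ - V u four i
        neg-e⁺ u i = trans (negᵥ-∙ u _) (-‿cong (e⁺-∙ u i))
        neg-e⁻ : ∀ u i → negᵥ u ∙ x (e⁻ i) ≈ V u four i
        neg-e⁻ u i = trans (negᵥ-∙ u _) (trans (-‿cong (e⁻-∙ u i)) (-‿involutive _))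
        neg-r : ∀ u i → negᵥ u ∙ x (r i) ≈ - V u (κ * s i) i
        neg-r u i = trans (negᵥ-∙ u _) (-‿cong (r-∙ u i))
        neg-p : ∀ u i → negᵥ u ∙ x (p i) ≈ V u (s i) i
        neg-p u i = trans (negᵥ-∙ u _) (trans (-‿cong (p-∙ u i)) (-‿involutive _))

      exposing-e⁺ : ∀ i → ∃[ u ] Max x u (e⁺ i)
      exposing-e⁺ i = unit i , max-by {unit i} {e⁺ i} (four * N) (trans (e⁺-∙ (unit i) i) (V-4N i))
        (cover {λ k → k ≢ e⁺ i → unit i ∙ x k < four * N}
          (λ j ≢ → <-resp (sym (e⁺-∙ (unit i) j)) refl
            (unit-below {i} {j} coefficient-4 (inj₁ λ { ≡.refl → ≢ ≡.refl })))
          (λ j _ → <-resp (sym (e⁻-∙ (unit i) j)) refl (unit-above {i} {j} coefficient-4))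
          (λ j _ → <-resp (sym (r-∙ (unit i) j)) refl (unit-below {i} {j} (coefficient-κs j) (inj₂ (κs<4 j))))
          (λ j _ → <-resp (sym (p-∙ (unit i) j)) refl (unit-above {i} {j} (coefficient-s j))))

      exposing-e⁻ : ∀ i → ∃[ u ] Max x u (e⁻ i)
      exposing-e⁻ i = negᵥ (unit i) , max-by {negᵥ (unit i)} {e⁻ i} (four * N) (trans (neg-e⁻ (unit i) i) (V-4N i))
        (cover {λ k → k ≢ e⁻ i → negᵥ (unit i) ∙ x k < four * N}
          (λ j _ → <-resp (sym (neg-e⁺ (unit i) j)) refl (unit-above {i} {j} coefficient-4))
          (λ j ≢ → <-resp (sym (neg-e⁻ (unit i) j)) refl
            (unit-below {i} {j} coefficient-4 (inj₁ λ { ≡.refl → ≢ ≡.refl })))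
          (λ j _ → <-resp (sym (neg-r (unit i) j)) refl (unit-above {i} {j} (coefficient-κs j)))
          (λ j ≢ → <-resp (sym (neg-p (unit i) j)) refl (unit-below {i} {j} (coefficient-s j) (off j ≢))))
        where
        off : ∀ j → p j ≢ e⁻ i → j ≢ i ⊎ s j < four
        off j ≢ = case p-e⁻ j of λ where
          (inj₁ eq) → inj₁ λ { ≡.refl → ≢ eq }
          (inj₂ h)  → inj₂ h

      private
        module _ (i : Fin d) where

          -- The coefficients are solved for so that the slope at `i` is `- N` and the others are
          -- `- 4 N`. The factor 4 lets `i` win against every other `j`: all `s` lie between 2 and
          -- 4, so that `s i < four * s j`.
          tilted : Point d
          tilted k = (four * N - (1# + two)) * 1# + (1# + two) * unit i k

          total-tilted : sum tilted ≈ four * (N * N) + N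
          total-tilted = trans (sum-linear (four * N - (1# + two)) (1# + two) (λ _ → 1#) (unit i))
            (trans (+-congˡ (*-congˡ (sum-unit i)))
            (solve 1 (λ D → (con (+ 4) :* (D :- :1) :- (:1 :+ con (+ 2))) :* D :+ (:1 :+ con (+ 2)) :* :1 := con
              (+ 4) :* ((D :- :1) :* (D :- :1)) :+ (D :- :1)) refl dim))

          ξ-on : ξ tilted i ≈ - N
          ξ-on = trans (+-cong (*-congˡ (+-congˡ (*-congˡ (unit-diagonal i)))) (-‿cong total-tilted))
            (solve 1 (λ n → n :* ((con (+ 4) :* n :- (:1 :+ con (+ 2))) :* :1 :+ (:1 :+ con (+ 2)) :* :1) :-
              (con (+ 4) :* (n :* n) :+ n) := :- n) refl N)

          ξ-off : ∀ {j} → j ≢ i → ξ tilted j ≈ - (four * N)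
          ξ-off j≢i = trans (+-cong (*-congˡ (+-congˡ (*-congˡ (unit-off-diagonal j≢i)))) (-‿cong total-tilted))
            (solve 1 (λ n → n :* ((con (+ 4) :* n :- (:1 :+ con (+ 2))) :* :1 :+ (:1 :+ con (+ 2)) :* :0) :-
              (con (+ 4) :* (n :* n) :+ n) := :- (con (+ 4) :* n)) refl N)

          target : K → K
          target τ = four * sum tilted - τ * N

          V-on : ∀ β → V tilted β i ≈ target β
          V-on β = trans (+-congˡ (*-congˡ ξ-on))
            (solve 3 (λ s b n → s :+ b :* (:- n) := s :- b :* n) refl (four * sum tilted) β N)

          V-off : ∀ {j} β → j ≢ i → V tilted β j ≈ target (four * β)
          V-off β j≢i = trans (+-congˡ (*-congˡ (ξ-off j≢i)))
            (solve 3 (λ s b n → s :+ b :* (:- (con (+ 4) :* n)) := s :- (con (+ 4) :* b) :* n) refl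
            (four * sum tilted) β N)

          target-mono : ∀ {τ β} → τ < β → target β < target τ
          target-mono {τ} {β} τ<β = by< (0<*0< (<⇒0< τ<β) 0<N)
            (solve 4 (λ s t b n → (s :- t :* n) :- (s :- b :* n) := (b :- t) :* n) refl (four * sum tilted) τ β N)

          tilted-below : ∀ {τ j β} → (j ≡ i → τ < β) → (j ≢ i → τ < four * β) → V tilted β j < target τ
          tilted-below {τ} {j} {β} on off = case j Fin.≟ i of λ where
            (yes ≡.refl) → <-resp (sym (V-on β)) refl (target-mono (on ≡.refl))
            (no j≢i)     → <-resp (sym (V-off β j≢i)) refl (target-mono (off j≢i))

          opposite-target : ∀ {τ β} → τ < four → β ≤ four * four → - target β < target τ
          opposite-target {τ} {β} τ<4 β≤16 = by< (0<+0< (0<+0≤ (0<*0< (<⇒0< τ<4) 0<N) (0≤*0≤ (≤⇒0≤ β≤16) (<⇒≤ 0<N)))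
              (0<+0< (0<*0< (0<*0< 0<32 0<N) 0<N-1) (0<*0< 0<20 0<N)))
            (trans (+-cong (+-congʳ (*-congˡ total-tilted)) (-‿cong (-‿cong (+-congʳ (*-congˡ total-tilted)))))
              (solve 3 (λ t b n → (con (+ 4) :* (con (+ 4) :* (n :* n) :+ n) :- t :* n) :-
                (:- (con (+ 4) :* (con (+ 4) :* (n :* n) :+ n) :- b :* n)) :=
                ((con (+ 4) :- t) :* n :+ (con (+ 4) :* con (+ 4) :- b) :* n) :+
                  ((con (+ 4) :* con (+ 4) :* con (+ 2)) :* n :* (n :- :1) :+ (con (+ 4) :* con (+ 4) :+ con (+ 4))
                  :* n)) refl τ β N))
            where
            0<32 : 0# < four * four * two
            0<32 = 0<*0< (0<*0< 0<4 0<4) (0<+0< 0<1 0<1)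
            0<20 : 0# < four * four + four
            0<20 = 0<+0< (0<*0< 0<4 0<4) 0<4

          tilted-above : ∀ {τ j β} → τ < four → Coefficient β → - V tilted β j < target τ
          tilted-above {τ} {j} {β} τ<4 c = case j Fin.≟ i of λ where
              (yes ≡.refl) → <-resp (-‿cong (sym (V-on β))) refl
                (opposite-target τ<4 (≤-trans (Coefficient.β≤4 c) 4≤16))
              (no j≢i)     → <-resp (-‿cong (sym (V-off β j≢i))) refl (opposite-target τ<4
                (by≤ (0≤*0≤ 0≤4 (≤⇒0≤ (Coefficient.β≤4 c)))
                  (solve 2 (λ f b → f :* f :- f :* b := f :* (f :- b)) refl four β)))
            where
            4≤16 : four ≤ four * four
            4≤16 = by≤ (0≤*0≤ 0≤4 (0≤+0≤ (<⇒≤ 0<1) (0≤+0≤ (<⇒≤ 0<1) (<⇒≤ 0<1))))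
              (solve 0 (con (+ 4) :* con (+ 4) :- con (+ 4) := con (+ 4) :* (:1 :+ (:1 :+ :1))) refl)

          <16 : ∀ {τ} → τ < four → τ < four * four
          <16 {τ} τ<4 = <-≤-trans τ<4 (by≤ (0≤*0≤ 0≤4 (0≤+0≤ (<⇒≤ 0<1) (0≤+0≤ (<⇒≤ 0<1) (<⇒≤ 0<1))))
            (solve 0 (con (+ 4) :* con (+ 4) :- con (+ 4) := con (+ 4) :* (:1 :+ (:1 :+ :1))) refl))

          s<4s : ∀ j → s i < four * s j
          s<4s j = by< (0<+0≤ (0<+0≤ 0<4 (0≤*0≤ 0≤4 (≤⇒0≤ (2≤s j)))) (≤⇒0≤ (s≤4 i)))
            (solve 2 (λ si sj → con (+ 4) :* sj :- si := (con (+ 4) :+ con (+ 4) :* (sj :- con (+ 2))) :+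
              (con (+ 4) :- si)) refl (s i) (s j))

      exposing-r : ∀ i → ∃[ u ] Max x u (r i)
      exposing-r i = tilted i , max-by {tilted i} {r i} (target i (κ * s i))
        (trans (r-∙ (tilted i) i) (V-on i (κ * s i)))
        (cover {λ k → k ≢ r i → tilted i ∙ x k < target i (κ * s i)}
          (λ j _ → <-resp (sym (e⁺-∙ (tilted i) j)) refl (tilted-below i (λ _ → κs<4 i) (λ _ → <16 i (κs<4 i))))
          (λ j _ → <-resp (sym (e⁻-∙ (tilted i) j)) refl (tilted-above i (κs<4 i) coefficient-4))
          (λ j ≢ → <-resp (sym (r-∙ (tilted i) j)) refl
            (tilted-below i (λ { ≡.refl → ⊥-elim (≢ ≡.refl) }) (λ _ → proportional-s j ≢)))
          (λ j _ → <-resp (sym (p-∙ (tilted i) j)) refl (tilted-above i (κs<4 i) (coefficient-s j))))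
        where
        proportional-s : ∀ j → r j ≢ r i → κ * s i < four * (κ * s j)
        proportional-s j ≢ = case r-merged j i of λ where
          (inj₁ eq)  → ⊥-elim (≢ eq)
          (inj₂ 0<κ) → by< (0<*0< 0<κ (<⇒0< (s<4s i j)))
            (solve 4 (λ f k si sj → f :* (k :* sj) :- k :* si := k :* (f :* sj :- si)) refl four κ (s i) (s j))

      exposing-p : ∀ i → ∃[ u ] Max x u (p i)
      exposing-p i = case p-e⁻ i of λ where
        (inj₁ eq)  → ≡.subst (λ k → ∃[ u ] Max x u k) (≡.sym eq) (exposing-e⁻ i)
        (inj₂ s<4) → negᵥ (tilted i) , max-by {negᵥ (tilted i)} {p i} (target i (s i))
          (trans (neg-p (tilted i) i) (V-on i (s i)))
          (cover {λ k → k ≢ p i → negᵥ (tilted i) ∙ x k < target i (s i)}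
            (λ j _ → <-resp (sym (neg-e⁺ (tilted i) j)) refl (tilted-above i s<4 coefficient-4))
            (λ j _ → <-resp (sym (neg-e⁻ (tilted i) j)) refl (tilted-below i (λ _ → s<4) (λ _ → <16 i s<4)))
            (λ j _ → <-resp (sym (neg-r (tilted i) j)) refl (tilted-above i s<4 (coefficient-κs j)))
            (λ j ≢ → <-resp (sym (neg-p (tilted i) j)) refl
              (tilted-below i (λ { ≡.refl → ⊥-elim (≢ ≡.refl) }) (λ _ → s<4s i j))))

      capped-configuration : 2 ℕ.≤ n → StrictlyConvexConfiguration x
      capped-configuration 2≤n = configuration x 2≤n (cover exposing-e⁺ exposing-e⁻ exposing-r exposing-p)
        (affinely-spanning x (0<⇒≉0 (0<*0< 0<4 0<N)) e⁺ (λ i → ≋-trans (x-e⁺ i) (pt-4 i)) some (e⁻ some)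
          (≋-trans (x-e⁻ some) (λ k → *-congˡ (pt-4 some k))))
        where
        pt-4 : ∀ i → pt four i ≋ (four * N) *ᵥ unit i
        pt-4 i k = solve 2 (λ n e → (con (+ 4) :- con (+ 4)) :* :1 :+ (con (+ 4) :* n) :* e := (con (+ 4) :* n) :* e)
          refl N (unit i k)

-- The numbers of points and the minima

data Label (d : ℕ) : Set where
  e⁺-label e⁻-label r-label p-label : Fin d → Label d

module Theorem (em : ExcludedMiddle 0ℓ) (ℝ : RealField) where

  open TruncatedCross em ℝ public

  FewPairs : ℕ → ℕ → Set
  FewPairs d n = Σ[ x ∈ (Fin n → Point d) ] StrictlyConvexConfiguration x × sa x ℕ.≤ d ℕ.* 2

  -- Either every edge from the apex gets its own point r i, or all of them shrink
  -- to the apex, so that the single point in R stands for every r i.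
  module Labels {d : ℕ} (3≤d : 3 ℕ.≤ d) (R J : List (Fin d)) (R! : Unique R) (J! : Unique J)
    (ρ : Fin d → Fin d) (ρ∈ : ∀ i → ρ i ∈ R) (ρ-fixed : ∀ {i} → i ∈ R → ρ i ≡ i)
    (κ : K) (0≤κ : 0# ≤ κ) (κ<1 : κ < 1#)
    (h : ((∀ i → ρ i ≡ i) × 0# < κ) ⊎ ((∀ i j → ρ i ≡ ρ j) × κ ≈ 0#)) where

    open Coordinates d 3≤d

    -- The coefficient 2 places `p i` strictly between the negated apex and `e⁻ i`; the coefficient
    -- 4 makes it coincide with `e⁻ i`. So exactly the members of `J` add a point.
    value : ∀ {i} → Dec (i ∈ J) → K
    value (yes _) = two
    value (no _)  = four

    s : Fin d → K
    s i = value (∈?-with Fin._≟_ i J)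

    two<four : two < four
    two<four = by< (0<+0< 0<1 0<1) (solve 0 (con (+ 4) :- con (+ 2) := :1 :+ :1) refl)

    2≤value : ∀ {i} (δ : Dec (i ∈ J)) → two ≤ value δ
    2≤value (yes _) = ≤-refl
    2≤value (no _)  = <⇒≤ two<four

    value≤4 : ∀ {i} (δ : Dec (i ∈ J)) → value δ ≤ four
    value≤4 (yes _) = <⇒≤ two<four
    value≤4 (no _)  = ≤-refl

    point : Label d → Point d
    point (e⁺-label i) = pt four i
    point (e⁻-label i) = negᵥ (pt four i)
    point (r-label i)  = pt (κ * s i) i
    point (p-label i)  = negᵥ (pt two i)

    e⁺-labels e⁻-labels r-labels p-labels labels : List (Label d)
    e⁺-labels = map e⁺-label (allFin d)
    e⁻-labels = map e⁻-label (allFin d)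
    r-labels  = map r-label R
    p-labels  = map p-label J
    labels    = e⁺-labels ++ e⁻-labels ++ r-labels ++ p-labels

    labels! : Unique labels
    labels! = Unique.++⁺ (Unique.map⁺ (λ { ≡.refl → ≡.refl }) (Unique.allFin⁺ d))
      (Unique.++⁺ (Unique.map⁺ (λ { ≡.refl → ≡.refl }) (Unique.allFin⁺ d))
        (Unique.++⁺ (Unique.map⁺ (λ { ≡.refl → ≡.refl }) R!) (Unique.map⁺ (λ { ≡.refl → ≡.refl }) J!) r-apart) e⁻-apart)
          e⁺-apart
      where
      r-apart : Disjoint r-labels p-labels
      r-apart (a , b) with ∈-map⁻ r-label a | ∈-map⁻ p-label b
      ... | _ , _ , ≡.refl | _ , _ , ()
      e⁻-apart : Disjoint e⁻-labels (r-labels ++ p-labels)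
      e⁻-apart (a , b) with ∈-map⁻ e⁻-label a | ∈-++⁻ r-labels b
      ... | _ , _ , ≡.refl | inj₁ c = case ∈-map⁻ r-label c of λ { (_ , _ , ()) }
      ... | _ , _ , ≡.refl | inj₂ c = case ∈-map⁻ p-label c of λ { (_ , _ , ()) }
      e⁺-apart : Disjoint e⁺-labels (e⁻-labels ++ r-labels ++ p-labels)
      e⁺-apart (a , b) with ∈-map⁻ e⁺-label a | ∈-++⁻ e⁻-labels b
      ... | _ , _ , ≡.refl | inj₁ c = case ∈-map⁻ e⁻-label c of λ { (_ , _ , ()) }
      ... | _ , _ , ≡.refl | inj₂ c with ∈-++⁻ r-labels c
      ...   | inj₁ c = case ∈-map⁻ r-label c of λ { (_ , _ , ()) }
      ...   | inj₂ c = case ∈-map⁻ p-label c of λ { (_ , _ , ()) }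

    x : Fin (length labels) → Point d
    x k = point (lookup labels k)

    x-point : ∀ {k c} → lookup labels k ≡ c → x k ≋ point c
    x-point eq k = reflexive (≡.cong (λ c → point c k) eq)

    e⁺-index : ∀ i → ∃[ k ] lookup labels k ≡ e⁺-label i
    e⁺-index i = ∈⇒lookup (∈-++⁺ˡ (∈-map⁺ e⁺-label (∈-allFin i)))

    e⁻-index : ∀ i → ∃[ k ] lookup labels k ≡ e⁻-label i
    e⁻-index i = ∈⇒lookup (∈-++⁺ʳ e⁺-labels (∈-++⁺ˡ (∈-map⁺ e⁻-label (∈-allFin i))))

    r-index : ∀ i → ∃[ k ] lookup labels k ≡ r-label (ρ i)
    r-index i = ∈⇒lookup (∈-++⁺ʳ e⁺-labels (∈-++⁺ʳ e⁻-labels (∈-++⁺ˡ (∈-map⁺ r-label (ρ∈ i)))))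

    p-index : ∀ {i} → i ∈ J → ∃[ k ] lookup labels k ≡ p-label i
    p-index i∈J = ∈⇒lookup (∈-++⁺ʳ e⁺-labels (∈-++⁺ʳ e⁻-labels (∈-++⁺ʳ r-labels (∈-map⁺ p-label i∈J))))

    e⁺ e⁻ r p : Fin d → Fin (length labels)
    e⁺ i = proj₁ (e⁺-index i)
    e⁻ i = proj₁ (e⁻-index i)
    r i  = proj₁ (r-index i)

    p-choice : ∀ {i} → Dec (i ∈ J) → Fin (length labels)
    p-choice {i} (yes i∈J) = proj₁ (p-index i∈J)
    p-choice {i} (no _)    = e⁻ i

    p i = p-choice (∈?-with Fin._≟_ i J)

    x-p : ∀ {i} (δ : Dec (i ∈ J)) → x (p-choice δ) ≋ negᵥ (pt (value δ) i)
    x-p {i} (yes i∈J) = x-point (proj₂ (p-index i∈J))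
    x-p {i} (no _)    = x-point (proj₂ (e⁻-index i))

    p-e⁻ : ∀ {i} (δ : Dec (i ∈ J)) → p-choice δ ≡ e⁻ i ⊎ value δ < four
    p-e⁻ (yes _) = inj₂ two<four
    p-e⁻ (no _)  = inj₁ ≡.refl

    p-label-choice : ∀ {i} (δ : Dec (i ∈ J)) → i ∈ J → lookup labels (p-choice δ) ≡ p-label i
    p-label-choice (yes i∈J) _   = proj₂ (p-index i∈J)
    p-label-choice (no i∉J)  i∈J = ⊥-elim (i∉J i∈J)

    x-r : ∀ i → x (r i) ≋ pt (κ * s i) i
    x-r i = ≋-trans (x-point (proj₂ (r-index i))) (moved h)
      where
      moved : ((∀ i → ρ i ≡ i) × 0# < κ) ⊎ ((∀ i j → ρ i ≡ ρ j) × κ ≈ 0#) → pt (κ * s (ρ i)) (ρ i) ≋ pt (κ * s i) i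
      moved (inj₁ (fixed , _)) k = reflexive (≡.cong (λ j → pt (κ * s j) j k) (fixed i))
      moved (inj₂ (_ , κ≈0))   k = trans (apex (s (ρ i)) (unit (ρ i) k)) (sym (apex (s i) (unit i k)))
        where
        apex : ∀ t y → (four - κ * t) * 1# + ((κ * t) * N) * y ≈ four
        apex t y = trans (+-cong (*-congʳ (+-congˡ (-‿cong (*-congʳ κ≈0)))) (*-congʳ (*-congʳ (*-congʳ κ≈0))))
          (solve 3 (λ t n y → (con (+ 4) :- :0 :* t) :* :1 :+ ((:0 :* t) :* n) :* y := con (+ 4)) refl t N y)

    r-merged : ∀ i j → r i ≡ r j ⊎ 0# < κ
    r-merged i j = case h of λ where
      (inj₁ (_ , 0<κ))    → inj₂ 0<κ
      (inj₂ (merged , _)) → inj₁ (lookup-unique labels!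
        (≡.trans (proj₂ (r-index i)) (≡.trans (≡.cong r-label (merged i j)) (≡.sym (proj₂ (r-index j))))))

    cover : ∀ {P : Fin (length labels) → Set} → (∀ i → P (e⁺ i)) → (∀ i → P (e⁻ i)) → (∀ i → P (r i)) →
      (∀ i → P (p i)) → ∀ k → P k
    cover {P} h⁺ h⁻ hr hp k = All.lookup everywhere (∈-lookup {xs = labels} k) k ≡.refl
      where
      At : Label d → Set
      At c = ∀ k → lookup labels k ≡ c → P k
      at : ∀ {c} l → lookup labels l ≡ c → P l → At c
      at l eq pl k eq′ = ≡.subst P (lookup-unique labels! (≡.trans eq (≡.sym eq′))) pl
      everywhere : All At labels
      everywhere = All.++⁺ (All.map⁺ (All.tabulate {xs = allFin d} λ {i} _ → at (e⁺ i) (proj₂ (e⁺-index i)) (h⁺ i)))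
        (All.++⁺ (All.map⁺ (All.tabulate {xs = allFin d} λ {i} _ → at (e⁻ i) (proj₂ (e⁻-index i)) (h⁻ i)))
        (All.++⁺ (All.map⁺ (All.tabulate λ {i} i∈R → at (r i)
          (≡.trans (proj₂ (r-index i)) (≡.cong r-label (ρ-fixed i∈R))) (hr i)))
                 (All.map⁺ (All.tabulate λ {i} i∈J → at (p i) (p-label-choice (∈?-with Fin._≟_ i J) i∈J) (hp i)))))

    open Caps x e⁺ e⁻ r p s κ (λ i → x-point (proj₂ (e⁺-index i))) (λ i → x-point (proj₂ (e⁻-index i))) x-r
      (λ i → x-p (∈?-with Fin._≟_ i J)) cover (λ i → 2≤value (∈?-with Fin._≟_ i J))
        (λ i → value≤4 (∈?-with Fin._≟_ i J))
      0≤κ κ<1 (λ i → p-e⁻ (∈?-with Fin._≟_ i J)) r-merged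

    length-labels : length labels ≡ d ℕ.+ (d ℕ.+ (length R ℕ.+ length J))
    length-labels = ≡.trans (length-++ e⁺-labels)
      (≡.cong₂ ℕ._+_ (≡.trans (length-map e⁺-label (allFin d)) (length-allFin d))
      (≡.trans (length-++ e⁻-labels) (≡.cong₂ ℕ._+_ (≡.trans (length-map e⁻-label (allFin d)) (length-allFin d))
      (≡.trans (length-++ r-labels) (≡.cong₂ ℕ._+_ (length-map r-label R) (length-map p-label J))))))

    few-pairs : FewPairs d (length labels)
    few-pairs = x , convex , sa≤2d (StrictlyConvexConfiguration.distinct convex)
      where
      convex : StrictlyConvexConfiguration x
      convex = capped-configuration (ℕ.≤-trans (ℕ.≤-trans (s≤s (s≤s z≤n)) 3≤d)
        (ℕ.≤-trans (ℕ.m≤m+n d _) (ℕ.≤-reflexive (≡.sym length-labels))))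

  -- To the `2 d` vertices of the cross-polytope one cap adds 1 or `d` points and the other any
  -- number `e ≤ d`; the two shapes together reach every `n` from `2 d + 1` to `4 d`.
  few-pairs : ∀ {d n} → 3 ℕ.≤ d → 2 ℕ.* d ℕ.+ 1 ℕ.≤ n → n ℕ.≤ 4 ℕ.* d → FewPairs d n
  few-pairs {d@(suc _)} {n} 3≤d 2d<n n≤4d = case ℕ.≤-<-connex n (3 ℕ.* d) of λ where
      (inj₁ n≤3d) → single (ℕ.m≤n⇒∃[o]m+o≡n 2d<n) n≤3d
      (inj₂ 3d<n) → several (ℕ.m≤n⇒∃[o]m+o≡n (ℕ.<⇒≤ 3d<n))
    where
    single : ∃[ e ] 2 ℕ.* d ℕ.+ 1 ℕ.+ e ≡ n → n ℕ.≤ 3 ℕ.* d → FewPairs d n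
    single (e , ≡.refl) n≤3d = realise (initial e e≤d)
      where
      e≤d : e ℕ.≤ d
      e≤d = ℕ.+-cancelˡ-≤ (2 ℕ.* d) e d (ℕ.≤-trans (ℕ.+-monoˡ-≤ e (ℕ.m≤m+n (2 ℕ.* d) 1))
        (ℕ.≤-trans n≤3d (ℕ.≤-reflexive (ℕ.+-comm d (2 ℕ.* d)))))
      realise : ∃[ J ] Unique {A = Fin d} J × length J ≡ e → FewPairs d (2 ℕ.* d ℕ.+ 1 ℕ.+ e)
      realise (J , J! , ≡.refl) = ≡.subst (FewPairs d) (≡.trans L.length-labels (arithmetic d (length J))) L.few-pairs
        where
        fixed : ∀ {i} → i ∈ zero ∷ [] → zero ≡ i
        fixed (here ≡.refl) = ≡.refl
        -- With `κ` zero all `r i` are the apex, which is listed once.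
        module L = Labels 3≤d (zero ∷ []) J ([] ∷ []) J! (λ _ → zero) (λ _ → here ≡.refl) fixed
          0# ≤-refl 0<1 (inj₂ ((λ _ _ → ≡.refl) , refl))
        arithmetic : ∀ d e → d ℕ.+ (d ℕ.+ (1 ℕ.+ e)) ≡ 2 ℕ.* d ℕ.+ 1 ℕ.+ e
        arithmetic = ℕ.solve-∀
    several : ∃[ e ] 3 ℕ.* d ℕ.+ e ≡ n → FewPairs d n
    several (e , ≡.refl) = realise (initial e e≤d)
      where
      e≤d : e ℕ.≤ d
      e≤d = ℕ.+-cancelˡ-≤ (3 ℕ.* d) e d (ℕ.≤-trans n≤4d (ℕ.≤-reflexive (ℕ.+-comm d (3 ℕ.* d))))
      realise : ∃[ J ] Unique {A = Fin d} J × length J ≡ e → FewPairs d (3 ℕ.* d ℕ.+ e)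
      realise (J , J! , ≡.refl) = ≡.subst (FewPairs d)
          (≡.trans L.length-labels (≡.trans (≡.cong (λ l → d ℕ.+ (d ℕ.+ (l ℕ.+ length J))) (length-allFin d))
            (arithmetic d (length J)))) L.few-pairs
        where
        κ<1 : proj₁ half < 1#
        κ<1 = by< (proj₁ (proj₂ half)) (trans (+-congʳ (sym (proj₂ (proj₂ half))))
          (solve 1 (λ k → (k :+ k) :- k := k) refl (proj₁ half)))
        -- With `κ` strictly between 0 and 1 there are `d` points `r i`; one half is an arbitrary
        -- choice.
        module L = Labels 3≤d (allFin d) J (Unique.allFin⁺ d) J! (λ i → i) ∈-allFin (λ _ → ≡.refl)
          (proj₁ half) (<⇒≤ (proj₁ (proj₂ half))) κ<1 (inj₁ ((λ _ → ≡.refl) , proj₁ (proj₂ half)))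
        arithmetic : ∀ d e → d ℕ.+ (d ℕ.+ (d ℕ.+ e)) ≡ 3 ℕ.* d ℕ.+ e
        arithmetic = ℕ.solve-∀

  minimum : (S : ℕ → Set) → ∃ S → ∃[ m ] IsMinimum S m
  minimum S (k , k∈S) = case below (suc k) of λ where
      (inj₁ m)     → m
      (inj₂ above) → ⊥-elim (ℕ.<-irrefl ≡.refl (above k k∈S))
    where
    below : ∀ b → (∃[ m ] IsMinimum S m) ⊎ (∀ k → S k → b ℕ.≤ k)
    below zero    = inj₂ λ _ _ → z≤n
    below (suc b) = case below b of λ where
      (inj₁ m)     → inj₁ m
      (inj₂ above) → case em {P = S b} of λ where
        (yes b∈S) → inj₁ (b , b∈S , above)
        (no b∉S)  → inj₂ λ k k∈S → ℕ.≤∧≢⇒< (above k k∈S) λ { ≡.refl → b∉S k∈S }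

  -- With fewer pairs the set would have a centre, and `n` would be the even number `sa x * 2`.
  sa-odd : ∀ {d n} (x : Fin n → Point d) → StrictlyConvexConfiguration x → 2 ℕ.≤ n → 3 ℕ.≤ d → n % 2 ≡ 1 →
    2 ℕ.* d ℕ.≤ sa x
  sa-odd {n = n} x conf 2≤n 3≤d odd = ℕ.≮⇒≥ λ few → case ≡.trans (≡.sym odd)
    (≡.trans (≡.cong (_% 2) (halved (few⇒centred 3≤d few))) (m*n%n≡0 (sa x) 2)) of λ ()
    where
    open AntipodalConfiguration x conf 2≤n
    halved : Centred → n ≡ sa x ℕ.* 2
    halved centred = ℕ.≤-antisym n≤2sa (2sa≤n centred)

  -- With fewer pairs the set would have a centre, and `2 d ≤ 2 sa x ≤ n`.
  sa-few-points : ∀ {d n} (x : Fin n → Point d) → StrictlyConvexConfiguration x → 2 ℕ.≤ n → 3 ℕ.≤ d → n ℕ.< 2 ℕ.* d →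
    2 ℕ.* d ℕ.≤ sa x
  sa-few-points {d} x conf 2≤n 3≤d n<2d = ℕ.≮⇒≥ λ few → ℕ.<-irrefl ≡.refl
    (ℕ.≤-<-trans (ℕ.≤-trans (ℕ.≤-reflexive (ℕ.*-comm 2 d)) (ℕ.*-monoˡ-≤ 2 d≤sa))
      (ℕ.≤-<-trans (2sa≤n (few⇒centred 3≤d few)) n<2d))
    where open AntipodalConfiguration x conf 2≤n

  sa-minima : (d : ℕ) → 3 ℕ.≤ d →
    (∀ n → 2 ℕ.* d ℕ.+ 1 ℕ.≤ n → n ℕ.≤ 4 ℕ.* d ℕ.∸ 1 → n % 2 ≡ 1 →
      IsMinimum (saValues d n) (2 ℕ.* d))
    × (∀ n → d ℕ.+ 2 ℕ.≤ n → n ℕ.≤ 2 ℕ.* d ℕ.∸ 1 →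
      ∃[ m ] IsMinimum (saValues d n) m × 2 ℕ.* d ℕ.≤ m)
    × ((x : Fin (2 ℕ.* d) → Point d) → StrictlyConvexConfiguration x →
      (IsCrossPolytope (conv x) × sa x ≡ d)
      ⊎ (¬ IsCrossPolytope (conv x) × 2 ℕ.* d ℕ.≤ sa x))
  sa-minima d 3≤d =
    (λ n 2d<n n<4d odd →
      let 2≤n = ℕ.≤-trans (ℕ.≤-trans 2≤2d (ℕ.m≤m+n (2 ℕ.* d) 1)) 2d<n
          x , conf , sa≤ = few-pairs 3≤d 2d<n (ℕ.≤-trans n<4d (ℕ.m∸n≤m (4 ℕ.* d) 1))
      in (x , conf , ℕ.≤-antisym (ℕ.≤-trans sa≤ (ℕ.≤-reflexive (ℕ.*-comm d 2))) (sa-odd x conf 2≤n 3≤d odd))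
         , λ { _ (y , conf-y , ≡.refl) → sa-odd y conf-y 2≤n 3≤d odd })
    , (λ n d+2≤n n<2d →
      let n<2d′ = ℕ.≤-trans (s≤s n<2d) (ℕ.≤-reflexive (ℕ.m+[n∸m]≡n {1} (ℕ.≤-trans (s≤s z≤n) 2≤2d)))
          m , (x , conf , sa≡m) , least = minimum (saValues d n) (saValues-nonempty d n 3≤d
            (ℕ.≤-trans (ℕ.≤-trans (ℕ.≤-reflexive (ℕ.+-comm 1 d)) (ℕ.+-monoʳ-≤ d (s≤s z≤n))) d+2≤n) (ℕ.<⇒≤ n<2d′))
      in m , ((x , conf , sa≡m) , least)
         , ≡.subst (2 ℕ.* d ℕ.≤_) sa≡m (sa-few-points x conf (ℕ.≤-trans (ℕ.m≤n+m 2 d) d+2≤n) 3≤d n<2d′))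
    , λ x conf → crossPolytope-dichotomy x conf 2≤2d ≡.refl 3≤d
    where
    2≤2d : 2 ℕ.≤ 2 ℕ.* d
    2≤2d = ℕ.*-monoʳ-≤ 2 (ℕ.≤-trans (s≤s z≤n) 3≤d)

open import Data.Nat.Base using (_+_; _*_; _∸_; _≤_)
open import Data.Vec.Functional using (Vector)

theorem2p4 : (em : ExcludedMiddle 0ℓ) (ℝ : RealField) (d : ℕ) → 3 ≤ d →
    let open Geometry em ℝ in
    (∀ n → 2 * d + 1 ≤ n → n ≤ 4 * d ∸ 1 → n % 2 ≡ 1 →
    IsMinimum (saValues d n) (2 * d))
    × (∀ n → d + 2 ≤ n → n ≤ 2 * d ∸ 1 →
    ∃[ m ] IsMinimum (saValues d n) m × 2 * d ≤ m)
    × ((x : Vector (Point d) (2 * d)) → StrictlyConvexConfiguration x →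
    (IsCrossPolytope (conv x) × sa x ≡ d)
    ⊎ (¬ IsCrossPolytope (conv x) × 2 * d ≤ sa x))
theorem2p4 = Theorem.sa-minima
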